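{- Let $\alpha$ be a real number not in $\mathbb{Q}(\mathbf{H}_4)$. Let $\frac{r_i}{s_i}$ be the $i$-th convergent of the Rosen continued fraction of $\alpha$ and let $\frac{\tilde r_i}{\tilde s_i}$ be the $i$-th convergent of the dual Rosen continued fraction of $\alpha$. Then $p/q\in\mathbb{Q}(\mathbf{H}_4)$ is an $\mathbf{H}_4$-best approximation of $\alpha$ if and only if $$\frac pq=\frac{r_i}{s_i}\ \text{ for some } i\ge0\qquad\text{or}\qquad \frac pq=\frac{\tilde r_i}{\tilde s_i}\ \text{ for some } i\ge1.$$
   Context: The Hecke group $\mathbf{H}_4$ is the subgroup of $\mathrm{PSL}_2(\mathbb{R})$ generated by $\begin{pmatrix}1&\sqrt2\\0&1\end{pmatrix}$ and $\begin{pmatrix}0&-1\\1&0\end{pmatrix}$. The set $\mathbb{Q}(\mathbf{H}_4)\subset \mathbb{R}\cup\{\infty\}$ is the set of all $p/q$ such that $\begin{pmatrix} p & r \\ q & s \end{pmatrix}\in\mathbf{H}_4$ for some $r,s$; its finite elements form the set $\sqrt2\,\mathbb{Q}$. Writing $p/q\in\mathbb{Q}(\mathbf{H}_4)$ always means the normalized form: $(p,q)$ is the first column of a matrix in $\mathbf{H}_4$ with $q>0$. Explicitly, either $p=a$, $q=\sqrt2\,c$ with $a,c\in\mathbb{Z}$, $c>0$, $\gcd(a,2c)=1$, or $p=\sqrt2\,a$, $q=c$ with $a,c\in\mathbb{Z}$, $c>0$, $\gcd(2a,c)=1$. $p/q\in\mathbb{Q}(\mathbf{H}_4)$ is an $\mathbf{H}_4$-best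 approximation of a real number $\alpha$ if for any $r/s\in\mathbb{Q}(\mathbf{H}_4)$ with $r/s\ne p/q$ and $0<s\le q$ one has $|s\alpha-r|>|q\alpha-p|$. Notation: for $a_0\in\mathbb{Z}$, $a_i\in\mathbb{N}$ (positive integers) and $\epsilon_i\in\{ -1,+1\}$ ($i\ge1$), $$\llbracket a_0;\epsilon_1/a_1,\epsilon_2/a_2,\dots\rrbracket = a_0\sqrt2+\cfrac{\epsilon_1}{a_1\sqrt2+\cfrac{\epsilon_2}{a_2\sqrt2+\ddots}},$$ and $\llbracket a_0;\epsilon_1/a_1,\dots,\epsilon_i/a_i\rrbracket$ is the corresponding finite expression, called the $i$-th convergent. Rosen continued fraction of $\alpha\in\mathbb{R}\setminus\mathbb{Q}(\mathbf{H}_4)$: the expansion $\alpha=\llbracket a_0;\epsilon_1/a_1,\epsilon_2/a_2,\dots\rrbracket$ with the rule that if $a_i=1$ with $i\ge1$ then $\epsilon_{i+1}=+1$. It is generated as follows: put $x_0=\alpha$; given $x_i$, let $a_i$ be the integer with $a_i\sqrt2-\frac1{\sqrt2}<x_i<a_i\sqrt2+\frac1{\sqrt2}$, let $\epsilon_{i+1}$ be the sign of $x_i-a_i\sqrt2$, and let $x_{i+1}=1/|x_i-a_i\sqrt2|$. Its $i$-th convergent is $\frac{r_i}{s_i}=\llbracket a_0;\epsilon_1/a_1,\dots,\epsilon_i/a_i\rrbracket$. Dual Rosen continued fraction of $\alpha$: the expansion $\alpha=\llbracket\tilde a_0;\tilde\epsilon_1/\tilde a_1,\tilde\epsilon_2/\tilde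 a_2,\dots\rrbracket$ with the rule that if $\tilde a_i=1$ with $i\ge1$ then $\tilde\epsilon_i=+1$. It is generated as follows: put $x_0=\alpha$; given $x_i$, let $\tilde a_i$ be the integer with $(\tilde a_i-1)\sqrt2+1\le x_i<\tilde a_i\sqrt2+1$, let $\tilde\epsilon_{i+1}$ be the sign of $x_i-\tilde a_i\sqrt2$, and let $x_{i+1}=1/|x_i-\tilde a_i\sqrt2|$. Its $i$-th convergent is $\frac{\tilde r_i}{\tilde s_i}=\llbracket\tilde a_0;\tilde\epsilon_1/\tilde a_1,\dots,\tilde\epsilon_i/\tilde a_i\rrbracket$. -}

module Defs where

open import Algebra.Bundles using (CommutativeRing)
open import Algebra.Core using (Op₁; Op₂)
open import Algebra.Structures using (IsCommutativeRing)
import Algebra.Properties.Semiring.Mult as SemiringMult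
open import Data.Integer.Base as ℤ using (ℤ; +_; -[1+_])
open import Data.Nat.Base using (ℕ; zero; suc)
open import Data.Product.Base using (∃; ∃₂; _×_; _,_)
open import Data.Sign.Base as Sign using (Sign)
open import Data.Sum.Base using (_⊎_)
open import Function.Base using (_∘_)
open import Level using (_⊔_) renaming (suc to lsuc)
open import Relation.Binary.Core using (Rel)
open import Relation.Binary.Definitions using (tri<; tri≈; tri>)
open import Relation.Binary.Structures using (IsStrictTotalOrder)
import Relation.Binary.Construct.StrictToNonStrict as StrictToNonStrict
open import Relation.Nullary.Negation.Core using (¬_)

-- The real numbers, characterised (classically, up to unique isomorphism)
-- as the Dedekind-complete ordered field.  The order is trichotomous, as it
-- is for the classical reals.

record CompleteOrderedField c ℓ : Set (lsuc (c ⊔ ℓ)) where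
  infix  4 _≈_ _<_
  infixl 6 _+_
  infixl 7 _*_ _/_
  infix  8 -_ _⁻¹
  field
    Carrier            : Set c
    _≈_ _<_            : Rel Carrier ℓ
    _+_ _*_            : Op₂ Carrier
    -_                 : Op₁ Carrier
    0# 1#              : Carrier
    isCommutativeRing  : IsCommutativeRing _≈_ _+_ _*_ -_ 0# 1#
    isStrictTotalOrder : IsStrictTotalOrder _≈_ _<_
    0≉1                : ¬ (0# ≈ 1#)
    +-monoˡ-<          : ∀ z {x y} → x < y → x + z < y + z
    *-pos              : ∀ {x y} → 0# < x → 0# < y → 0# < x * y

    -- A total operation; its value at 0# is left unspecified.
    _⁻¹                : Op₁ Carrier
    ⁻¹-cong            : ∀ {x y} → x ≈ y → x ⁻¹ ≈ y ⁻¹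
    ⁻¹-inverseʳ        : ∀ {x} → ¬ (x ≈ 0#) → x * x ⁻¹ ≈ 1#

  open StrictToNonStrict _≈_ _<_ public using (_≤_)

  field
    supremum : (P : Carrier → Set (c ⊔ ℓ)) →
               ∃ P →
               (∃ λ b → ∀ x → P x → x ≤ b) →
               ∃ λ s → (∀ x → P x → x ≤ s) ×
                       (∀ b → b < s → ∃ λ x → P x × b < x)

  commutativeRing : CommutativeRing c ℓ
  commutativeRing = record { isCommutativeRing = isCommutativeRing }

  open CommutativeRing commutativeRing public using (semiring; _-_)
  open IsStrictTotalOrder isStrictTotalOrder public using (compare)
  open SemiringMult semiring using () renaming (_×_ to _·_)

  _/_ : Op₂ Carrier
  x / y = x * y ⁻¹

  ∣_∣ : Op₁ Carrier
  ∣ x ∣ with compare x 0#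
  ... | tri< _ _ _ = - x
  ... | tri≈ _ _ _ = x
  ... | tri> _ _ _ = x

  fromℤ : ℤ → Carrier
  fromℤ (+ n)    = n · 1#
  fromℤ -[1+ n ] = - (suc n · 1#)

  fromSign : Sign → Carrier
  fromSign Sign.+ = 1#
  fromSign Sign.- = - 1#

  HasSign : Sign → Carrier → Set ℓ
  HasSign Sign.+ x = 0# < x
  HasSign Sign.- x = x < 0#

-- √2 is a parameter here; a statement using this module must assume that it
-- is the positive square root of 2.

module Hecke {c ℓ} (ℝ : CompleteOrderedField c ℓ)
             (√2 : CompleteOrderedField.Carrier ℝ) where

  open CompleteOrderedField ℝ

  -- mat p r q s is the matrix with rows (p , r) and (q , s).
  record Matrix : Set c where
    constructor mat
    field p r q s : Carrier

  _∙_ : Op₂ Matrix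
  mat p r q s ∙ mat p′ r′ q′ s′ =
    mat (p * p′ + r * q′) (p * r′ + r * s′)
        (q * p′ + s * q′) (q * r′ + s * s′)

  -- The inverse of a matrix of determinant 1.
  inverse : Op₁ Matrix
  inverse (mat p r q s) = mat s (- r) (- q) p

  negate : Op₁ Matrix
  negate (mat p r q s) = mat (- p) (- r) (- q) (- s)

  infix 4 _≋_ _≋±_

  _≋_ : Rel Matrix ℓ
  mat p r q s ≋ mat p′ r′ q′ s′ = p ≈ p′ × r ≈ r′ × q ≈ q′ × s ≈ s′

  -- Equality of the classes in PSL₂.
  _≋±_ : Rel Matrix ℓ
  M ≋± N = M ≋ N ⊎ M ≋ negate N

  -- H₄ M : M has determinant 1 and its class in PSL₂(ℝ) lies in the Hecke
  -- group, the subgroup generated by the first two matrices below.  The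
  -- determinant condition is automatic.
  data H₄ : Matrix → Set (c ⊔ ℓ) where
    translation : H₄ (mat 1# √2 0# 1#)
    inversion   : H₄ (mat 0# (- 1#) 1# 0#)
    identity    : H₄ (mat 1# 0# 0# 1#)
    product     : ∀ {M N} → H₄ M → H₄ N → H₄ (M ∙ N)
    inverted    : ∀ {M} → H₄ M → H₄ (inverse M)
    respects    : ∀ {M N} → M ≋± N → H₄ M → H₄ N

  -- p/q is the normalised form of a finite element of ℚ(H₄).
  IsNormalised : (p q : Carrier) → Set (c ⊔ ℓ)
  IsNormalised p q = 0# < q × ∃₂ λ r s → H₄ (mat p r q s)

  -- Membership of a real number in ℚ(H₄).
  _∈ℚH₄ : Carrier → Set (c ⊔ ℓ)
  x ∈ℚH₄ = ∃₂ λ p q → IsNormalised p q × x ≈ p / q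

  IsBestApproximation : (α p q : Carrier) → Set (c ⊔ ℓ)
  IsBestApproximation α p q =
    ∀ r s → IsNormalised r s → ¬ (r / s ≈ p / q) → s ≤ q →
    ∣ q * α - p ∣ < ∣ s * α - r ∣

  -- convergent a ε i = ⟦a₀; ε₁/a₁, …, εᵢ/aᵢ⟧; the value ε 0 is never used.
  convergent : (a : ℕ → ℤ) (ε : ℕ → Sign) → ℕ → Carrier
  convergent a ε zero    = fromℤ (a 0) * √2
  convergent a ε (suc i) =
    fromℤ (a 0) * √2 + fromSign (ε 1) / convergent (a ∘ suc) (ε ∘ suc) i

  -- The data produced by running an expansion algorithm on α.  The argument
  -- Digit says which integers a may be chosen as partial quotient at x.  As
  -- in convergent, ε 0 is a dummy.
  record Expansion (Digit : ℤ → Carrier → Set ℓ) (α : Carrier) :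
                   Set (c ⊔ ℓ) where
    field
      a     : ℕ → ℤ
      ε     : ℕ → Sign
      x     : ℕ → Carrier
      start : x 0 ≈ α
      digit : ∀ i → Digit (a i) (x i)
      sign  : ∀ i → HasSign (ε (suc i)) (x i - fromℤ (a i) * √2)
      step  : ∀ i → x (suc i) ≈ 1# / ∣ x i - fromℤ (a i) * √2 ∣

    convergents : ℕ → Carrier
    convergents = convergent a ε

  RosenDigit : ℤ → Carrier → Set ℓ
  RosenDigit a x = fromℤ a * √2 - 1# / √2 < x × x < fromℤ a * √2 + 1# / √2

  DualRosenDigit : ℤ → Carrier → Set ℓ
  DualRosenDigit a x =
    (fromℤ a - 1#) * √2 + 1# ≤ x × x < fromℤ a * √2 + 1#

  RosenExpansion : Carrier → Set (c ⊔ ℓ)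
  RosenExpansion = Expansion RosenDigit

  DualRosenExpansion : Carrier → Set (c ⊔ ℓ)
  DualRosenExpansion = Expansion DualRosenDigit

{-# OPTIONS --safe #-}
module Submission where

-- Call (t , u) the coordinates of a lattice vector in the basis formed by two consecutive
-- Rosen convergents.  They run through the pairs (odd integer , integer multiple of √2) and
-- (integer multiple of √2 , odd integer), the denominator of the vector is proportional to
-- u + t y and its error to u - ε t x, where y < 1 is a quotient of denominators and x > √2 a
-- complete quotient.  Elementary inequalities then show that the best approximations are
-- the Rosen convergents vₙ and, when εₙ₊₁ = -1 and xₙ₊₁ < 1 + √2, the vectors vₙ - √2 vₙ₋₁.
-- Running both algorithms in parallel shows that the n-th dual convergent is vₙ - √2 vₙ₋₁ in
-- exactly these cases and vₙ otherwise.

open import Defs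
import Algebra.Properties.AbelianGroup as AbelianGroupProperties
import Algebra.Properties.Ring as RingProperties
import Algebra.Properties.Semiring.Mult as SemiringMult
import Algebra.Solver.Ring as RingSolver
import Algebra.Solver.Ring.NaturalCoefficients.Default as SemiringSolver
open import Algebra.Bundles using (CommutativeRing; RawRing)
open import Algebra.Solver.Ring.AlmostCommutativeRing
  using (AlmostCommutativeRing; fromCommutativeRing; _-Raw-AlmostCommutative⟶_)
open import Data.Bool.Base using (Bool; true; false; T)
open import Data.Empty using (⊥; ⊥-elim)
open import Data.Fin.Base using (Fin)
open import Data.Integer.Base as ℤ using (ℤ; +_; -[1+_]; _⊖_; _◃_)
import Data.Integer.Properties as ℤ
open import Data.List.Base using (List; []; _∷_)
open import Data.Maybe.Base as Maybe using (Maybe; just; is-just)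
open import Data.Nat.Base as ℕ using (ℕ; zero; suc)
import Data.Nat.Properties as ℕ
open import Data.Product.Base using (∃; ∃₂; _×_; _,_; proj₁; proj₂)
open import Data.Product.Properties using (≡-dec)
open import Data.Sign.Base as Sign using (Sign)
open import Data.Sum.Base using (_⊎_; inj₁; inj₂)
open import Data.Vec.Base as Vec using (Vec; []; _∷_; lookup; allFin)
open import Data.Vec.N-ary using (N-ary; _$ⁿ_)
open import Function.Base using (_∘_)
open import Function.Bundles using (_⇔_; mk⇔)
open import Level as Level using (0ℓ; Lift; lift; lower)
open import Relation.Binary.Definitions using (tri<; tri≈; tri>)
import Relation.Binary.PropositionalEquality as ≡
open import Relation.Binary.PropositionalEquality using (_≡_)
import Relation.Binary.Reasoning.Setoid as SetoidReasoning
open import Relation.Binary.Structures using (IsStrictTotalOrder)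
open import Relation.Nullary.Decidable.Core using (dec⇒maybe)
open import Relation.Nullary.Negation.Core using (¬_)

-- The parities of (t , u) come from the group. If the columns of M are two consecutive convergents
-- up to sign and N has first column (p , q), then (u , t) is, up to sign, the first column of M⁻¹N,
-- again an element of the group. The possible absolute values 0, 1, √2, 2√2, 3, ... are spaced
-- widely enough for linear bounds to single out one vector.
--
-- The constants √2 - 1 and 1 + √2 are the two fixed points of w ↦ 1 / (2√2 - w). A Rosen digit
-- followed by the sign -1 is at least 2, so y < √2 - 1 reproduces itself along such signs; x < 1 +
-- √2 reproduces itself along digits 2 for the same reason.
--
-- The vector vₙ - √2 vₙ₋₁ comes from the digit intervals. Rosen remainders x - a√2 lie in (-1/√2 ,
-- 1/√2), dual ones in [1 - √2 , 1), both of length √2. They agree unless the Rosen remainder is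
-- below 1 - √2, that is, εₙ₊₁ = -1 and xₙ₊₁ < 1 + √2; then the dual digit drops by one, which
-- subtracts √2 vₙ₋₁.
--
-- The field is abstract, so each inequality carries an explicit certificate, checked by normalising
-- polynomials over ℤ[√2].

module OrderedField {c ℓ} (ℝ : CompleteOrderedField c ℓ) where

  open CompleteOrderedField ℝ public
  open CommutativeRing commutativeRing public
    using ( ring; commutativeSemiring; +-abelianGroup; setoid; refl; sym; trans; reflexive
          ; +-cong; +-congˡ; +-congʳ; *-cong; *-congˡ; *-congʳ; -‿cong
          ; +-assoc; +-comm; +-identityˡ; +-identityʳ; -‿inverseˡ; -‿inverseʳ
          ; *-assoc; *-comm; *-identityˡ; *-identityʳ; zeroˡ; zeroʳ )
  open RingProperties ring public
    using (-‿distribˡ-*; -‿distribʳ-*; -1*x≈-x)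
  open AbelianGroupProperties +-abelianGroup public
    using (⁻¹-∙-comm; ⁻¹-involutive; ε⁻¹≈ε)
  open SemiringMult semiring public
    using (×-homo-+; ×1-homo-*) renaming (_×_ to _·_)
  open IsStrictTotalOrder isStrictTotalOrder public
    using (<-respˡ-≈; <-respʳ-≈) renaming (trans to <-trans; irrefl to <-irrefl)
  open SetoidReasoning setoid

  ¬0<0 : ¬ (0# < 0#)
  ¬0<0 = <-irrefl refl

  0<-resp-≈ : ∀ {x y} → x ≈ y → 0# < x → 0# < y
  0<-resp-≈ = <-respʳ-≈

  x<y⇒0<y-x : ∀ {x y} → x < y → 0# < y - x
  x<y⇒0<y-x {x} x<y = <-respˡ-≈ (-‿inverseʳ x) (+-monoˡ-< (- x) x<y)

  0<+0<⇒0< : ∀ {x y} → 0# < x → 0# < y → 0# < x + y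
  0<+0<⇒0< {x} {y} 0<x 0<y =
    <-trans 0<y (<-respˡ-≈ (+-identityˡ y) (+-monoˡ-< y 0<x))

  x<0⇒0<-x : ∀ {x} → x < 0# → 0# < - x
  x<0⇒0<-x {x} x<0 = 0<-resp-≈ (+-identityˡ (- x)) (x<y⇒0<y-x x<0)

  -x*-y≈x*y : ∀ x y → - x * - y ≈ x * y
  -x*-y≈x*y x y = begin
    - x * - y    ≈⟨ -‿distribʳ-* (- x) y ⟨
    - (- x * y)  ≈⟨ -‿cong (-‿distribˡ-* x y) ⟨
    - - (x * y)  ≈⟨ ⁻¹-involutive (x * y) ⟩
    x * y        ∎

  0<1 : 0# < 1#
  0<1 with compare 0# 1#
  ... | tri< 0<1 _ _ = 0<1
  ... | tri≈ _ 0≈1 _ = ⊥-elim (0≉1 0≈1)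
  ... | tri> _ _ 1<0 = 0<-resp-≈ (trans (-x*-y≈x*y 1# 1#) (*-identityˡ 1#))
                         (*-pos (x<0⇒0<-x 1<0) (x<0⇒0<-x 1<0))

  -- The ring homomorphism from the integers to the field.

  fromSign-homo-* : ∀ s t → fromSign (s Sign.* t) ≈ fromSign s * fromSign t
  fromSign-homo-* Sign.+ t      = sym (*-identityˡ _)
  fromSign-homo-* Sign.- Sign.+ = sym (*-identityʳ _)
  fromSign-homo-* Sign.- Sign.- = sym (trans (-x*-y≈x*y 1# 1#) (*-identityˡ 1#))

  fromℤ-◃ : ∀ s n → fromℤ (s ◃ n) ≈ fromSign s * (n · 1#)
  fromℤ-◃ s      zero    = sym (zeroʳ (fromSign s))
  fromℤ-◃ Sign.+ (suc n) = sym (*-identityˡ _)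
  fromℤ-◃ Sign.- (suc n) = sym (-1*x≈-x _)

  fromℤ-⊖ : ∀ m n → fromℤ (m ⊖ n) ≈ m · 1# - n · 1#
  fromℤ-⊖ zero    zero    = sym (-‿inverseʳ 0#)
  fromℤ-⊖ zero    (suc n) = sym (+-identityˡ _)
  fromℤ-⊖ (suc m) zero    = sym (trans (+-congˡ ε⁻¹≈ε) (+-identityʳ _))
  fromℤ-⊖ (suc m) (suc n) = begin
    fromℤ (suc m ⊖ suc n)                ≡⟨ ≡.cong fromℤ (ℤ.[1+m]⊖[1+n]≡m⊖n m n) ⟩
    fromℤ (m ⊖ n)                        ≈⟨ fromℤ-⊖ m n ⟩
    M - N                                ≈⟨ +-congʳ (+-identityˡ M) ⟨
    0# + M - N                           ≈⟨ +-congʳ (+-congʳ (-‿inverseˡ 1#)) ⟨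
    - 1# + 1# + M - N                    ≈⟨ +-congʳ (+-assoc (- 1#) 1# M) ⟩
    - 1# + (1# + M) - N                  ≈⟨ +-congʳ (+-comm (- 1#) (1# + M)) ⟩
    1# + M + - 1# - N                    ≈⟨ +-assoc (1# + M) (- 1#) (- N) ⟩
    1# + M + (- 1# - N)                  ≈⟨ +-congˡ (⁻¹-∙-comm 1# N) ⟩
    1# + M - (1# + N)                    ∎
    where M = m · 1#
          N = n · 1#

  fromℤ-homo-+ : ∀ i j → fromℤ (i ℤ.+ j) ≈ fromℤ i + fromℤ j
  fromℤ-homo-+ (+ m)    (+ n)    = ×-homo-+ 1# m n
  fromℤ-homo-+ (+ m)    -[1+ n ] = fromℤ-⊖ m (suc n)
  fromℤ-homo-+ -[1+ m ] (+ n)    = trans (fromℤ-⊖ n (suc m)) (+-comm _ _)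
  fromℤ-homo-+ -[1+ m ] -[1+ n ] = begin
    - (suc (suc (m ℕ.+ n)) · 1#)       ≡⟨ ≡.cong (λ k → - (suc k · 1#)) (ℕ.+-suc m n) ⟨
    - ((suc m ℕ.+ suc n) · 1#)         ≈⟨ -‿cong (×-homo-+ 1# (suc m) (suc n)) ⟩
    - (suc m · 1# + suc n · 1#)        ≈⟨ ⁻¹-∙-comm _ _ ⟨
    - (suc m · 1#) - suc n · 1#        ∎


  fromℤ-homo-neg : ∀ i → fromℤ (ℤ.- i) ≈ - fromℤ i
  fromℤ-homo-neg (+ zero)  = sym ε⁻¹≈ε
  fromℤ-homo-neg (+ suc n) = refl
  fromℤ-homo-neg -[1+ n ]  = sym (⁻¹-involutive _)

  fromℤ-sign-∣∣ : ∀ i → fromℤ i ≈ fromSign (ℤ.sign i) * (ℤ.∣ i ∣ · 1#)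
  fromℤ-sign-∣∣ (+ n)    = sym (*-identityˡ _)
  fromℤ-sign-∣∣ -[1+ n ] = sym (-1*x≈-x _)

  *-interchange : ∀ w x y z → (w * x) * (y * z) ≈ (w * y) * (x * z)
  *-interchange w x y z = begin
    (w * x) * (y * z)  ≈⟨ *-assoc w x (y * z) ⟩
    w * (x * (y * z))  ≈⟨ *-congˡ (*-assoc x y z) ⟨
    w * (x * y * z)    ≈⟨ *-congˡ (*-congʳ (*-comm x y)) ⟩
    w * (y * x * z)    ≈⟨ *-congˡ (*-assoc y x z) ⟩
    w * (y * (x * z))  ≈⟨ *-assoc w y (x * z) ⟨
    (w * y) * (x * z)  ∎

  fromℤ-homo-* : ∀ i j → fromℤ (i ℤ.* j) ≈ fromℤ i * fromℤ j
  fromℤ-homo-* i j = begin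
    fromℤ (s Sign.* t ◃ m ℕ.* n)                        ≈⟨ fromℤ-◃ (s Sign.* t) (m ℕ.* n) ⟩
    fromSign (s Sign.* t) * ((m ℕ.* n) · 1#)            ≈⟨ *-cong (fromSign-homo-* s t) (×1-homo-* m n) ⟩
    (fromSign s * fromSign t) * (m · 1# * (n · 1#))     ≈⟨ *-interchange _ _ _ _ ⟩
    (fromSign s * (m · 1#)) * (fromSign t * (n · 1#))   ≈⟨ *-cong (fromℤ-sign-∣∣ i) (fromℤ-sign-∣∣ j) ⟨
    fromℤ i * fromℤ j                                   ∎
    where s = ℤ.sign i
          t = ℤ.sign j
          m = ℤ.∣ i ∣
          n = ℤ.∣ j ∣

-- The pair (a , b) stands for a + b√2. Equality of pairs is decidable and multiplication replaces
-- √2 · √2 by 2, so a ring solver with these coefficients can decide whether a polynomial involving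
-- √2 vanishes.
ℤ[√2] : RawRing 0ℓ 0ℓ
ℤ[√2] = record
  { Carrier = ℤ × ℤ
  ; _≈_     = _≡_
  ; _+_     = λ { (a , b) (c , d) → a ℤ.+ c , b ℤ.+ d }
  ; _*_     = λ { (a , b) (c , d) →
                  a ℤ.* c ℤ.+ + 2 ℤ.* (b ℤ.* d) , a ℤ.* d ℤ.+ b ℤ.* c }
  ; -_      = λ { (a , b) → ℤ.- a , ℤ.- b }
  ; 0#      = + 0 , + 0
  ; 1#      = + 1 , + 0
  }

-- Inequalities certified by identities over ℤ[√2].

module Inequalities {c ℓ} (ℝ : CompleteOrderedField c ℓ)
  (√2 : CompleteOrderedField.Carrier ℝ)
  (0<√2 : CompleteOrderedField._<_ ℝ (CompleteOrderedField.0# ℝ) √2)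
  (√2*√2≈2 : CompleteOrderedField._≈_ ℝ (CompleteOrderedField._*_ ℝ √2 √2)
     (CompleteOrderedField._+_ ℝ (CompleteOrderedField.1# ℝ) (CompleteOrderedField.1# ℝ)))
  where

  open OrderedField ℝ
  open SetoidReasoning setoid

  private
    almostRing : AlmostCommutativeRing c ℓ
    almostRing = fromCommutativeRing commutativeRing

    evaluate : ℤ × ℤ → Carrier
    evaluate (a , b) = fromℤ a + fromℤ b * √2

    evaluate-homo-+ : ∀ x y → evaluate (RawRing._+_ ℤ[√2] x y) ≈ evaluate x + evaluate y
    evaluate-homo-+ (a , b) (c , d) = begin
      fromℤ (a ℤ.+ c) + fromℤ (b ℤ.+ d) * √2
        ≈⟨ +-cong (fromℤ-homo-+ a c) (*-congʳ (fromℤ-homo-+ b d)) ⟩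
      (fromℤ a + fromℤ c) + (fromℤ b + fromℤ d) * √2
        ≈⟨ solve 5 (λ a b c d s → (a :+ c) :+ (b :+ d) :* s :=
             (a :+ b :* s) :+ (c :+ d :* s)) refl (fromℤ a) (fromℤ b) (fromℤ c) (fromℤ d) √2 ⟩
      evaluate (a , b) + evaluate (c , d)  ∎
      where open SemiringSolver commutativeSemiring

    evaluate-homo-* : ∀ x y → evaluate (RawRing._*_ ℤ[√2] x y) ≈ evaluate x * evaluate y
    evaluate-homo-* (a , b) (c , d) = begin
      fromℤ (a ℤ.* c ℤ.+ + 2 ℤ.* (b ℤ.* d)) + fromℤ (a ℤ.* d ℤ.+ b ℤ.* c) * √2
        ≈⟨ +-cong (fromℤ-homo-+ (a ℤ.* c) _) (*-congʳ (fromℤ-homo-+ (a ℤ.* d) _)) ⟩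
      (fromℤ (a ℤ.* c) + fromℤ (+ 2 ℤ.* (b ℤ.* d))) + (fromℤ (a ℤ.* d) + fromℤ (b ℤ.* c)) * √2
        ≈⟨ +-cong (+-cong (fromℤ-homo-* a c) (trans (fromℤ-homo-* (+ 2) (b ℤ.* d)) (*-congˡ (fromℤ-homo-* b d))))
                  (*-congʳ (+-cong (fromℤ-homo-* a d) (fromℤ-homo-* b c))) ⟩
      (A * C + fromℤ (+ 2) * (B * D)) + (A * D + B * C) * √2
        ≈⟨ +-congʳ (+-congˡ (*-congʳ (trans (+-congˡ (+-identityʳ 1#)) (sym √2*√2≈2)))) ⟩
      (A * C + (√2 * √2) * (B * D)) + (A * D + B * C) * √2
        ≈⟨ solve 5 (λ a b c d s → (a :* c :+ (s :* s) :* (b :* d)) :+ (a :* d :+ b :* c) :* s :=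
             (a :+ b :* s) :* (c :+ d :* s)) refl A B C D √2 ⟩
      evaluate (a , b) * evaluate (c , d)  ∎
      where
      open SemiringSolver commutativeSemiring
      A = fromℤ a
      B = fromℤ b
      C = fromℤ c
      D = fromℤ d

    evaluate-homo-neg : ∀ x → evaluate (RawRing.-_ ℤ[√2] x) ≈ - evaluate x
    evaluate-homo-neg (a , b) = begin
      fromℤ (ℤ.- a) + fromℤ (ℤ.- b) * √2  ≈⟨ +-cong (fromℤ-homo-neg a) (*-congʳ (fromℤ-homo-neg b)) ⟩
      - fromℤ a + - fromℤ b * √2          ≈⟨ +-congˡ (-‿distribˡ-* (fromℤ b) √2) ⟨
      - fromℤ a - fromℤ b * √2            ≈⟨ ⁻¹-∙-comm (fromℤ a) _ ⟩
      - evaluate (a , b)                  ∎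

    evaluate-0 : evaluate (+ 0 , + 0) ≈ 0#
    evaluate-0 = trans (+-identityˡ _) (zeroˡ √2)

    evaluate-1 : evaluate (+ 1 , + 0) ≈ 1#
    evaluate-1 = trans (+-cong (+-identityʳ 1#) (zeroˡ √2)) (+-identityʳ 1#)

    evaluate-√2 : evaluate (+ 0 , + 1) ≈ √2
    evaluate-√2 = trans (+-identityˡ _) (trans (*-congʳ (+-identityʳ 1#)) (*-identityˡ √2))

    evaluate-morphism : ℤ[√2] -Raw-AlmostCommutative⟶ almostRing
    evaluate-morphism = record
      { ⟦_⟧    = evaluate
      ; +-homo = evaluate-homo-+
      ; *-homo = evaluate-homo-*
      ; -‿homo = evaluate-homo-neg
      ; 0-homo = evaluate-0
      ; 1-homo = evaluate-1
      }

    _≟ᶜ_ : ∀ x y → Maybe (evaluate x ≈ evaluate y)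
    x ≟ᶜ y = Maybe.map (λ x≡y → reflexive (≡.cong evaluate x≡y)) (dec⇒maybe (≡-dec ℤ._≟_ ℤ._≟_ x y))

    module Solver = RingSolver ℤ[√2] almostRing evaluate-morphism _≟ᶜ_

  infixl 6 _:+_ _:-_
  infixl 7 _:*_
  infix  8 :-_
  infix  9 #_

  -- Kept apart from the solver's polynomials so that `:0`, `:1` and `:√2` denote literally the
  -- field elements that occur in goals; a solver constant (a , b) denotes `fromℤ a + fromℤ b * √2`
  -- instead.
  data Expr (n : ℕ) : Set where
    var            : Fin n → Expr n
    :0 :1 :√2      : Expr n
    _:+_ _:*_ _:-_ : Expr n → Expr n → Expr n
    :-_            : Expr n → Expr n

  ⟦_⟧ : ∀ {n} → Expr n → Vec Carrier n → Carrier
  ⟦ var i  ⟧ ρ = lookup ρ i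
  ⟦ :0     ⟧ ρ = 0#
  ⟦ :1     ⟧ ρ = 1#
  ⟦ :√2    ⟧ ρ = √2
  ⟦ d :+ e ⟧ ρ = ⟦ d ⟧ ρ + ⟦ e ⟧ ρ
  ⟦ d :* e ⟧ ρ = ⟦ d ⟧ ρ * ⟦ e ⟧ ρ
  ⟦ d :- e ⟧ ρ = ⟦ d ⟧ ρ - ⟦ e ⟧ ρ
  ⟦ :- e   ⟧ ρ = - ⟦ e ⟧ ρ

  private
    polynomial : ∀ {n} → Expr n → Solver.Polynomial n
    polynomial (var i)  = Solver.var i
    polynomial :0       = Solver.con (+ 0 , + 0)
    polynomial :1       = Solver.con (+ 1 , + 0)
    polynomial :√2      = Solver.con (+ 0 , + 1)
    polynomial (d :+ e) = polynomial d Solver.:+ polynomial e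
    polynomial (d :* e) = polynomial d Solver.:* polynomial e
    polynomial (d :- e) = polynomial d Solver.:- polynomial e
    polynomial (:- e)   = Solver.:- polynomial e

    polynomial-correct : ∀ {n} (e : Expr n) ρ → Solver.⟦ polynomial e ⟧ ρ ≈ ⟦ e ⟧ ρ
    polynomial-correct (var i)  ρ = refl
    polynomial-correct :0       ρ = evaluate-0
    polynomial-correct :1       ρ = evaluate-1
    polynomial-correct :√2      ρ = evaluate-√2
    polynomial-correct (d :+ e) ρ = +-cong (polynomial-correct d ρ) (polynomial-correct e ρ)
    polynomial-correct (d :* e) ρ = *-cong (polynomial-correct d ρ) (polynomial-correct e ρ)
    polynomial-correct (d :- e) ρ =
      +-cong (polynomial-correct d ρ) (-‿cong (polynomial-correct e ρ))
    polynomial-correct (:- e)   ρ = -‿cong (polynomial-correct e ρ)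

    isZero : ∀ {n} → Expr n → Bool
    isZero e = is-just (Solver.normalise (polynomial e) Solver.≟N Solver.0N)

    isZero-sound : ∀ {n} (e : Expr n) ρ → isZero e ≡ true → 0# ≈ ⟦ e ⟧ ρ
    isZero-sound e ρ _ with Solver.normalise (polynomial e) Solver.≟N Solver.0N
    isZero-sound e ρ _ | just e≈0 = begin
      0#                                            ≈⟨ Solver.0N-homo ρ ⟨
      Solver.⟦ Solver.0N ⟧N ρ                       ≈⟨ Solver.⟦ e≈0 ⟧N-cong ρ ⟨
      Solver.⟦ Solver.normalise (polynomial e) ⟧N ρ ≈⟨ Solver.correct (polynomial e) ρ ⟩
      Solver.⟦ polynomial e ⟧ ρ                     ≈⟨ polynomial-correct e ρ ⟩
      ⟦ e ⟧ ρ                                       ∎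

  infix 5 _:<_ _:≤_ _:≈_
  infixr 4 _⊃_
  infix 4 ⊢_
  infix 3 _by_

  data Formula (n : ℕ) : Set where
    _:<_ _:≤_ _:≈_ : Expr n → Expr n → Formula n
    :⊥             : Formula n

  data Sequent (n : ℕ) : Set where
    ⊢_  : Formula n → Sequent n
    _⊃_ : Formula n → Sequent n → Sequent n

  ⟦_⟧ᶠ : ∀ {n} → Formula n → Vec Carrier n → Set ℓ
  ⟦ d :< e ⟧ᶠ ρ = ⟦ d ⟧ ρ < ⟦ e ⟧ ρ
  ⟦ d :≤ e ⟧ᶠ ρ = ⟦ d ⟧ ρ ≤ ⟦ e ⟧ ρ
  ⟦ d :≈ e ⟧ᶠ ρ = ⟦ d ⟧ ρ ≈ ⟦ e ⟧ ρ
  ⟦ :⊥     ⟧ᶠ ρ = Lift ℓ ⊥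

  ⟦_⟧ˢ : ∀ {n} → Sequent n → Vec Carrier n → Set ℓ
  ⟦ ⊢ φ   ⟧ˢ ρ = ⟦ φ ⟧ᶠ ρ
  ⟦ φ ⊃ s ⟧ˢ ρ = ⟦ φ ⟧ᶠ ρ → ⟦ s ⟧ˢ ρ

  data Status : Set where
    zer nonneg pos : Status

  private
    Has : Status → Carrier → Set ℓ
    Has zer    x = 0# ≈ x
    Has nonneg x = 0# ≤ x
    Has pos    x = 0# < x

    -- Minimum and maximum for the chain `zer`, `nonneg`, `pos`: a sum of nonnegative quantities is
    -- as positive as its best term, a product only as positive as its worst factor.
    _⊓_ _⊔_ : Status → Status → Status
    zer    ⊔ t      = t
    nonneg ⊔ zer    = nonneg
    nonneg ⊔ t      = t
    pos    ⊔ _      = pos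
    zer    ⊓ _      = zer
    nonneg ⊓ zer    = zer
    nonneg ⊓ _      = nonneg
    pos    ⊓ t      = t

    weaken : ∀ s {x} → Has s x → 0# ≤ x
    weaken zer    0≈x = inj₂ 0≈x
    weaken nonneg 0≤x = 0≤x
    weaken pos    0<x = inj₁ 0<x

    Has-resp-≈ : ∀ s {x y} → x ≈ y → Has s x → Has s y
    Has-resp-≈ zer    x≈y 0≈x        = trans 0≈x x≈y
    Has-resp-≈ nonneg x≈y (inj₁ 0<x) = inj₁ (0<-resp-≈ x≈y 0<x)
    Has-resp-≈ nonneg x≈y (inj₂ 0≈x) = inj₂ (trans 0≈x x≈y)
    Has-resp-≈ pos    x≈y 0<x        = 0<-resp-≈ x≈y 0<x

    0+ : ∀ {x y} → 0# ≈ x → y ≈ x + y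
    0+ {x} {y} 0≈x = trans (sym (+-identityˡ y)) (+-congʳ 0≈x)

    +0 : ∀ {x y} → 0# ≈ y → x ≈ x + y
    +0 {x} {y} 0≈y = trans (sym (+-identityʳ x)) (+-congˡ 0≈y)

    0* : ∀ {x y} → 0# ≈ x → 0# ≈ x * y
    0* {x} {y} 0≈x = trans (sym (zeroˡ y)) (*-congʳ 0≈x)

    *0 : ∀ {x y} → 0# ≈ y → 0# ≈ x * y
    *0 {x} {y} 0≈y = trans (sym (zeroʳ x)) (*-congˡ 0≈y)

    pos+nonneg : ∀ {x y} → 0# < x → 0# ≤ y → 0# < x + y
    pos+nonneg 0<x (inj₁ 0<y) = 0<+0<⇒0< 0<x 0<y
    pos+nonneg 0<x (inj₂ 0≈y) = 0<-resp-≈ (+0 0≈y) 0<x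

    nonneg*nonneg : ∀ {x y} → 0# ≤ x → 0# ≤ y → 0# ≤ x * y
    nonneg*nonneg (inj₁ 0<x) (inj₁ 0<y) = inj₁ (*-pos 0<x 0<y)
    nonneg*nonneg (inj₁ 0<x) (inj₂ 0≈y) = inj₂ (*0 0≈y)
    nonneg*nonneg (inj₂ 0≈x) _          = inj₂ (0* 0≈x)

    Has-+ : ∀ s t {x y} → Has s x → Has t y → Has (s ⊔ t) (x + y)
    Has-+ zer    t      0≈x 0?y = Has-resp-≈ t (0+ 0≈x) 0?y
    Has-+ nonneg zer    0≤x 0≈y = Has-resp-≈ nonneg (+0 0≈y) 0≤x
    Has-+ nonneg nonneg (inj₁ 0<x) 0≤y = inj₁ (pos+nonneg 0<x 0≤y)
    Has-+ nonneg nonneg (inj₂ 0≈x) 0≤y = Has-resp-≈ nonneg (0+ 0≈x) 0≤y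
    Has-+ nonneg pos    0≤x 0<y = 0<-resp-≈ (+-comm _ _) (pos+nonneg 0<y 0≤x)
    Has-+ pos    t      0<x 0?y = pos+nonneg 0<x (weaken t 0?y)

    Has-* : ∀ s t {x y} → Has s x → Has t y → Has (s ⊓ t) (x * y)
    Has-* zer    t      0≈x 0?y = 0* 0≈x
    Has-* nonneg zer    0≤x 0≈y = *0 0≈y
    Has-* nonneg nonneg 0≤x 0≤y = nonneg*nonneg 0≤x 0≤y
    Has-* nonneg pos    0≤x 0<y = nonneg*nonneg 0≤x (inj₁ 0<y)
    Has-* pos    zer    0<x 0≈y = *0 0≈y
    Has-* pos    nonneg 0<x 0≤y = nonneg*nonneg (inj₁ 0<x) 0≤y
    Has-* pos    pos    0<x 0<y = *-pos 0<x 0<y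

    -- Proved by hand because the checker takes √2 - 1 > 0 for granted. If √2 = 1 then 1 = 2 - 1 =
    -- 0; if √2 < 1 then (1 - √2)(1 + √2) + 1, which vanishes identically, would be positive.
    1<√2 : 1# < √2
    1<√2 with compare 1# √2
    ... | tri< 1<√2 _ _ = 1<√2
    ... | tri≈ _ 1≈√2 _ = ⊥-elim (¬0<0 (0<-resp-≈ (trans (sym 2-1≈1)
            (trans (+-congʳ (sym √2*√2≈2)) (trans (+-congʳ (trans (*-cong (sym 1≈√2) (sym 1≈√2)) (*-identityˡ 1#)))
              (-‿inverseʳ 1#)))) 0<1))
      where
      2-1≈1 : 1# + 1# - 1# ≈ 1#
      2-1≈1 = trans (+-assoc 1# 1# (- 1#)) (trans (+-congˡ (-‿inverseʳ 1#)) (+-identityʳ 1#))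
    ... | tri> _ _ √2<1 = ⊥-elim (¬0<0 (0<-resp-≈ (sym (isZero-sound 
            {0} ((:1 :- :√2) :* (:1 :+ :√2) :+ :1) [] ≡.refl))
          (0<+0<⇒0< (*-pos (x<y⇒0<y-x √2<1) (0<+0<⇒0< 0<1 0<√2)) 0<1)))

  infixl 6 _⊕_
  infixl 7 _⊗_ _⊙_

  -- A sum of products of hypotheses, of the negated goal and of the positive constants 1, √2
  -- and √2 - 1 (gap) refutes the negated goal once it is positive and vanishes identically.
  data Certificate (n : ℕ) : Set where
    hyp          : ℕ → Certificate n
    ¬goal        : Certificate n
    one root gap : Certificate n
    _⊕_ _⊗_      : Certificate n → Certificate n → Certificate n
    _⊙_          : Expr n → Certificate n → Certificate n

  _by_ : ∀ {n} → Sequent n → Certificate n → Sequent n × Certificate n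
  _by_ = _,_

  infix 8 _×ᶜ_
  infix 9 _^ᶜ_

  private
    Fact : ℕ → Set
    Fact n = Status × Expr n

    Holds : ∀ {n} → Fact n → Vec Carrier n → Set ℓ
    Holds (s , e) ρ = Has s (⟦ e ⟧ ρ)

    trivial : ∀ {n} → Fact n
    trivial = zer , :0

    fact : ∀ {n} → Formula n → Fact n
    fact (d :< e) = pos    , e :- d
    fact (d :≤ e) = nonneg , e :- d
    fact (d :≈ e) = zer    , e :- d
    fact :⊥       = trivial

    negation : ∀ {n} → Formula n → Fact n
    negation (d :< e) = nonneg , d :- e
    negation (d :≤ e) = pos    , d :- e
    negation _        = trivial

    at : ∀ {n} → List (Fact n) → ℕ → Fact n
    at []       _       = trivial
    at (φ ∷ φs) zero    = φ
    at (φ ∷ φs) (suc i) = at φs i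

    -- Only an equation may be multiplied by an expression of unknown sign; any other fact degrades
    -- to 0 = 0.
    scale : ∀ {n} → Expr n → Fact n → Fact n
    scale e (zer , d) = zer , e :* d
    scale e _         = trivial

    _+ᶠ_ _*ᶠ_ : ∀ {n} → Fact n → Fact n → Fact n
    (s , d) +ᶠ (t , e) = s ⊔ t , d :+ e
    (s , d) *ᶠ (t , e) = s ⊓ t , d :* e

    conclusion : ∀ {n} → List (Fact n) → Fact n → Certificate n → Fact n
    conclusion Γ ν (hyp i) = at Γ i
    conclusion Γ ν ¬goal   = ν
    conclusion Γ ν one     = pos , :1
    conclusion Γ ν root    = pos , :√2
    conclusion Γ ν gap     = pos , :√2 :- :1
    conclusion Γ ν (κ ⊕ μ) = conclusion Γ ν κ +ᶠ conclusion Γ ν μ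
    conclusion Γ ν (κ ⊗ μ) = conclusion Γ ν κ *ᶠ conclusion Γ ν μ
    conclusion Γ ν (e ⊙ κ) = scale e (conclusion Γ ν κ)

    hypotheses : ∀ {n} → Sequent n → List (Fact n)
    hypotheses (⊢ φ)   = []
    hypotheses (φ ⊃ s) = fact φ ∷ hypotheses s

    goal : ∀ {n} → Sequent n → Formula n
    goal (⊢ φ)   = φ
    goal (φ ⊃ s) = goal s

    -- Inequalities and `:⊥` are proved by refutation, through a positive fact that vanishes
    -- identically. An equation is derived directly, from a zero fact that is identically the
    -- difference of its sides.
    closes : ∀ {n} → Formula n → Fact n → Bool
    closes (d :≈ e) (zer , f) = isZero (f :- (e :- d))
    closes (d :≈ e) _         = false
    closes _        (pos , f) = isZero f
    closes _        _         = false

    check : ∀ {n} → Sequent n → Certificate n → Bool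
    check s κ = closes (goal s) (conclusion (hypotheses s) (negation (goal s)) κ)

    data All (n : ℕ) (ρ : Vec Carrier n) : List (Fact n) → Set ℓ where
      []  : All n ρ []
      _∷_ : ∀ {φ Γ} → Holds φ ρ → All n ρ Γ → All n ρ (φ ∷ Γ)

    x-y≈0⇒x≈y : ∀ {x y} → 0# ≈ y - x → x ≈ y
    x-y≈0⇒x≈y {x} {y} 0≈y-x = begin
      x            ≈⟨ 0+ 0≈y-x ⟩
      y - x + x    ≈⟨ +-assoc y (- x) x ⟩
      y + (- x + x) ≈⟨ +-congˡ (-‿inverseˡ x) ⟩
      y + 0#       ≈⟨ +-identityʳ y ⟩
      y            ∎

    fact-sound : ∀ {n} (φ : Formula n) ρ → ⟦ φ ⟧ᶠ ρ → Holds (fact φ) ρ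
    fact-sound (d :< e) ρ d<e = x<y⇒0<y-x d<e
    fact-sound (d :≤ e) ρ (inj₁ d<e) = inj₁ (x<y⇒0<y-x d<e)
    fact-sound (d :≤ e) ρ (inj₂ d≈e) = inj₂ (trans (sym (-‿inverseʳ _)) (+-congˡ (-‿cong (sym d≈e))))
    fact-sound (d :≈ e) ρ d≈e = trans (sym (-‿inverseʳ _)) (+-congˡ (-‿cong (sym d≈e)))
    fact-sound :⊥ ρ _ = refl

    at-sound : ∀ {n ρ Γ} → All n ρ Γ → ∀ i → Holds (at Γ i) ρ
    at-sound []      i       = refl
    at-sound (h ∷ _) zero    = h
    at-sound (_ ∷ Γ) (suc i) = at-sound Γ i

    scale-sound : ∀ {n ρ} (e : Expr n) φ → Holds φ ρ → Holds (scale e φ) ρ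
    scale-sound e (zer , d)    0≈d = *0 0≈d
    scale-sound e (nonneg , d) _   = refl
    scale-sound e (pos , d)    _   = refl

    conclusion-sound : ∀ {n ρ Γ} {ν : Fact n} → All n ρ Γ → Holds ν ρ →
                       ∀ κ → Holds (conclusion Γ ν κ) ρ
    conclusion-sound Γ ν (hyp i) = at-sound Γ i
    conclusion-sound Γ ν ¬goal   = ν
    conclusion-sound Γ ν one     = 0<1
    conclusion-sound Γ ν root    = 0<√2
    conclusion-sound Γ ν gap     = x<y⇒0<y-x 1<√2
    conclusion-sound {Γ = Δ} {φ} Γ ν (κ ⊕ μ) =
      Has-+ (proj₁ (conclusion Δ φ κ)) _
        (conclusion-sound {ν = φ} Γ ν κ) (conclusion-sound {ν = φ} Γ ν μ)
    conclusion-sound {Γ = Δ} {φ} Γ ν (κ ⊗ μ) =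
      Has-* (proj₁ (conclusion Δ φ κ)) _
        (conclusion-sound {ν = φ} Γ ν κ) (conclusion-sound {ν = φ} Γ ν μ)
    conclusion-sound {Γ = Δ} {φ} Γ ν (e ⊙ κ) =
      scale-sound e (conclusion Δ φ κ) (conclusion-sound {ν = φ} Γ ν κ)

    refute : ∀ {n ρ} (e : Expr n) → isZero e ≡ true → 0# < ⟦ e ⟧ ρ → ⊥
    refute {ρ = ρ} e e≡0 0<e = ¬0<0 (0<-resp-≈ (sym (isZero-sound e ρ e≡0)) 0<e)

    -- `ψ` is the conclusion of the certificate as a function of the negated goal: the negation is
    -- available only in those branches of the trichotomy where the goal fails.
    goal-sound : ∀ {n ρ} (φ : Formula n) (ψ : Fact n → Fact n) →
                 (∀ {ν} → Holds ν ρ → Holds (ψ ν) ρ) →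
                 closes φ (ψ (negation φ)) ≡ true → ⟦ φ ⟧ᶠ ρ
    goal-sound {ρ = ρ} (d :< e) ψ sound closed with compare (⟦ d ⟧ ρ) (⟦ e ⟧ ρ)
    ... | tri< d<e _ _ = d<e
    ... | tri≈ _ d≈e _ with ψ (nonneg , d :- e) | sound {nonneg , d :- e} (fact-sound (e :≤ d) ρ (inj₂ (sym d≈e)))
    ... | pos , f | 0<f = ⊥-elim (refute f closed 0<f)
    goal-sound {ρ = ρ} (d :< e) ψ sound closed | tri> _ _ e<d
      with ψ (nonneg , d :- e) | sound {nonneg , d :- e} (fact-sound (e :≤ d) ρ (inj₁ e<d))
    ... | pos , f | 0<f = ⊥-elim (refute f closed 0<f)
    goal-sound {ρ = ρ} (d :≤ e) ψ sound closed with compare (⟦ d ⟧ ρ) (⟦ e ⟧ ρ)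
    ... | tri< d<e _ _ = inj₁ d<e
    ... | tri≈ _ d≈e _ = inj₂ d≈e
    ... | tri> _ _ e<d with ψ (pos , d :- e) | sound {pos , d :- e} (x<y⇒0<y-x e<d)
    ... | pos , f | 0<f = ⊥-elim (refute f closed 0<f)
    goal-sound {ρ = ρ} (d :≈ e) ψ sound closed with ψ trivial | sound {trivial} refl
    ... | zer , f | 0≈f = x-y≈0⇒x≈y (trans 0≈f (sym (x-y≈0⇒x≈y (isZero-sound (f :- (e :- d)) ρ closed))))
    goal-sound :⊥ ψ sound closed with ψ trivial | sound {trivial} refl
    ... | pos , f | 0<f = lift (refute f closed 0<f)

    sequent-sound : ∀ {n} ρ (s : Sequent n) (ψ : List (Fact n) → Fact n → Fact n) →
                    (∀ {Γ ν} → All n ρ Γ → Holds ν ρ → Holds (ψ Γ ν) ρ) →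
                    closes (goal s) (ψ (hypotheses s) (negation (goal s))) ≡ true → ⟦ s ⟧ˢ ρ
    sequent-sound ρ (⊢ φ)   ψ sound closed = goal-sound φ (ψ []) (sound []) closed
    sequent-sound ρ (φ ⊃ s) ψ sound closed h =
      sequent-sound ρ s (λ Γ → ψ (fact φ ∷ Γ)) (λ Γ → sound (fact-sound φ ρ h ∷ Γ)) closed

  Curried : ∀ n → (Vec Carrier n → Set ℓ) → Set (c Level.⊔ ℓ)
  Curried zero    P = Lift c (P [])
  Curried 1       P = ∀ x → P (x ∷ [])
  Curried (suc n) P = ∀ x → Curried n (λ ρ → P (x ∷ ρ))

  private
    curried : ∀ n {P : Vec Carrier n → Set ℓ} → (∀ ρ → P ρ) → Curried n P
    curried zero    p   = lift (p [])
    curried 1       p x = p (x ∷ [])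
    curried (suc (suc n)) p x = curried (suc n) (λ ρ → p (x ∷ ρ))

    close : ∀ n {A : Set} → N-ary n (Expr n) A → A
    close n f = f $ⁿ Vec.map var (allFin n)

  -- Since `one` is not an equation, scaling it gives the trivial fact 0 = 0. The goal must then be
  -- a polynomial identity over ℤ[√2].
  no-hypothesis : ∀ {n} → Certificate n
  no-hypothesis = :0 ⊙ one

  _×ᶜ_ : ∀ {n} → ℕ → Certificate n → Certificate n
  zero        ×ᶜ κ = no-hypothesis
  suc zero    ×ᶜ κ = κ
  suc (suc m) ×ᶜ κ = κ ⊕ suc m ×ᶜ κ

  -- Powers of `gap` supply positive coefficients with a negative integer or irrational part; for
  -- instance `gap ⊕ gap ^ᶜ 2` is 2 - √2, and 3 `gap` plus 2 `gap` squared is 3 - √2.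
  _^ᶜ_ : ∀ {n} → Certificate n → ℕ → Certificate n
  κ ^ᶜ zero  = one
  κ ^ᶜ suc m = κ ⊗ κ ^ᶜ m

  private
    T⇒≡ : ∀ {b} → T b → b ≡ true
    T⇒≡ {true} _ = ≡.refl

  -- Opaque, so that no later conversion check unfolds the solver.
  abstract
    prove : ∀ n (f : N-ary n (Expr n) (Sequent n × Certificate n)) →
            {checked : T (check (proj₁ (close n f)) (proj₂ (close n f)))} →
            Curried n ⟦ proj₁ (close n f) ⟧ˢ
    prove n f {checked} = curried n λ ρ →
      sequent-sound ρ (proj₁ (close n f)) (λ Γ ν → conclusion Γ ν (proj₂ (close n f)))
        (λ Γ ν → conclusion-sound Γ ν (proj₂ (close n f))) (T⇒≡ checked)

  #_ : ∀ {n} → ℕ → Expr n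
  # 0           = :0
  # 1           = :1
  # suc (suc m) = :1 :+ # suc m

-- Integers and absolute values inside the field.

module Continuants {c ℓ} (ℝ : CompleteOrderedField c ℓ)
  (√2 : CompleteOrderedField.Carrier ℝ)
  (0<√2 : CompleteOrderedField._<_ ℝ (CompleteOrderedField.0# ℝ) √2)
  (√2*√2≈2 : CompleteOrderedField._≈_ ℝ (CompleteOrderedField._*_ ℝ √2 √2)
     (CompleteOrderedField._+_ ℝ (CompleteOrderedField.1# ℝ) (CompleteOrderedField.1# ℝ)))
  where
  open OrderedField ℝ public
  open Inequalities ℝ √2 0<√2 √2*√2≈2 public
  open Hecke ℝ √2 public


  IsInt : Carrier → Set ℓ
  IsInt x = ∃ λ k → x ≈ fromℤ k

  int-fromℤ : ∀ k → IsInt (fromℤ k)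
  int-fromℤ k = k , refl

  int-0 : IsInt 0#
  int-0 = + 0 , refl

  int-1 : IsInt 1#
  int-1 = + 1 , sym (+-identityʳ 1#)

  int-+ : ∀ {x y} → IsInt x → IsInt y → IsInt (x + y)
  int-+ (i , x≈i) (j , y≈j) = i ℤ.+ j , trans (+-cong x≈i y≈j) (sym (fromℤ-homo-+ i j))

  int-* : ∀ {x y} → IsInt x → IsInt y → IsInt (x * y)
  int-* (i , x≈i) (j , y≈j) = i ℤ.* j , trans (*-cong x≈i y≈j) (sym (fromℤ-homo-* i j))

  int-neg : ∀ {x} → IsInt x → IsInt (- x)
  int-neg (i , x≈i) = ℤ.- i , trans (-‿cong x≈i) (sym (fromℤ-homo-neg i))

  0≤1+ = prove 1 (λ x →
      :0 :≤ x ⊃ ⊢ :0 :≤ :1 :+ x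
      by one ⊕ ¬goal ⊕ hyp 0)
  1≤1+ = prove 1 (λ x →
      :0 :≤ x ⊃ ⊢ :1 :≤ :1 :+ x
      by ¬goal ⊕ hyp 0)
  neg≤-1 = prove 1 (λ x →
      :1 :≤ x ⊃ ⊢ :- x :≤ :- :1
      by ¬goal ⊕ hyp 0)

  0≤fromℕ : ∀ n → 0# ≤ fromℤ (+ n)
  0≤fromℕ zero    = inj₂ refl
  0≤fromℕ (suc n) = 0≤1+ _ (0≤fromℕ n)

  ≤-respʳ = prove 3 (λ x y z →
      y :≈ z ⊃ x :≤ y ⊃ ⊢ x :≤ z
      by ¬goal ⊕ hyp 1 ⊕ :1 ⊙ hyp 0)
  ≤-respˡ = prove 3 (λ x y z →
      y :≈ z ⊃ y :≤ x ⊃ ⊢ z :≤ x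
      by ¬goal ⊕ hyp 1 ⊕ (:0 :- :1) ⊙ hyp 0)

  -- The discreteness of the integers in the form used throughout: every gap between odd integers or
  -- between multiples of √2, and every determination of a digit, is read off from it.
  int-trichotomy : ∀ {x} → IsInt x → 1# ≤ x ⊎ x ≈ 0# ⊎ x ≤ - 1#
  int-trichotomy (+ zero   , x≈0) = inj₂ (inj₁ x≈0)
  int-trichotomy (+ suc n  , x≈k) = inj₁ (≤-respʳ _ _ _ (sym x≈k) (1≤1+ _ (0≤fromℕ n)))
  int-trichotomy (-[1+ n ] , x≈k) = inj₂ (inj₂ (≤-respˡ _ _ _ (sym x≈k) (neg≤-1 _ (1≤1+ _ (0≤fromℕ n)))))

  pos-zero-⊥ = prove 1 (λ x →
      :0 :< x ⊃ x :≈ :0 ⊃ ⊢ :⊥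
      by hyp 0 ⊕ :1 ⊙ hyp 1)
  x*y≈1⇒0<y = prove 2 (λ x y →
      :0 :< x ⊃ x :* y :≈ :1 ⊃ ⊢ :0 :< y
      by one ⊕ ¬goal ⊗ hyp 0 ⊕ (:0 :- :1) ⊙ hyp 1)

  0<x⇒x≉0 : ∀ {x} → 0# < x → ¬ (x ≈ 0#)
  0<x⇒x≉0 0<x x≈0 = lower (pos-zero-⊥ _ 0<x x≈0)

  0<x⇒0<x⁻¹ : ∀ {x} → 0# < x → 0# < x ⁻¹
  0<x⇒0<x⁻¹ 0<x = x*y≈1⇒0<y _ _ 0<x (⁻¹-inverseʳ (0<x⇒x≉0 0<x))

  ∣∣-cases : ∀ x → (0# ≤ x × ∣ x ∣ ≈ x) ⊎ (x < 0# × ∣ x ∣ ≈ - x)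
  ∣∣-cases x with compare x 0#
  ... | tri< x<0 _ _ = inj₂ (x<0 , refl)
  ... | tri≈ _ x≈0 _ = inj₁ (inj₂ (sym x≈0) , refl)
  ... | tri> _ _ 0<x = inj₁ (inj₁ 0<x , refl)

  0≤y≈x = prove 2 (λ x y →
      :0 :≤ x ⊃ y :≈ x ⊃ ⊢ :0 :≤ y
      by ¬goal ⊕ hyp 0 ⊕ (:0 :- :1) ⊙ hyp 1)
  0≤y≈-x = prove 2 (λ x y →
      x :< :0 ⊃ y :≈ :- x ⊃ ⊢ :0 :≤ y
      by ¬goal ⊕ hyp 0 ⊕ (:0 :- :1) ⊙ hyp 1)
  y*y≈x*x = prove 2 (λ x y →
      y :≈ x ⊃ ⊢ y :* y :≈ x :* x
      by (x :+ y) ⊙ hyp 0)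
  y*y≈x*x′ = prove 2 (λ x y →
      y :≈ :- x ⊃ ⊢ y :* y :≈ x :* x
      by (:0 :- x :+ y) ⊙ hyp 0)

  0≤∣x∣ : ∀ x → 0# ≤ ∣ x ∣
  0≤∣x∣ x with ∣∣-cases x
  ... | inj₁ (0≤x , ∣x∣≈x)  = 0≤y≈x _ _ 0≤x ∣x∣≈x
  ... | inj₂ (x<0 , ∣x∣≈-x) = 0≤y≈-x _ _ x<0 ∣x∣≈-x

  ∣x∣*∣x∣≈x*x : ∀ x → ∣ x ∣ * ∣ x ∣ ≈ x * x
  ∣x∣*∣x∣≈x*x x with ∣∣-cases x
  ... | inj₁ (_ , ∣x∣≈x)  = y*y≈x*x _ _ ∣x∣≈x
  ... | inj₂ (_ , ∣x∣≈-x) = y*y≈x*x′ _ _ ∣x∣≈-x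

  x≉0⇒0<x*x : ∀ {x} → ¬ (x ≈ 0#) → 0# < x * x
  x≉0⇒0<x*x {x} x≉0 with compare x 0#
  ... | tri< x<0 _ _ = 0<-resp-≈ (-x*-y≈x*y x x) (*-pos (x<0⇒0<-x x<0) (x<0⇒0<-x x<0))
  ... | tri≈ _ x≈0 _ = ⊥-elim (x≉0 x≈0)
  ... | tri> _ _ 0<x = *-pos 0<x 0<x

  ∣∣≤⇒≤ = prove 7 (λ a b A B D l m →
      :0 :≤ A ⊃ A :≤ B ⊃ A :* A :≈ a :* a ⊃ B :* B :≈ b :* b ⊃ a :≈ l :* D ⊃
      b :* b :≈ m :* D :* (m :* D) ⊃ :0 :< D :* D ⊃ :0 :≤ m ⊃ ⊢ l :≤ m
      by ¬goal ⊗ ¬goal ⊗ hyp 6 ⊕ 2 ×ᶜ (¬goal ⊗ hyp 7 ⊗ hyp 6) ⊕ 2 ×ᶜ (hyp 1 ⊗ hyp 0)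
         ⊕ hyp 1 ⊗ hyp 1 ⊕ (:0 :- :1) ⊙ hyp 2 ⊕ :1 ⊙ hyp 3 ⊕ (:0 :- a :- D :* l) ⊙ hyp 4
         ⊕ :1 ⊙ hyp 5)
  ∣∣<⇒< = prove 7 (λ a b A B D l m →
      :0 :≤ A ⊃ A :< B ⊃ A :* A :≈ a :* a ⊃ B :* B :≈ b :* b ⊃ a :≈ l :* D ⊃
      b :* b :≈ m :* D :* (m :* D) ⊃ :0 :< D :* D ⊃ :0 :≤ m ⊃ ⊢ l :< m
      by ¬goal ⊗ ¬goal ⊗ hyp 6 ⊕ 2 ×ᶜ (¬goal ⊗ hyp 7 ⊗ hyp 6) ⊕ 2 ×ᶜ (hyp 1 ⊗ hyp 0)
         ⊕ hyp 1 ⊗ hyp 1 ⊕ (:0 :- :1) ⊙ hyp 2 ⊕ :1 ⊙ hyp 3 ⊕ (:0 :- a :- D :* l) ⊙ hyp 4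
         ⊕ :1 ⊙ hyp 5)
  -ℓ≤m = prove 2 (λ l m →
      :- l :≤ m ⊃ ⊢ :- m :≤ l
      by ¬goal ⊕ hyp 0)
  -ℓ<m = prove 2 (λ l m →
      :- l :< m ⊃ ⊢ :- m :< l
      by ¬goal ⊕ hyp 0)
  a≈-ℓ*-D = prove 3 (λ a l D →
      a :≈ l :* D ⊃ ⊢ :- a :≈ :- l :* D
      by (:0 :- :1) ⊙ hyp 0)
  -a*-a = prove 2 (λ a A →
      A :≈ a :* a ⊃ ⊢ A :≈ :- a :* (:- a)
      by :1 ⊙ hyp 0)

  -- In use, D is an error of unknown sign, so everything goes through squares, where absolute
  -- values disappear. The lower bound for ℓ is the upper bound for -ℓ.
  ∣ℓD∣≤∣mD∣⇒ : ∀ {a b D ℓ m} → ¬ (D ≈ 0#) → a ≈ ℓ * D → b * b ≈ m * D * (m * D) → 0# ≤ m →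
               ∣ a ∣ ≤ ∣ b ∣ → - m ≤ ℓ × ℓ ≤ m
  ∣ℓD∣≤∣mD∣⇒ {a} {b} D≉0 a≈ b≈ 0≤m ∣a∣≤∣b∣ =
    -ℓ≤m _ _ (∣∣≤⇒≤ _ _ _ _ _ _ _ (0≤∣x∣ a) ∣a∣≤∣b∣ (-a*-a a _ (∣x∣*∣x∣≈x*x a)) (∣x∣*∣x∣≈x*x b)
                (a≈-ℓ*-D _ _ _ a≈) b≈ (x≉0⇒0<x*x D≉0) 0≤m) ,
    ∣∣≤⇒≤ _ _ _ _ _ _ _ (0≤∣x∣ a) ∣a∣≤∣b∣ (∣x∣*∣x∣≈x*x a) (∣x∣*∣x∣≈x*x b)
      a≈ b≈ (x≉0⇒0<x*x D≉0) 0≤m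

  ∣ℓD∣<∣mD∣⇒ : ∀ {a b D ℓ m} → ¬ (D ≈ 0#) → a ≈ ℓ * D → b * b ≈ m * D * (m * D) → 0# ≤ m →
               ∣ a ∣ < ∣ b ∣ → - m < ℓ × ℓ < m
  ∣ℓD∣<∣mD∣⇒ {a} {b} D≉0 a≈ b≈ 0≤m ∣a∣<∣b∣ =
    -ℓ<m _ _ (∣∣<⇒< _ _ _ _ _ _ _ (0≤∣x∣ a) ∣a∣<∣b∣ (-a*-a a _ (∣x∣*∣x∣≈x*x a)) (∣x∣*∣x∣≈x*x b)
                (a≈-ℓ*-D _ _ _ a≈) b≈ (x≉0⇒0<x*x D≉0) 0≤m) ,
    ∣∣<⇒< _ _ _ _ _ _ _ (0≤∣x∣ a) ∣a∣<∣b∣ (∣x∣*∣x∣≈x*x a) (∣x∣*∣x∣≈x*x b)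
      a≈ b≈ (x≉0⇒0<x*x D≉0) 0≤m

  -- Continuants.

  sign₀ : (ℕ → Sign) → ℕ → Sign
  sign₀ ε zero    = Sign.+
  sign₀ ε (suc n) = ε (suc n)

  -- The convention ε₀ = 1 starts the recursion for the continuants.
  signs : (ℕ → Sign) → ℕ → Carrier
  signs ε n = fromSign (sign₀ ε n)

  signs-square : ∀ ε n → signs ε n * signs ε n ≈ 1#
  signs-square ε zero = *-identityˡ 1#
  signs-square ε (suc n) with ε (suc n)
  ... | Sign.+ = *-identityˡ 1#
  ... | Sign.- = trans (-x*-y≈x*y 1# 1#) (*-identityˡ 1#)

  -- K x₀ x₁ (2 + i) is the i-th value of the solution of the recursion
  -- vᵢ = aᵢ √2 vᵢ₋₁ + εᵢ vᵢ₋₂ with v₋₂ = x₀ and v₋₁ = x₁.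
  K : (ℕ → ℤ) → (ℕ → Sign) → (x₀ x₁ : Carrier) → ℕ → Carrier
  K a ε x₀ x₁ zero          = x₀
  K a ε x₀ x₁ (suc zero)    = x₁
  K a ε x₀ x₁ (suc (suc n)) = fromℤ (a n) * √2 * K a ε x₀ x₁ (suc n) + signs ε n * K a ε x₀ x₁ n

  -- The starting vectors are the formal fractions 0/1 and 1/0.
  numerator denominator : (ℕ → ℤ) → (ℕ → Sign) → ℕ → Carrier
  numerator   a ε = K a ε 0# 1#
  denominator a ε = K a ε 1# 0#

  shift-num₀ = prove 2 (λ A e →
      ⊢ A :* :√2 :* :1 :+ :1 :* :0 :≈ A :* :√2 :* :1 :+ e :* :0
      by no-hypothesis)
  shift-num₁ = prove 3 (λ A B e →
     
      ⊢ B :* :√2 :* (A :* :√2 :* :1 :+ :1 :* :0) :+ e :* :1 :≈ A :* :√2 :* (B :* :√2 :* :1 :+ :1 :* :0) :+ e :* :1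
      by no-hypothesis)
  shift-den₁ = prove 2 (λ B e →
      ⊢ B :* :√2 :* :1 :+ e :* :0 :≈ B :* :√2 :* :1 :+ :1 :* :0
      by no-hypothesis)
  shift-den₀ = prove 1 (λ A →
      ⊢ A :* :√2 :* :0 :+ :1 :* :1 :≈ :1
      by no-hypothesis)
  shift-den = prove 6 (λ B e h k g l →
      h :≈ k ⊃ g :≈ l ⊃ ⊢ B :* :√2 :* h :+ e :* g :≈ B :* :√2 :* k :+ e :* l
      by (:√2 :* B) ⊙ hyp 0 ⊕ e ⊙ hyp 1)
  shift-numerator-step = prove 10 (λ A d B e h p q g u v →
      h :≈ A :* :√2 :* p :+ d :* q ⊃ g :≈ A :* :√2 :* u :+ d :* v ⊃
      ⊢ B :* :√2 :* h :+ e :* g :≈ A :* :√2 :* (B :* :√2 :* p :+ e :* u) :+ d :* (B :* :√2 :* q :+ e :* v)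
      by (:√2 :* B) ⊙ hyp 0 ⊕ e ⊙ hyp 1)

  module _ (a : ℕ → ℤ) (ε : ℕ → Sign) where
    private
      r = numerator a ε
      s = denominator a ε
      r′ = numerator (a ∘ suc) (ε ∘ suc)
      s′ = denominator (a ∘ suc) (ε ∘ suc)
      A = fromℤ (a 0)
      e = fromSign (ε 1)


    -- Together with `numerator-shift` this splits off the first digit: `K` appends digits at the
    -- end, whereas `convergent` peels them off at the front. Two base cases are needed, because the
    -- shifted sequence starts with its own convention ε₀ = 1 in place of ε₁.
    denominator-shift : ∀ n → s (2 ℕ.+ n) ≈ r′ (suc n)
    denominator-shift zero          = shift-den₀ A
    denominator-shift (suc zero)    = trans (+-congʳ (*-congˡ (shift-den₀ A))) (shift-den₁ _ e)
    denominator-shift (suc (suc n)) =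
      shift-den _ _ _ _ _ _ (denominator-shift (suc n)) (denominator-shift n)

    numerator-shift : ∀ n → r (2 ℕ.+ n) ≈ A * √2 * r′ (suc n) + e * s′ (suc n)
    numerator-shift zero          = shift-num₀ A e
    numerator-shift (suc zero)    = trans (shift-num₁ A (fromℤ (a 1)) e)
      (+-congˡ (*-congˡ (sym (shift-den₀ (fromℤ (a 1))))))
    numerator-shift (suc (suc n)) = shift-numerator-step A e _ _ _ _ _ _ _ _
      (numerator-shift (suc n)) (numerator-shift n)

-- Parities of the entries of the Hecke group.

module HeckeGroup {c ℓ} (ℝ : CompleteOrderedField c ℓ)
  (√2 : CompleteOrderedField.Carrier ℝ)
  (0<√2 : CompleteOrderedField._<_ ℝ (CompleteOrderedField.0# ℝ) √2)
  (√2*√2≈2 : CompleteOrderedField._≈_ ℝ (CompleteOrderedField._*_ ℝ √2 √2)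
     (CompleteOrderedField._+_ ℝ (CompleteOrderedField.1# ℝ) (CompleteOrderedField.1# ℝ)))
  where
  open Continuants ℝ √2 0<√2 √2*√2≈2 public

  Odd Rad : Carrier → Set (c Level.⊔ ℓ)
  Odd x = ∃ λ y → IsInt y × x ≈ 1# + (1# + 1#) * y
  Rad x = ∃ λ y → IsInt y × x ≈ √2 * y

  odd-oo = prove 8 (λ a b c d w x y z →
      a :≈ :1 :+ # 2 :* w ⊃ b :≈ :1 :+ # 2 :* x ⊃ c :≈ :√2 :* y ⊃ d :≈ :√2 :* z ⊃
      ⊢ a :* b :+ c :* d :≈ :1 :+ # 2 :* (w :+ x :+ # 2 :* w :* x :+ y :* z)
      by (:1 :+ # 2 :* x) ⊙ hyp 0 ⊕ a ⊙ hyp 1 ⊕ (:√2 :* z) ⊙ hyp 2 ⊕ c ⊙ hyp 3)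
  rad-or = prove 8 (λ a b c d w x y z →
      a :≈ :1 :+ # 2 :* w ⊃ b :≈ :√2 :* x ⊃ c :≈ :√2 :* y ⊃ d :≈ :1 :+ # 2 :* z ⊃
      ⊢ a :* b :+ c :* d :≈ :√2 :* (x :+ # 2 :* w :* x :+ y :+ # 2 :* y :* z)
      by (:√2 :* x) ⊙ hyp 0 ⊕ a ⊙ hyp 1 ⊕ (:1 :+ # 2 :* z) ⊙ hyp 2 ⊕ c ⊙ hyp 3)
  odd-neg′ = prove 2 (λ a x →
      a :≈ :1 :+ # 2 :* x ⊃ ⊢ :- a :≈ :1 :+ # 2 :* (:- :1 :- x)
      by (:0 :- :1) ⊙ hyp 0)
  rad-neg′ = prove 2 (λ a x →
      a :≈ :√2 :* x ⊃ ⊢ :- a :≈ :√2 :* (:- x)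
      by (:0 :- :1) ⊙ hyp 0)

  odd-*+* : ∀ {a b c d} → Odd a → Odd b → Rad c → Rad d → Odd (a * b + c * d)
  odd-*+* (w , w∈ , a≈) (x , x∈ , b≈) (y , y∈ , c≈) (z , z∈ , d≈) =
    _ , int-+ (int-+ (int-+ w∈ x∈) (int-* (int-* (int-+ int-1 int-1) w∈) x∈)) (int-* y∈ z∈) ,
    odd-oo _ _ _ _ w x y z a≈ b≈ c≈ d≈

  rad-*+* : ∀ {a b c d} → Odd a → Rad b → Rad c → Odd d → Rad (a * b + c * d)
  rad-*+* (w , w∈ , a≈) (x , x∈ , b≈) (y , y∈ , c≈) (z , z∈ , d≈) =
    _ , int-+ (int-+ (int-+ x∈ (int-* (int-* (int-+ int-1 int-1) w∈) x∈)) y∈)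
              (int-* (int-* (int-+ int-1 int-1) y∈) z∈) ,
    rad-or _ _ _ _ w x y z a≈ b≈ c≈ d≈

  odd-resp-≈ : ∀ {x y} → x ≈ y → Odd x → Odd y
  odd-resp-≈ x≈y (w , w∈ , x≈) = w , w∈ , trans (sym x≈y) x≈

  rad-resp-≈ : ∀ {x y} → x ≈ y → Rad x → Rad y
  rad-resp-≈ x≈y (w , w∈ , x≈) = w , w∈ , trans (sym x≈y) x≈

  odd-+* : ∀ {a b c d} → Odd a → Odd b → Rad c → Rad d → Odd (c * d + a * b)
  odd-+* a b c d = odd-resp-≈ (+-comm _ _) (odd-*+* a b c d)

  rad-+* : ∀ {a b c d} → Odd a → Rad b → Rad c → Odd d → Rad (c * d + a * b)
  rad-+* a b c d = rad-resp-≈ (+-comm _ _) (rad-*+* a b c d)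

  odd-neg : ∀ {x} → Odd x → Odd (- x)
  odd-neg (w , w∈ , x≈) = _ , int-+ (int-neg int-1) (int-neg w∈) , odd-neg′ _ _ x≈

  rad-neg : ∀ {x} → Rad x → Rad (- x)
  rad-neg (w , w∈ , x≈) = _ , int-neg w∈ , rad-neg′ _ _ x≈

  odd-1 : Odd 1#
  odd-1 = 0# , int-0 , prove 1 (λ x → ⊢ :1 :≈ :1 :+ # 2 :* :0 by no-hypothesis) 1#

  rad-0 : Rad 0#
  rad-0 = 0# , int-0 , sym (zeroʳ √2)

  rad-√2 : Rad √2
  rad-√2 = 1# , int-1 , sym (*-identityʳ √2)

  Mixed : (x y : Carrier) → Set (c Level.⊔ ℓ)
  Mixed x y = (Odd x × Rad y) ⊎ (Rad x × Odd y)

  mixed-resp-≈ : ∀ {x y z w} → x ≈ z → y ≈ w → Mixed x y → Mixed z w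
  mixed-resp-≈ x≈z y≈w (inj₁ (p , q)) = inj₁ (odd-resp-≈ x≈z p , rad-resp-≈ y≈w q)
  mixed-resp-≈ x≈z y≈w (inj₂ (p , q)) = inj₂ (rad-resp-≈ x≈z p , odd-resp-≈ y≈w q)

  mixed-neg : ∀ {x y} → Mixed x y → Mixed (- x) (- y)
  mixed-neg (inj₁ (p , q)) = inj₁ (odd-neg p , rad-neg q)
  mixed-neg (inj₂ (p , q)) = inj₂ (rad-neg p , odd-neg q)

  mixed-negʳ : ∀ {x y} → Mixed x y → Mixed x (- y)
  mixed-negʳ (inj₁ (p , q)) = inj₁ (p , rad-neg q)
  mixed-negʳ (inj₂ (p , q)) = inj₂ (p , odd-neg q)

  mixed-swap : ∀ {x y} → Mixed x y → Mixed y x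
  mixed-swap (inj₁ (p , q)) = inj₂ (q , p)
  mixed-swap (inj₂ (p , q)) = inj₁ (q , p)

  det-∙ = prove 8 (λ p h q s a b c d →
      p :* s :- h :* q :≈ :1 ⊃ a :* d :- b :* c :≈ :1 ⊃
      ⊢ (p :* a :+ h :* c) :* (q :* b :+ s :* d) :- (p :* b :+ h :* d) :* (q :* a :+ s :* c) :≈ :1
      by (a :* d :- b :* c) ⊙ hyp 0 ⊕ :1 ⊙ hyp 1)
  det-inverse = prove 4 (λ p h q s →
      p :* s :- h :* q :≈ :1 ⊃ ⊢ s :* p :- :- h :* (:- q) :≈ :1
      by :1 ⊙ hyp 0)
  det-unipotent = prove 1 (λ x →
      ⊢ :1 :* :1 :- x :* :0 :≈ :1
      by no-hypothesis)
  det-inversion = prove 1 (λ x →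
      ⊢ :0 :* :0 :- :- :1 :* :1 :≈ :1
      by no-hypothesis)
  det-neg = prove 8 (λ p h q s a b c d →
      a :≈ :- p ⊃ b :≈ :- h ⊃ c :≈ :- q ⊃ d :≈ :- s ⊃ a :* d :- b :* c :≈ :1 ⊃
      ⊢ p :* s :- h :* q :≈ :1
      by (:0 :- d) ⊙ hyp 0 ⊕ (:0 :- q) ⊙ hyp 1 ⊕ b ⊙ hyp 2 ⊕ p ⊙ hyp 3 ⊕ :1 ⊙ hyp 4)
  det-cong = prove 8 (λ p h q s a b c d →
      a :≈ p ⊃ b :≈ h ⊃ c :≈ q ⊃ d :≈ s ⊃ a :* d :- b :* c :≈ :1 ⊃ ⊢ p :* s :- h :* q :≈ :1
      by (:0 :- d) ⊙ hyp 0 ⊕ q ⊙ hyp 1 ⊕ b ⊙ hyp 2 ⊕ (:0 :- p) ⊙ hyp 3 ⊕ :1 ⊙ hyp 4)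

  module _ where
    open Matrix

    -- The two alternatives multiply like the group of order two: `translation` belongs to the first
    -- and `inversion` to the second.
    Parities : Matrix → Set (c Level.⊔ ℓ)
    Parities M = (Odd (p M) × Rad (r M) × Rad (q M) × Odd (s M)) ⊎
                 (Rad (p M) × Odd (r M) × Odd (q M) × Rad (s M))

    det : Matrix → Carrier
    det M = p M * s M - r M * q M

  parities-∙ : ∀ M N → Parities M → Parities N → Parities (M ∙ N)
  parities-∙ _ _ (inj₁ (p , r , q , s)) (inj₁ (a , b , c , d)) = inj₁
    (odd-*+* p a r c , rad-*+* p b r d , rad-+* s c q a , odd-+* s d q b)
  parities-∙ _ _ (inj₁ (p , r , q , s)) (inj₂ (a , b , c , d)) = inj₂
    (rad-*+* p a r c , odd-*+* p b r d , odd-+* s c q a , rad-+* s d q b)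
  parities-∙ _ _ (inj₂ (p , r , q , s)) (inj₁ (a , b , c , d)) = inj₂
    (rad-+* r c p a , odd-+* r d p b , odd-*+* q a s c , rad-*+* q b s d)
  parities-∙ _ _ (inj₂ (p , r , q , s)) (inj₂ (a , b , c , d)) = inj₁
    (odd-+* r c p a , rad-+* r d p b , rad-*+* q a s c , odd-*+* q b s d)

  parities-inverse : ∀ M → Parities M → Parities (inverse M)
  parities-inverse _ (inj₁ (p , r , q , s)) = inj₁ (s , rad-neg r , rad-neg q , p)
  parities-inverse _ (inj₂ (p , r , q , s)) = inj₂ (s , odd-neg r , odd-neg q , p)

  parities-≋ : ∀ M N → M ≋ N → Parities M → Parities N
  parities-≋ _ _ (p≈ , r≈ , q≈ , s≈) (inj₁ (p , r , q , s)) =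
    inj₁ (odd-resp-≈ p≈ p , rad-resp-≈ r≈ r , rad-resp-≈ q≈ q , odd-resp-≈ s≈ s)
  parities-≋ _ _ (p≈ , r≈ , q≈ , s≈) (inj₂ (p , r , q , s)) =
    inj₂ (rad-resp-≈ p≈ p , odd-resp-≈ r≈ r , odd-resp-≈ q≈ q , rad-resp-≈ s≈ s)

  parities-negate : ∀ M → Parities M → Parities (negate M)
  parities-negate _ (inj₁ (p , r , q , s)) = inj₁ (odd-neg p , rad-neg r , rad-neg q , odd-neg s)
  parities-negate _ (inj₂ (p , r , q , s)) = inj₂ (rad-neg p , odd-neg r , odd-neg q , rad-neg s)

  ≋-negate : ∀ M N → M ≋ negate N → negate M ≋ N
  ≋-negate _ _ (p≈ , r≈ , q≈ , s≈) = flip p≈ , flip r≈ , flip q≈ , flip s≈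
    where
    flip : ∀ {x y} → x ≈ - y → - x ≈ y
    flip x≈-y = trans (-‿cong x≈-y) (⁻¹-involutive _)

  H₄-parities : ∀ {M} → H₄ M → Parities M
  H₄-parities translation = inj₁ (odd-1 , rad-√2 , rad-0 , odd-1)
  H₄-parities inversion   = inj₂ (rad-0 , odd-neg odd-1 , odd-1 , rad-0)
  H₄-parities identity    = inj₁ (odd-1 , rad-0 , rad-0 , odd-1)
  H₄-parities (product {M} {N} HM HN) = parities-∙ M N (H₄-parities HM) (H₄-parities HN)
  H₄-parities (inverted {M} HM)       = parities-inverse M (H₄-parities HM)
  H₄-parities (respects {M} {N} (inj₁ M≋N) HM)  = parities-≋ M N M≋N (H₄-parities HM)
  H₄-parities (respects {M} {N} (inj₂ M≋-N) HM) =
    parities-≋ (negate M) N (≋-negate M N M≋-N) (parities-negate M (H₄-parities HM))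

  H₄-det : ∀ {M} → H₄ M → det M ≈ 1#
  H₄-det translation         = det-unipotent √2
  H₄-det inversion           = det-inversion √2
  H₄-det identity            = det-unipotent 0#
  H₄-det (product HM HN)     = det-∙ _ _ _ _ _ _ _ _ (H₄-det HM) (H₄-det HN)
  H₄-det (inverted HM)       = det-inverse _ _ _ _ (H₄-det HM)
  H₄-det (respects (inj₁ (p≈ , r≈ , q≈ , s≈)) HM) =
    det-cong _ _ _ _ _ _ _ _ p≈ r≈ q≈ s≈ (H₄-det HM)
  H₄-det (respects (inj₂ (p≈ , r≈ , q≈ , s≈)) HM) =
    det-neg _ _ _ _ _ _ _ _ p≈ r≈ q≈ s≈ (H₄-det HM)

  H₄-column : ∀ {p r q s} → H₄ (mat p r q s) → Mixed p q
  H₄-column HM with H₄-parities HM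
  ... | inj₁ (p , _ , q , _) = inj₁ (p , q)
  ... | inj₂ (p , _ , q , _) = inj₂ (p , q)

  coord₁ = prove 6 (λ p h q s a b →
      p :* s :- h :* q :≈ :1 ⊃ ⊢ a :≈ (:- q :* a :+ p :* b) :* h :+ (s :* a :+ :- h :* b) :* p
      by (:0 :- a) ⊙ hyp 0)
  coord₂ = prove 6 (λ p h q s a b →
      p :* s :- h :* q :≈ :1 ⊃ ⊢ b :≈ (:- q :* a :+ p :* b) :* s :+ (s :* a :+ :- h :* b) :* q
      by (:0 :- b) ⊙ hyp 0)

  -- With M and N the two matrices, N = M (M⁻¹N), so the first column of N is the combination of the
  -- columns of M whose coefficients (u , t) form the first column of M⁻¹N. That matrix is in the
  -- group, whence the parities.
  coordinates : ∀ {p r q s p′ r′ q′ s′} → H₄ (mat p r q s) → H₄ (mat p′ r′ q′ s′) →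
                ∃₂ λ t u → Mixed t u × p′ ≈ t * r + u * p × q′ ≈ t * s + u * q
  coordinates HM HN =
    _ , _ , mixed-swap (H₄-column (product (inverted HM) HN)) ,
    coord₁ _ _ _ _ _ _ (H₄-det HM) , coord₂ _ _ _ _ _ _ (H₄-det HM)

  odd-1≤y⇒1≤x = prove 2 (λ x y →
      x :≈ :1 :+ # 2 :* y ⊃ :0 :< x ⊃ :1 :≤ y ⊃ ⊢ :1 :≤ x
      by 3 ×ᶜ ¬goal ⊕ 2 ×ᶜ hyp 1 ⊕ 2 ×ᶜ hyp 2 ⊕ (:0 :- :1) ⊙ hyp 0)
  odd-y≈0⇒1≤x = prove 2 (λ x y →
      x :≈ :1 :+ # 2 :* y ⊃ :0 :< x ⊃ y :≈ :0 ⊃ ⊢ :1 :≤ x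
      by ¬goal ⊕ (:0 :- :1) ⊙ hyp 0 ⊕ (:0 :- # 2) ⊙ hyp 2)
  odd-y≤-1⇒1≤x = prove 2 (λ x y →
      x :≈ :1 :+ # 2 :* y ⊃ :0 :< x ⊃ y :≤ :- :1 ⊃ ⊢ :1 :≤ x
      by ¬goal ⊕ 2 ×ᶜ hyp 1 ⊕ 2 ×ᶜ hyp 2 ⊕ :1 ⊙ hyp 0)
  rad-1≤y⇒1≤x = prove 2 (λ x y →
      x :≈ :√2 :* y ⊃ :0 :< x ⊃ :1 :≤ y ⊃ ⊢ :1 :≤ x
      by (4 ×ᶜ one ⊕ root) ⊗ ¬goal ⊕ (3 ×ᶜ gap ⊕ 2 ×ᶜ gap ^ᶜ 2) ⊗ hyp 1
         ⊕ (4 ×ᶜ one ⊕ root) ⊗ hyp 2 ⊕ (:0 :- :1 :- # 2 :* :√2) ⊙ hyp 0)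
  rad-y≈0⇒1≤x = prove 2 (λ x y →
      x :≈ :√2 :* y ⊃ :0 :< x ⊃ y :≈ :0 ⊃ ⊢ :1 :≤ x
      by hyp 1 ⊕ :1 ⊙ hyp 0 ⊕ :√2 ⊙ hyp 2)
  rad-y≤-1⇒1≤x = prove 2 (λ x y →
      x :≈ :√2 :* y ⊃ :0 :< x ⊃ y :≤ :- :1 ⊃ ⊢ :1 :≤ x
      by (5 ×ᶜ gap ⊕ 3 ×ᶜ gap ^ᶜ 2) ⊗ ¬goal ⊕ (3 ×ᶜ one ⊕ root) ⊗ hyp 1
         ⊕ (5 ×ᶜ gap ⊕ 3 ×ᶜ gap ^ᶜ 2) ⊗ hyp 2 ⊕ (:0 :- :1 :+ # 2 :* :√2) ⊙ hyp 0)

  odd≥1-pos : ∀ {x} → Odd x → 0# < x → 1# ≤ x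
  odd≥1-pos (y , y∈ , x≈) 0<x with int-trichotomy y∈
  ... | inj₁ 1≤y         = odd-1≤y⇒1≤x _ _ x≈ 0<x 1≤y
  ... | inj₂ (inj₁ y≈0)  = odd-y≈0⇒1≤x _ _ x≈ 0<x y≈0
  ... | inj₂ (inj₂ y≤-1) = odd-y≤-1⇒1≤x _ _ x≈ 0<x y≤-1

  rad≥1-pos : ∀ {x} → Rad x → 0# < x → 1# ≤ x
  rad≥1-pos (y , y∈ , x≈) 0<x with int-trichotomy y∈
  ... | inj₁ 1≤y         = rad-1≤y⇒1≤x _ _ x≈ 0<x 1≤y
  ... | inj₂ (inj₁ y≈0)  = rad-y≈0⇒1≤x _ _ x≈ 0<x y≈0
  ... | inj₂ (inj₂ y≤-1) = rad-y≤-1⇒1≤x _ _ x≈ 0<x y≤-1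

  mixed≥1 : ∀ {x y} → Mixed x y → 0# < y → 1# ≤ y
  mixed≥1 (inj₁ (_ , y)) = rad≥1-pos y
  mixed≥1 (inj₂ (_ , y)) = odd≥1-pos y

  ratio-of-denominators = prove 6 (λ p q a b h s →
      p :* s :- h :* q :≈ :1 ⊃ p :* b :≈ a :* q ⊃ ⊢ b :≈ (s :* a :+ :- h :* b) :* q
      by (:0 :- b) ⊙ hyp 0 ⊕ s ⊙ hyp 1)
  0<ratio-of-denominators = prove 3 (λ b t q →
      b :≈ t :* q ⊃ :0 :< b ⊃ :0 :< q ⊃ ⊢ :0 :< t
      by hyp 1 ⊕ ¬goal ⊗ hyp 2 ⊕ :1 ⊙ hyp 0)
  q≤tq = prove 3 (λ q b t →
      b :≈ t :* q ⊃ :1 :≤ t ⊃ :0 :< q ⊃ ⊢ q :≤ b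
      by ¬goal ⊕ hyp 1 ⊗ hyp 2 ⊕ (:0 :- :1) ⊙ hyp 0)
  numerators-agree = prove 5 (λ p q a b i →
      p :* b :≈ a :* q ⊃ b :≈ q ⊃ q :* i :≈ :1 ⊃ ⊢ a :≈ p
      by (:0 :- i) ⊙ hyp 0 ⊕ (i :* p) ⊙ hyp 1 ⊕ (:0 :- a :+ p) ⊙ hyp 2)

  -- If the fractions agree, M⁻¹N has first column (t , 0) with q′ = t q. As a positive entry of a
  -- group element t is at least 1, so q ≤ q′, and by symmetry the denominators agree.
  normalised-unique : ∀ {p r q s p′ r′ q′ s′} → H₄ (mat p r q s) → H₄ (mat p′ r′ q′ s′) →
                      0# < q → 0# < q′ → p * q′ ≈ p′ * q → p′ ≈ p × q′ ≈ q
  normalised-unique {p} {r} {q} {s} {p′} {r′} {q′} {s′} HM HN 0<q 0<q′ pq′≈p′q =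
    numerators-agree _ _ _ _ (q ⁻¹) pq′≈p′q q′≈q (⁻¹-inverseʳ (0<x⇒x≉0 0<q)) , q′≈q
    where
    q≤q′ : ∀ {p r q s p′ r′ q′ s′} → H₄ (mat p r q s) → H₄ (mat p′ r′ q′ s′) →
           0# < q → 0# < q′ → p * q′ ≈ p′ * q → q ≤ q′
    q≤q′ HM HN 0<q 0<q′ pq′≈p′q = q≤tq _ _ _ q′≈tq
      (mixed≥1 (mixed-swap (H₄-column (product (inverted HM) HN))) (0<ratio-of-denominators _ _ _ q′≈tq 0<q′ 0<q)) 0<q
      where q′≈tq = ratio-of-denominators _ _ _ _ _ _ (H₄-det HM) pq′≈p′q
    q′≈q : q′ ≈ q
    q′≈q with q≤q′ HM HN 0<q 0<q′ pq′≈p′q | q≤q′ HN HM 0<q′ 0<q (sym pq′≈p′q)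
    ... | inj₂ q≈q′ | _         = sym q≈q′
    ... | _         | inj₂ q′≈q = q′≈q
    ... | inj₁ q<q′ | inj₁ q′<q = ⊥-elim (<-irrefl refl (<-trans q<q′ q′<q))

  -- Continuant matrices belong to the Hecke group.

  translation-r = prove 1 (λ A →
      ⊢ :1 :* (A :* :√2) :+ :√2 :* :1 :≈ (:1 :+ A) :* :√2
      by no-hypothesis)
  translation-p = prove 1 (λ A →
      ⊢ :1 :* :1 :+ :√2 :* :0 :≈ :1
      by no-hypothesis)
  translation-q = prove 1 (λ A →
      ⊢ :0 :* :1 :+ :1 :* :0 :≈ :0
      by no-hypothesis)
  translation-s = prove 1 (λ A →
      ⊢ :0 :* (A :* :√2) :+ :1 :* :1 :≈ :1
      by no-hypothesis)
  translation⁻¹-r = prove 1 (λ A →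
      ⊢ :- (A :* :√2) :≈ :- A :* :√2
      by no-hypothesis)
  translation⁻¹-q = prove 1 (λ A →
      ⊢ :- :0 :≈ :0
      by no-hypothesis)

  translation^ℕ : ∀ n → H₄ (mat 1# (fromℤ (+ n) * √2) 0# 1#)
  translation^ℕ zero    = respects (inj₁ (refl , sym (zeroˡ √2) , refl , refl)) identity
  translation^ℕ (suc n) = respects (inj₁ (translation-p 0# , translation-r _ , translation-q 0# , translation-s (fromℤ (+ n))))
                            (product translation (translation^ℕ n))

  translation^ : ∀ k → H₄ (mat 1# (fromℤ k * √2) 0# 1#)
  translation^ (+ n)    = translation^ℕ n
  translation^ -[1+ n ] = respects (inj₁ (refl , translation⁻¹-r (fromℤ (+ suc n)) , translation⁻¹-q 0# , refl))
                            (inverted (translation^ℕ (suc n)))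

  digit-step-p = prove 1 (λ A →
      ⊢ :1 :* :0 :+ A :* :√2 :* :1 :≈ A :* :√2
      by no-hypothesis)
  digit-step-r = prove 1 (λ A →
      ⊢ :1 :* (:- :1) :+ A :* :√2 :* :0 :≈ :- :1
      by no-hypothesis)
  digit-step-q = prove 1 (λ A →
      ⊢ :0 :* :0 :+ :1 :* :1 :≈ :1
      by no-hypothesis)
  digit-step-s = prove 1 (λ A →
      ⊢ :0 :* (:- :1) :+ :1 :* :0 :≈ :0
      by no-hypothesis)

  digit-step digit-step⁻ : ∀ k → Matrix
  digit-step  k = mat (fromℤ k * √2) (- 1#) 1# 0#
  digit-step⁻ k = mat (fromℤ k * √2) 1# (- 1#) 0#

  H₄-digit-step : ∀ k → H₄ (digit-step k)
  H₄-digit-step k = respects (inj₁ (digit-step-p _ , digit-step-r _ , digit-step-q 0# , digit-step-s 0#))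
                      (product (translation^ k) inversion)

  neg-involutive = prove 1 (λ x →
      ⊢ x :≈ :- (:- x)
      by no-hypothesis)

  -- In PSL₂ this is `digit-step` at -k: the two matrices differ by the factor -1.
  H₄-digit-step⁻ : ∀ k → H₄ (digit-step⁻ k)
  H₄-digit-step⁻ k = respects (inj₂ (-k , refl , neg-involutive 1# , sym ε⁻¹≈ε)) (H₄-digit-step (ℤ.- k))
    where
    -k : fromℤ (ℤ.- k) * √2 ≈ - (fromℤ k * √2)
    -k = trans (*-congʳ (fromℤ-homo-neg k)) (sym (-‿distribˡ-* _ _))

  column₊₊ = prove 3 (λ p q A →
      ⊢ p :* (A :* :√2) :+ :1 :* q :* :1 :≈ A :* :√2 :* p :+ :1 :* q
      by no-hypothesis)
  column₊₋ = prove 3 (λ p q A →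
      ⊢ p :* (A :* :√2) :+ :- :1 :* q :* :1 :≈ A :* :√2 :* p :+ :- :1 :* q
      by no-hypothesis)
  column₋₊ = prove 3 (λ p q A →
      ⊢ p :* (A :* :√2) :+ :1 :* q :* (:- :1) :≈ A :* :√2 :* p :+ :- :1 :* q
      by no-hypothesis)
  column₋₋ = prove 3 (λ p q A →
      ⊢ p :* (A :* :√2) :+ :- :1 :* q :* (:- :1) :≈ A :* :√2 :* p :+ :1 :* q
      by no-hypothesis)
  negated-column = prove 2 (λ p q →
      ⊢ p :* (:- :1) :+ q :* :0 :≈ :- :1 :* p
      by no-hypothesis)
  kept-column = prove 2 (λ p q →
      ⊢ p :* :1 :+ q :* :0 :≈ :1 :* p
      by no-hypothesis)

  -- The sign makes the determinant 1.
  H₄-continuants : ∀ a ε n → ∃ λ σ →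
    let r = numerator a ε; s = denominator a ε in
    H₄ (mat (r (suc n)) (fromSign σ * r n) (s (suc n)) (fromSign σ * s n))
  H₄-continuants a ε zero =
    Sign.+ , respects (inj₁ (refl , sym (zeroʳ 1#) , refl , sym (*-identityʳ 1#))) identity
  -- Multiplying by `digit-step` adds the second column to the multiple of the first, multiplying by
  -- `digit-step⁻` subtracts it. The required term is εₙ vₙ and the second column is σ vₙ, so the
  -- choice depends on whether σ equals εₙ.
  H₄-continuants a ε (suc n) with H₄-continuants a ε n | sign₀ ε n
  ... | Sign.+ , H | Sign.+ = Sign.- , respects (inj₁
          (column₊₊ _ _ _ , negated-column _ _ , column₊₊ _ _ _ , negated-column _ _)) (product H (H₄-digit-step (a n)))
  ... | Sign.- , H | Sign.- = Sign.- , respects (inj₁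
          (column₊₋ _ _ _ , negated-column _ _ , column₊₋ _ _ _ , negated-column _ _)) (product H (H₄-digit-step (a n)))
  ... | Sign.+ , H | Sign.- = Sign.+ , respects (inj₁
          (column₋₊ _ _ _ , kept-column _ _ , column₋₊ _ _ _ , kept-column _ _)) (product H (H₄-digit-step⁻ (a n)))
  ... | Sign.- , H | Sign.+ = Sign.+ , respects (inj₁
          (column₋₋ _ _ _ , kept-column _ _ , column₋₋ _ _ _ , kept-column _ _)) (product H (H₄-digit-step⁻ (a n)))

  absorb-sign = prove 6 (λ x σ t u p h →
      x :≈ t :* (σ :* h) :+ u :* p ⊃ ⊢ x :≈ t :* σ :* h :+ u :* p
      by :1 ⊙ hyp 0)

  continuant-coordinates : ∀ a ε n {p r q s} → H₄ (mat p r q s) → ∃₂ λ t u → Mixed t u ×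
    p ≈ t * numerator   a ε n + u * numerator   a ε (suc n) ×
    q ≈ t * denominator a ε n + u * denominator a ε (suc n)
  continuant-coordinates a ε n HM with H₄-continuants a ε n
  ... | σ , HC with coordinates HC HM
  ... | t , u , tu , p≈ , q≈ =
    t * fromSign σ , u , mixed-sign σ tu , absorb-sign _ _ _ _ _ _ p≈ , absorb-sign _ _ _ _ _ _ q≈
    where
    mixed-sign : ∀ σ {t u} → Mixed t u → Mixed (t * fromSign σ) u
    mixed-sign Sign.+ = mixed-resp-≈ (sym (*-identityʳ _)) refl
    mixed-sign Sign.- = mixed-swap ∘ mixed-resp-≈ refl (trans (sym (-1*x≈-x _)) (*-comm _ _)) ∘
                        mixed-negʳ ∘ mixed-swap

-- Errors and values of convergents for an arbitrary digit rule.

module Expansions {c ℓ} (ℝ : CompleteOrderedField c ℓ)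
  (√2 : CompleteOrderedField.Carrier ℝ)
  (0<√2 : CompleteOrderedField._<_ ℝ (CompleteOrderedField.0# ℝ) √2)
  (√2*√2≈2 : CompleteOrderedField._≈_ ℝ (CompleteOrderedField._*_ ℝ √2 √2)
     (CompleteOrderedField._+_ ℝ (CompleteOrderedField.1# ℝ) (CompleteOrderedField.1# ℝ)))
  where
  open HeckeGroup ℝ √2 0<√2 √2*√2≈2 public

  reciprocal-unit = prove 5 (λ x y a t i →
      x :≈ :1 :* i ⊃ a :* i :≈ :1 ⊃ a :≈ t ⊃ ⊢ x :* (:1 :* t) :≈ :1
      by t ⊙ hyp 0 ⊕ :1 ⊙ hyp 1 ⊕ (:0 :- i) ⊙ hyp 2)
  reciprocal-unit⁻ = prove 5 (λ x y a t i →
      x :≈ :1 :* i ⊃ a :* i :≈ :1 ⊃ a :≈ :- t ⊃ ⊢ x :* (:- :1 :* t) :≈ :1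
      by (:0 :- t) ⊙ hyp 0 ⊕ :1 ⊙ hyp 1 ⊕ (:0 :- i) ⊙ hyp 2)
  0<1*t = prove 1 (λ t →
      :0 :< t ⊃ ⊢ :0 :< :1 :* t
      by ¬goal ⊕ hyp 0)
  0<-1*t = prove 1 (λ t →
      t :< :0 ⊃ ⊢ :0 :< :- :1 :* t
      by ¬goal ⊕ hyp 0)
  0<t-t<0-⊥ = prove 1 (λ t →
      :0 :< t ⊃ t :< :0 ⊃ ⊢ :⊥
      by hyp 0 ⊕ hyp 1)
  t<0-0≤t-⊥ = prove 1 (λ t →
      t :< :0 ⊃ :0 :≤ t ⊃ ⊢ :⊥
      by hyp 0 ⊕ hyp 1)
  0<∣t∣ = prove 2 (λ t a →
      :0 :< t ⊃ a :≈ t ⊃ ⊢ :0 :< a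
      by ¬goal ⊕ hyp 0 ⊕ (:0 :- :1) ⊙ hyp 1)
  0<∣t∣⁻ = prove 2 (λ t a →
      t :< :0 ⊃ a :≈ :- t ⊃ ⊢ :0 :< a
      by ¬goal ⊕ hyp 0 ⊕ (:0 :- :1) ⊙ hyp 1)

  -- Replaces the absolute value and the inverse in the algorithm by the polynomial equation y (ε θ)
  -- = 1, which certificates can handle.
  reciprocal-∣∣ : ∀ s {θ y} → HasSign s θ → y ≈ 1# / ∣ θ ∣ →
                  0# < fromSign s * θ × y * (fromSign s * θ) ≈ 1#
  reciprocal-∣∣ Sign.+ {θ} {y} 0<θ y≈ with ∣∣-cases θ
  ... | inj₁ (_ , ∣θ∣≈θ) = 0<1*t _ 0<θ ,
          reciprocal-unit y y _ _ _ y≈ (⁻¹-inverseʳ (0<x⇒x≉0 (0<∣t∣ _ _ 0<θ ∣θ∣≈θ))) ∣θ∣≈θ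
  ... | inj₂ (θ<0 , _)   = ⊥-elim (lower (0<t-t<0-⊥ _ 0<θ θ<0))
  reciprocal-∣∣ Sign.- {θ} {y} θ<0 y≈ with ∣∣-cases θ
  ... | inj₁ (0≤θ , _)    = ⊥-elim (lower (t<0-0≤t-⊥ _ θ<0 0≤θ))
  ... | inj₂ (_ , ∣θ∣≈-θ) = 0<-1*t _ θ<0 ,
          reciprocal-unit⁻ y y _ _ _ y≈ (⁻¹-inverseʳ (0<x⇒x≉0 (0<∣t∣⁻ _ _ θ<0 ∣θ∣≈-θ))) ∣θ∣≈-θ

  reciprocal-pos = prove 2 (λ x u →
      :0 :< u ⊃ x :* u :≈ :1 ⊃ ⊢ :0 :< x
      by one ⊕ ¬goal ⊗ hyp 0 ⊕ (:0 :- :1) ⊙ hyp 1)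

  error-recursion-zero = prove 2 (λ x a →
      x :≈ a ⊃ ⊢ :1 :* a :- :0 :≈ :- (:1 :* x :* (:0 :* a :- :1))
      by (:0 :- :1) ⊙ hyp 0)
  error-unfold = prove 7 (λ A e s t α p q →
     
      ⊢ (A :* :√2 :* s :+ e :* t) :* α :- (A :* :√2 :* p :+ e :* q) :≈ A :* :√2 :* (s :* α :- p) :+ e :* (t :* α :- q)
      by no-hypothesis)
  error-recursion-suc = prove 8 (λ A x e f y L M N →
      N :≈ A :* :√2 :* M :+ e :* L ⊃ L :≈ :- (e :* x :* M) ⊃ e :* e :≈ :1 ⊃
      y :* (f :* (x :- A :* :√2)) :≈ :1 ⊃ ⊢ M :≈ :- (f :* y :* N)
      by (f :* y) ⊙ hyp 0 ⊕ (e :* f :* y) ⊙ hyp 1 ⊕ (:0 :- M :* f :* x :* y) ⊙ hyp 2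
         ⊕ (:0 :- M) ⊙ hyp 3)
  error-vanishes = prove 4 (λ e x M L →
      L :≈ :- (e :* x :* M) ⊃ M :≈ :0 ⊃ ⊢ L :≈ :0
      by :1 ⊙ hyp 0 ⊕ (:0 :- e :* x) ⊙ hyp 1)
  -1≉0 = prove 1 (λ α →
      :0 :* α :- :1 :≈ :0 ⊃ ⊢ :⊥
      by one ⊕ (:0 :- :1) ⊙ hyp 0)

  module _ {Digit : ℤ → Carrier → Set ℓ} where

    shift : ∀ {α} (E : Expansion Digit α) → Expansion Digit (Expansion.x E 1)
    shift E = record
      { a     = a ∘ suc
      ; ε     = ε ∘ suc
      ; x     = x ∘ suc
      ; start = refl
      ; digit = digit ∘ suc
      ; sign  = sign ∘ suc
      ; step  = step ∘ suc
      }
      where open Expansion E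

    module _ {α : Carrier} (E : Expansion Digit α) where
      open Expansion E

      num den e θ error : ℕ → Carrier
      num     = numerator a ε
      den     = denominator a ε
      e       = signs ε
      θ n     = x n - fromℤ (a n) * √2
      error n = den n * α - num n

      0<eθ : ∀ n → 0# < e (suc n) * θ n
      0<eθ n = proj₁ (reciprocal-∣∣ (ε (suc n)) (sign n) (step n))

      tail-unit : ∀ n → x (suc n) * (e (suc n) * θ n) ≈ 1#
      tail-unit n = proj₂ (reciprocal-∣∣ (ε (suc n)) (sign n) (step n))

      0<tail : ∀ n → 0# < x (suc n)
      0<tail n = reciprocal-pos _ _ (0<eθ n) (tail-unit n)

      -- The complete quotient is, up to sign, the ratio of two consecutive errors; equivalently xₙ
      -- times the later vector plus εₙ times the earlier one is proportional to (α , 1). The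
      -- recursion starts from the errors α and -1 of the two formal fractions.
      error-recursion : ∀ n → error n ≈ - (e n * x n * error (suc n))
      error-recursion zero    = error-recursion-zero _ _ start
      error-recursion (suc n) = error-recursion-suc _ _ _ _ _ _ _ _ (error-unfold _ _ _ _ _ _ _)
        (error-recursion n) (signs-square ε n) (tail-unit n)

      -- A vanishing error would propagate down the recursion to the error -1 of 1/0.
      error≉0 : ∀ n → ¬ (error (suc n) ≈ 0#)
      error≉0 zero    error≈0 = lower (-1≉0 _ error≈0)
      error≉0 (suc n) error≈0 = error≉0 n (error-vanishes _ _ _ _ (error-recursion (suc n)) error≈0)

    convergent-value-zero = prove 1 (λ A →
        ⊢ A :* :√2 :* (A :* :√2 :* :0 :+ :1 :* :1) :≈ A :* :√2 :* :1 :+ :1 :* :0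
        by no-hypothesis)
    convergent-value-suc = prove 8 (λ A e v i p q u w →
        v :* q :≈ p ⊃ v :* i :≈ :1 ⊃ u :≈ A :* :√2 :* p :+ e :* q ⊃ w :≈ p ⊃
        ⊢ (A :* :√2 :+ e :* i) :* w :≈ u
        by (:0 :- e :* i) ⊙ hyp 0 ⊕ (e :* q) ⊙ hyp 1 ⊕ (:0 :- :1) ⊙ hyp 2
           ⊕ (:√2 :* A :+ e :* i) ⊙ hyp 3)
    den-nonzero = prove 3 (λ v q p →
        v :* q :≈ p ⊃ :0 :< p ⊃ v :≈ :0 ⊃ ⊢ :⊥
        by hyp 1 ⊕ (:0 :- :1) ⊙ hyp 0 ⊕ q ⊙ hyp 2)

    -- The induction passes to `shift E`, which expands a different number; hence positivity is
    -- assumed for all expansions with the same digit rule. It makes the inner convergent nonzero,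
    -- so that its unspecified inverse at 0 is never met.
    convergent-value : (∀ {α} (E : Expansion Digit α) n → 0# < den E (2 ℕ.+ n)) →
                       ∀ {α} (E : Expansion Digit α) i →
                       Expansion.convergents E i * den E (2 ℕ.+ i) ≈ num E (2 ℕ.+ i)
    convergent-value 0<den E zero    = convergent-value-zero _
    convergent-value 0<den E (suc i) = convergent-value-suc _ _ v _ _ _ _ _ ih
      (⁻¹-inverseʳ v≉0) (numerator-shift a ε (suc i)) (denominator-shift a ε (suc i))
      where
      open Expansion E
      v = Expansion.convergents (shift E) i
      ih = convergent-value 0<den (shift E) i
      v≉0 : ¬ (v ≈ 0#)
      v≉0 v≈0 = lower (den-nonzero _ _ _ ih
        (0<-resp-≈ (denominator-shift a ε (suc i)) (0<den E (suc i))) v≈0)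

-- Lattice points in the regions cut out by denominator and error.

module Lattice {c ℓ} (ℝ : CompleteOrderedField c ℓ)
  (√2 : CompleteOrderedField.Carrier ℝ)
  (0<√2 : CompleteOrderedField._<_ ℝ (CompleteOrderedField.0# ℝ) √2)
  (√2*√2≈2 : CompleteOrderedField._≈_ ℝ (CompleteOrderedField._*_ ℝ √2 √2)
     (CompleteOrderedField._+_ ℝ (CompleteOrderedField.1# ℝ) (CompleteOrderedField.1# ℝ)))
  where
  open HeckeGroup ℝ √2 0<√2 √2*√2≈2

  rad-1≤y⇒√2≤x = prove 2 (λ x y →
      x :≈ :√2 :* y ⊃ :0 :< x ⊃ :1 :≤ y ⊃ ⊢ :√2 :≤ x
      by ¬goal ⊕ root ⊗ hyp 2 ⊕ (:0 :- :1) ⊙ hyp 0)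
  rad-y≈0-⊥ = prove 2 (λ x y →
      x :≈ :√2 :* y ⊃ :0 :< x ⊃ y :≈ :0 ⊃ ⊢ :⊥
      by hyp 1 ⊕ :1 ⊙ hyp 0 ⊕ :√2 ⊙ hyp 2)
  rad-y≤-1-⊥ = prove 2 (λ x y →
      x :≈ :√2 :* y ⊃ :0 :< x ⊃ y :≤ :- :1 ⊃ ⊢ :⊥
      by gap ⊕ gap ^ᶜ 2 ⊕ gap ⊗ hyp 1 ⊕ (gap ⊕ gap ^ᶜ 2) ⊗ hyp 2 ⊕ (:0 :- :1 :+ :√2) ⊙ hyp 0)

  rad-gap : ∀ {x} → Rad x → 0# < x → √2 ≤ x
  rad-gap (y , y∈ , x≈) 0<x with int-trichotomy y∈
  ... | inj₁ 1≤y         = rad-1≤y⇒√2≤x _ _ x≈ 0<x 1≤y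
  ... | inj₂ (inj₁ y≈0)  = ⊥-elim (lower (rad-y≈0-⊥ _ _ x≈ 0<x y≈0))
  ... | inj₂ (inj₂ y≤-1) = ⊥-elim (lower (rad-y≤-1-⊥ _ _ x≈ 0<x y≤-1))

  odd-1≤y⇒3≤x = prove 2 (λ x y →
      x :≈ :1 :+ # 2 :* y ⊃ :1 :< x ⊃ :1 :≤ y ⊃ ⊢ # 3 :≤ x
      by ¬goal ⊕ 2 ×ᶜ hyp 2 ⊕ (:0 :- :1) ⊙ hyp 0)
  odd-y≈0-⊥ = prove 2 (λ x y →
      x :≈ :1 :+ # 2 :* y ⊃ :1 :< x ⊃ y :≈ :0 ⊃ ⊢ :⊥
      by hyp 1 ⊕ :1 ⊙ hyp 0 ⊕ (# 2) ⊙ hyp 2)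
  odd-y≤-1-⊥ = prove 2 (λ x y →
      x :≈ :1 :+ # 2 :* y ⊃ :1 :< x ⊃ y :≤ :- :1 ⊃ ⊢ :⊥
      by 2 ×ᶜ one ⊕ hyp 1 ⊕ 2 ×ᶜ hyp 2 ⊕ :1 ⊙ hyp 0)

  odd-gap : ∀ {x} → Odd x → 1# < x → 1# + (1# + 1#) ≤ x
  odd-gap (y , y∈ , x≈) 0<x with int-trichotomy y∈
  ... | inj₁ 1≤y         = odd-1≤y⇒3≤x _ _ x≈ 0<x 1≤y
  ... | inj₂ (inj₁ y≈0)  = ⊥-elim (lower (odd-y≈0-⊥ _ _ x≈ 0<x y≈0))
  ... | inj₂ (inj₂ y≤-1) = ⊥-elim (lower (odd-y≤-1-⊥ _ _ x≈ 0<x y≤-1))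

  rad-shift = prove 2 (λ x y →
      x :≈ :√2 :* y ⊃ ⊢ x :- :√2 :≈ :√2 :* (y :- :1)
      by :1 ⊙ hyp 0)
  0<x-√2 = prove 1 (λ x →
      :√2 :< x ⊃ ⊢ :0 :< x :- :√2
      by ¬goal ⊕ hyp 0)
  2√2≤x = prove 1 (λ x →
      :√2 :≤ x :- :√2 ⊃ ⊢ # 2 :* :√2 :≤ x
      by ¬goal ⊕ hyp 0)

  rad-gap-√2 : ∀ {x} → Rad x → √2 < x → (1# + 1#) * √2 ≤ x
  rad-gap-√2 (y , y∈ , x≈) √2<x =
    2√2≤x _ (rad-gap (y - 1# , int-+ y∈ (int-neg int-1) , rad-shift _ _ x≈) (0<x-√2 _ √2<x))

  mixed≥1ˡ : ∀ {x y} → Mixed x y → 0# < x → 1# ≤ x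
  mixed≥1ˡ xy = mixed≥1 (mixed-swap xy)

  plus-rad-⊥ = prove 4 (λ X y t u →
      :√2 :< X ⊃ :0 :≤ y ⊃ :√2 :≤ t ⊃ u :+ t :* y :≤ :1 ⊃ :- :1 :≤ u :- :1 :* t :* X ⊃ ⊢ :⊥
      by 2 ×ᶜ hyp 0 ⊕ 2 ×ᶜ hyp 1 ⊕ 2 ×ᶜ hyp 2 ⊕ root ⊗ hyp 3 ⊕ root ⊗ hyp 4 ⊕ root ⊗ hyp 0 ⊗ hyp 2
         ⊕ root ⊗ hyp 1 ⊗ hyp 2)
  plus-odd-0<u = prove 3 (λ X t u →
      :√2 :< X ⊃ :1 :≤ t ⊃ :- :1 :≤ u :- :1 :* t :* X ⊃ ⊢ :0 :< u
      by gap ⊕ gap ^ᶜ 2 ⊕ root ⊗ ¬goal ⊕ root ⊗ hyp 0 ⊕ 2 ×ᶜ hyp 1 ⊕ root ⊗ hyp 2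
         ⊕ root ⊗ hyp 0 ⊗ hyp 1)
  plus-odd-⊥ = prove 3 (λ y t u →
      :0 :≤ y ⊃ :1 :≤ t ⊃ u :+ t :* y :≤ :1 ⊃ :√2 :≤ u ⊃ ⊢ :⊥
      by one ⊕ (one ⊕ root) ⊗ hyp 0 ⊕ (one ⊕ root) ⊗ hyp 2 ⊕ (one ⊕ root) ⊗ hyp 3
         ⊕ (one ⊕ root) ⊗ hyp 0 ⊗ hyp 1)
  minus-rad-1<-u = prove 3 (λ X t u →
      :√2 :< X ⊃ :√2 :≤ t ⊃ u :- :- :1 :* t :* X :≤ :1 ⊃ ⊢ :1 :< :- u
      by root ⊗ ¬goal ⊕ 2 ×ᶜ hyp 0 ⊕ 2 ×ᶜ hyp 1 ⊕ root ⊗ hyp 2 ⊕ root ⊗ hyp 0 ⊗ hyp 1)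
  minus-rad-⊥ = prove 4 (λ X y t u →
      :√2 :< X ⊃ y :< :√2 :- :1 ⊃ :√2 :≤ t ⊃ :- :1 :≤ u :+ t :* y ⊃ u :- :- :1 :* t :* X :≤ :1 ⊃
      # 3 :≤ :- u ⊃ ⊢ :⊥
      by 28 ×ᶜ gap ⊕ 16 ×ᶜ gap ^ᶜ 2 ⊕ (14 ×ᶜ gap ⊕ 8 ×ᶜ gap ^ᶜ 2) ⊗ hyp 0
         ⊕ (16 ×ᶜ one ⊕ 6 ×ᶜ root) ⊗ hyp 1 ⊕ (6 ×ᶜ one ⊕ 8 ×ᶜ root) ⊗ hyp 3
         ⊕ (3 ×ᶜ one ⊕ 5 ×ᶜ gap) ⊗ hyp 4 ⊕ (8 ×ᶜ one ⊕ 3 ×ᶜ root) ⊗ hyp 5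
         ⊕ (3 ×ᶜ one ⊕ 5 ×ᶜ gap) ⊗ hyp 0 ⊗ hyp 2 ⊕ (6 ×ᶜ one ⊕ 8 ×ᶜ root) ⊗ hyp 1 ⊗ hyp 2)
  minus-odd-0<-u = prove 3 (λ X t u →
      :√2 :< X ⊃ :1 :≤ t ⊃ u :- :- :1 :* t :* X :≤ :1 ⊃ ⊢ :0 :< :- u
      by gap ⊕ gap ^ᶜ 2 ⊕ root ⊗ ¬goal ⊕ root ⊗ hyp 0 ⊕ 2 ×ᶜ hyp 1 ⊕ root ⊗ hyp 2
         ⊕ root ⊗ hyp 0 ⊗ hyp 1)
  minus-odd-t≈1-⊥ = prove 3 (λ y t u →
      y :< :√2 :- :1 ⊃ t :≈ :1 ⊃ :- :1 :≤ u :+ t :* y ⊃ :√2 :≤ :- u ⊃ ⊢ :⊥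
      by hyp 0 ⊕ hyp 2 ⊕ hyp 3 ⊕ y ⊙ hyp 1)
  minus-odd-t≥3-⊥ = prove 4 (λ X y t u →
      :√2 :< X ⊃ y :< :√2 :- :1 ⊃ # 3 :≤ t ⊃ :- :1 :≤ u :+ t :* y ⊃ u :- :- :1 :* t :* X :≤ :1 ⊃
      ⊢ :⊥
      by one ⊕ 3 ×ᶜ hyp 0 ⊕ 3 ×ᶜ hyp 1 ⊕ hyp 2 ⊕ hyp 3 ⊕ hyp 4 ⊕ hyp 0 ⊗ hyp 2 ⊕ hyp 1 ⊗ hyp 2)

  -- What the rule for Rosen digits says of e = εₙ and of the quotient y = sₙ / sₙ₊₁.
  SignBound : (e y : Carrier) → Set ℓ
  SignBound e y = e ≈ 1# ⊎ (e ≈ - 1# × y < √2 - 1#)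

  subst-e≥ = prove 6 (λ e f t X u m →
      e :≈ f ⊃ m :≤ u :- e :* t :* X ⊃ ⊢ m :≤ u :- f :* t :* X
      by ¬goal ⊕ hyp 1 ⊕ (:0 :- X :* t) ⊙ hyp 0)
  subst-e≤ = prove 6 (λ e f t X u m →
      e :≈ f ⊃ u :- e :* t :* X :≤ m ⊃ ⊢ u :- f :* t :* X :≤ m
      by ¬goal ⊕ hyp 1 ⊕ (X :* t) ⊙ hyp 0)

  -- Write N = u + t y and L = u - e t X, the denominator and error in units of those of the current
  -- convergent. For e = 1 positivity of t pulls N and L apart; for e = -1 it pushes both upwards at
  -- the different rates y and X.
  rosen-local-pos : ∀ {e X y t u} → √2 < X → 0# ≤ y → SignBound e y → Mixed t u → 0# < t →
                    - 1# ≤ u + t * y → u + t * y ≤ 1# →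
                    - 1# ≤ u - e * t * X → u - e * t * X ≤ 1# → ⊥
  -- With t at least √2, the difference N - L = t (y + X) exceeds 2.
  rosen-local-pos √2<X 0≤y (inj₁ e≈1) (inj₂ (t∈ , _)) 0<t _ N≤1 -1≤L _ =
    lower (plus-rad-⊥ _ _ _ _ √2<X 0≤y (rad-gap t∈ 0<t) N≤1 (subst-e≥ _ _ _ _ _ _ e≈1 -1≤L))
  -- With t odd, L ≥ -1 gives u ≥ X - 1 > 0; then u is at least √2 and N is too large.
  rosen-local-pos √2<X 0≤y (inj₁ e≈1) (inj₁ (t∈ , u∈)) 0<t _ N≤1 -1≤L _ =
    lower (plus-odd-⊥ _ _ _ 0≤y (odd≥1-pos t∈ 0<t) N≤1 (rad-gap u∈
      (plus-odd-0<u _ _ _ √2<X (odd≥1-pos t∈ 0<t) (subst-e≥ _ _ _ _ _ _ e≈1 -1≤L))))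
  -- Here -u exceeds 1 and is therefore at least 3, whereas eliminating t from the two bounds leaves
  -- -u < 2.
  rosen-local-pos √2<X 0≤y (inj₂ (e≈-1 , y<)) (inj₂ (t∈ , u∈)) 0<t -1≤N _ _ L≤1 =
    lower (minus-rad-⊥ _ _ _ _ √2<X y< √2≤t -1≤N L≤1′
      (odd-gap (odd-neg u∈) (minus-rad-1<-u _ _ _ √2<X √2≤t L≤1′)))
    where
    √2≤t = rad-gap t∈ 0<t
    L≤1′ = subst-e≤ _ _ _ _ _ _ e≈-1 L≤1
  -- For t = 1, N is at most y - √2 < -1. For t ≥ 3, L - N = t (X - y) exceeds 3, although the
  -- bounds allow at most 2.
  rosen-local-pos {t = t} √2<X 0≤y (inj₂ (e≈-1 , y<)) (inj₁ (t∈ , u∈)) 0<t -1≤N _ _ L≤1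
    with odd≥1-pos t∈ 0<t
  ... | inj₁ 1<t = lower (minus-odd-t≥3-⊥ _ _ _ _ √2<X y< (odd-gap t∈ 1<t) -1≤N
                     (subst-e≤ _ _ _ _ _ _ e≈-1 L≤1))
  ... | inj₂ 1≈t = lower (minus-odd-t≈1-⊥ _ _ _ y< (sym 1≈t) -1≤N (rad-gap (rad-neg u∈)
                     (minus-odd-0<-u _ _ _ √2<X (inj₂ 1≈t) (subst-e≤ _ _ _ _ _ _ e≈-1 L≤1))))

  flip-N≤ = prove 3 (λ t u y →
      u :+ t :* y :≤ :1 ⊃ ⊢ :- :1 :≤ :- u :+ :- t :* y
      by ¬goal ⊕ hyp 0)
  flip-L≤ = prove 4 (λ e X t u →
      u :- e :* t :* X :≤ :1 ⊃ ⊢ :- :1 :≤ :- u :- e :* (:- t) :* X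
      by ¬goal ⊕ hyp 0)
  flip-L≥ = prove 4 (λ e X t u →
      :- :1 :≤ u :- e :* t :* X ⊃ ⊢ :- u :- e :* (:- t) :* X :≤ :1
      by ¬goal ⊕ hyp 0)
  flip-N≥1 = prove 3 (λ t u y →
      :- :1 :≤ u :+ t :* y ⊃ ⊢ :- u :+ :- t :* y :≤ :1
      by ¬goal ⊕ hyp 0)

  -- The region is symmetric under (t , u) ↦ (-t , -u), so t > 0 is the only case to exclude. The
  -- conclusion t = 0 places a competitor on the line of the convergent itself.
  rosen-local : ∀ {e X y t u} → √2 < X → 0# ≤ y → SignBound e y → Mixed t u →
                - 1# ≤ u + t * y → u + t * y ≤ 1# →
                - 1# ≤ u - e * t * X → u - e * t * X ≤ 1# → t ≈ 0#
  rosen-local {t = t} √2<X 0≤y ey tu -1≤N N≤1 -1≤L L≤1 with compare t 0#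
  ... | tri≈ _ t≈0 _ = t≈0
  ... | tri> _ _ 0<t = ⊥-elim (rosen-local-pos √2<X 0≤y ey tu 0<t -1≤N N≤1 -1≤L L≤1)
  ... | tri< t<0 _ _ = ⊥-elim (rosen-local-pos √2<X 0≤y ey (mixed-neg tu) (x<0⇒0<-x t<0)
          (flip-N≤ _ _ _ N≤1) (flip-N≥1 _ _ _ -1≤N) (flip-L≤ _ _ _ _ L≤1) (flip-L≥ _ _ _ _ -1≤L))

  skipped-t≈0-⊥ = prove 3 (λ y t u →
      :0 :< y ⊃ t :≈ :0 ⊃ u :+ t :* y :≤ :1 :- :√2 :* y ⊃ :1 :≤ u ⊃ ⊢ :⊥
      by 2 ×ᶜ hyp 0 ⊕ root ⊗ hyp 2 ⊕ root ⊗ hyp 3 ⊕ (:0 :- :√2 :* y) ⊙ hyp 1)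
  skipped-t≈0-0<u = prove 3 (λ y t u →
      t :≈ :0 ⊃ :0 :< u :+ t :* y ⊃ ⊢ :0 :< u
      by ¬goal ⊕ hyp 1 ⊕ y ⊙ hyp 0)
  skipped-u≥1-⊥ = prove 3 (λ y t u →
      :0 :< y ⊃ :0 :< t ⊃ :1 :≤ u ⊃ u :+ t :* y :≤ :1 :- :√2 :* y ⊃ ⊢ :⊥
      by (gap ⊕ gap ^ᶜ 2) ⊗ hyp 0 ⊕ gap ⊗ hyp 2 ⊕ gap ⊗ hyp 3 ⊕ gap ⊗ hyp 0 ⊗ hyp 1)
  skipped-u≈0-⊥ = prove 3 (λ X t u →
      :√2 :< X ⊃ X :< :1 :+ :√2 ⊃ :1 :≤ t ⊃ u :≈ :0 ⊃ u :+ t :* X :≤ :√2 :* X :- :1 ⊃ ⊢ :⊥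
      by hyp 1 ⊕ (2 ×ᶜ one ⊕ root) ⊗ hyp 2 ⊕ (one ⊕ root) ⊗ hyp 4 ⊕ (one ⊕ root) ⊗ hyp 0 ⊗ hyp 2
         ⊕ (:0 :- :1 :- :√2) ⊙ hyp 3)
  skipped-u≤-1-⊥ = prove 4 (λ X y t u →
      :√2 :< X ⊃ y :< :√2 :- :1 ⊃ :0 :< y ⊃ :0 :< t ⊃ :1 :≤ :- u ⊃ :0 :< u :+ t :* y ⊃
      u :+ t :* X :≤ :√2 :* X :- :1 ⊃ ⊢ :⊥
      by root ⊗ hyp 1 ⊕ root ⊗ hyp 2 ⊕ hyp 4 ⊕ root ⊗ hyp 5 ⊕ gap ⊗ hyp 6
         ⊕ gap ^ᶜ 2 ⊗ hyp 0 ⊗ hyp 3 ⊕ root ⊗ hyp 1 ⊗ hyp 3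
         ⊕ (gap ⊕ gap ^ᶜ 2) ⊗ hyp 3 ⊗ hyp 1 ⊗ hyp 0 ⊕ (gap ⊕ gap ^ᶜ 2) ⊗ hyp 5 ⊗ hyp 0
         ⊕ (gap ⊕ gap ^ᶜ 2) ⊗ hyp 4 ⊗ hyp 0)
  skipped-0<u = prove 3 (λ y t u →
      :0 :< y ⊃ :0 :< :- t ⊃ :0 :< u :+ t :* y ⊃ ⊢ :0 :< u
      by ¬goal ⊕ hyp 2 ⊕ hyp 0 ⊗ hyp 1)
  skipped-neg-t≤√2 = prove 4 (λ X y t u →
      :√2 :< X ⊃ y :< :√2 :- :1 ⊃ u :+ t :* y :≤ :1 :- :√2 :* y ⊃
      :- (:√2 :* X :- :1) :≤ u :+ t :* X ⊃ ⊢ :- t :≤ :√2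
      by ¬goal ⊕ hyp 2 ⊕ hyp 3 ⊕ ¬goal ⊗ hyp 0 ⊕ ¬goal ⊗ hyp 1)
  skipped-odd-⊥ = prove 3 (λ y t u →
      :0 :< y ⊃ :- t :≤ :√2 ⊃ :√2 :≤ u ⊃ u :+ t :* y :≤ :1 :- :√2 :* y ⊃ ⊢ :⊥
      by one ⊕ (one ⊕ root) ⊗ hyp 2 ⊕ (one ⊕ root) ⊗ hyp 3 ⊕ (one ⊕ root) ⊗ hyp 0 ⊗ hyp 1)
  skipped-u≤1 = prove 3 (λ y t u →
      t :≈ :- :√2 ⊃ u :+ t :* y :≤ :1 :- :√2 :* y ⊃ ⊢ u :≤ :1
      by ¬goal ⊕ hyp 1 ⊕ (:0 :- y) ⊙ hyp 0)
  -√2≤t = prove 1 (λ t →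
      :- t :≤ :√2 ⊃ :√2 :≤ :- t ⊃ ⊢ :- :√2 :≤ t
      by ¬goal ⊕ hyp 0)
  t≤-√2 = prove 1 (λ t →
      :- t :≤ :√2 ⊃ :√2 :≤ :- t ⊃ ⊢ t :≤ :- :√2
      by ¬goal ⊕ hyp 1)

  ≤-antisym : ∀ {x y} → x ≤ y → y ≤ x → x ≈ y
  ≤-antisym (inj₂ x≈y) _          = x≈y
  ≤-antisym (inj₁ _)   (inj₂ y≈x) = sym y≈x
  ≤-antisym (inj₁ x<y) (inj₁ y<x) = ⊥-elim (<-irrefl refl (<-trans x<y y<x))

  -- The bounds are those of the skipped vector (-√2 , 1), whose denominator is 1 - √2 y and whose
  -- error is 1 - √2 X: nothing else is as good as it in both respects.
  skipped-local : ∀ {X y t u} → √2 < X → X < 1# + √2 → 0# < y → y < √2 - 1# → Mixed t u →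
               0# < u + t * y → u + t * y ≤ 1# - √2 * y →
               - (√2 * X - 1#) ≤ u + t * X → u + t * X ≤ √2 * X - 1# → t ≈ - √2 × u ≈ 1#
  skipped-local {t = t} {u} √2<X X<1+√2 0<y y< tu 0<N N≤ ≤L L≤ with compare t 0#
  ... | tri≈ _ t≈0 _ = ⊥-elim (lower (skipped-t≈0-⊥ _ _ _ 0<y t≈0 N≤ (mixed≥1 tu (skipped-t≈0-0<u _ _ _ t≈0 0<N))))
  ... | tri> _ _ 0<t with compare u 0#
  ...   | tri> _ _ 0<u = ⊥-elim (lower (skipped-u≥1-⊥ _ _ _ 0<y 0<t (mixed≥1 tu 0<u) N≤))
  -- The point where X < 1 + √2 is essential: u = 0 and t ≥ 1 would give X ≤ √2 X - 1.
  ...   | tri≈ _ u≈0 _ = ⊥-elim (lower (skipped-u≈0-⊥ _ _ _ √2<X X<1+√2 (mixed≥1ˡ tu 0<t) u≈0 L≤))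
  ...   | tri< u<0 _ _ = ⊥-elim (lower (skipped-u≤-1-⊥ _ _ _ _ √2<X y< 0<y 0<t
            (mixed≥1 (mixed-neg tu) (x<0⇒0<-x u<0)) 0<N L≤))
  skipped-local {t = t} {u} √2<X X<1+√2 0<y y< tu 0<N N≤ ≤L L≤ | tri< t<0 _ _ = conclude tu
    where
    0<-t = x<0⇒0<-x t<0
    0<u  = skipped-0<u _ _ _ 0<y 0<-t 0<N
    -- Adding the upper bound on u + t y to the lower bound on u + t X gives (√2 + t)(X - y) ≥ 0.
    -t≤√2 = skipped-neg-t≤√2 _ _ _ _ √2<X y< N≤ ≤L
    conclude : Mixed t u → t ≈ - √2 × u ≈ 1#
    conclude (inj₁ (_ , u∈)) = ⊥-elim (lower (skipped-odd-⊥ _ _ _ 0<y -t≤√2 (rad-gap u∈ 0<u) N≤))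
    conclude (inj₂ (t∈ , u∈)) = t≈ , ≤-antisym (skipped-u≤1 _ _ _ t≈ N≤) (odd≥1-pos u∈ 0<u)
      where
      √2≤-t = rad-gap (rad-neg t∈) 0<-t
      t≈ : t ≈ - √2
      t≈ = ≤-antisym (t≤-√2 _ -t≤√2 √2≤-t) (-√2≤t _ -t≤√2 √2≤-t)

  minimal-t≈0-0<u = prove 3 (λ y t u →
      :0 :< y ⊃ t :≈ :0 ⊃ y :≤ u :+ t :* y ⊃ ⊢ :0 :< u
      by ¬goal ⊕ hyp 0 ⊕ hyp 2 ⊕ y ⊙ hyp 1)
  minimal-t≈0-⊥ = prove 3 (λ y t u →
      t :≈ :0 ⊃ u :+ t :* y :< :1 ⊃ :1 :≤ u ⊃ ⊢ :⊥
      by hyp 1 ⊕ hyp 2 ⊕ (:0 :- y) ⊙ hyp 0)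
  minimal-plus-0<u = prove 3 (λ X t u →
      :√2 :< X ⊃ :1 :≤ t ⊃ :- X :< u :- :1 :* t :* X ⊃ ⊢ :0 :< u
      by ¬goal ⊕ root ⊗ hyp 1 ⊕ hyp 2 ⊕ hyp 0 ⊗ hyp 1)
  minimal-plus-u≥1-⊥ = prove 3 (λ y t u →
      :0 :< y ⊃ :0 :< t ⊃ u :+ t :* y :< :1 ⊃ :1 :≤ u ⊃ ⊢ :⊥
      by hyp 2 ⊕ hyp 3 ⊕ hyp 0 ⊗ hyp 1)
  minimal-plus-t≤-1-⊥ = prove 4 (λ X y t u →
      :√2 :< X ⊃ :0 :< y ⊃ :1 :≤ :- t ⊃ y :≤ u :+ t :* y ⊃ u :- :1 :* t :* X :< X ⊃ ⊢ :⊥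
      by 2 ×ᶜ hyp 1 ⊕ root ⊗ hyp 2 ⊕ hyp 3 ⊕ hyp 4 ⊕ hyp 0 ⊗ hyp 2 ⊕ hyp 1 ⊗ hyp 2)
  minimal-minus-t≥1-⊥ = prove 4 (λ X y t u →
      :√2 :< X ⊃ y :< :√2 :- :1 ⊃ :1 :≤ t ⊃ y :≤ u :+ t :* y ⊃ u :- :- :1 :* t :* X :< X ⊃ ⊢ :⊥
      by hyp 2 ⊕ hyp 3 ⊕ hyp 4 ⊕ hyp 0 ⊗ hyp 2 ⊕ hyp 1 ⊗ hyp 2)
  minimal-minus-0<u = prove 3 (λ y t u →
      :0 :< y ⊃ :0 :< :- t ⊃ y :≤ u :+ t :* y ⊃ ⊢ :0 :< u
      by ¬goal ⊕ hyp 0 ⊕ hyp 2 ⊕ hyp 0 ⊗ hyp 1)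
  minimal-minus-t≈-1-⊥ = prove 3 (λ y t u →
      y :< :√2 :- :1 ⊃ :- t :≈ :1 ⊃ u :+ t :* y :< :1 ⊃ :√2 :≤ u ⊃ ⊢ :⊥
      by hyp 0 ⊕ hyp 2 ⊕ hyp 3 ⊕ y ⊙ hyp 1)
  minimal-minus-t≤-2√2-⊥ = prove 4 (λ X y t u →
      :√2 :< X ⊃ y :< :√2 :- :1 ⊃ :0 :< y ⊃ # 2 :* :√2 :≤ :- t ⊃ u :+ t :* y :< :1 ⊃
      :- X :< u :- :- :1 :* t :* X ⊃ ⊢ :⊥
      by (8 ×ᶜ gap ⊕ 9 ×ᶜ gap ^ᶜ 2) ⊗ hyp 0 ⊕ (20 ×ᶜ gap ⊕ 11 ×ᶜ gap ^ᶜ 2) ⊗ hyp 1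
         ⊕ (one ⊕ 4 ×ᶜ gap) ⊗ hyp 2 ⊕ (one ⊕ 4 ×ᶜ gap) ⊗ hyp 3 ⊕ (one ⊕ 4 ×ᶜ gap) ⊗ hyp 4
         ⊕ (one ⊕ 4 ×ᶜ gap) ⊗ hyp 5 ⊕ (one ⊕ 4 ×ᶜ gap) ⊗ hyp 0 ⊗ hyp 3
         ⊕ (one ⊕ 4 ×ᶜ gap) ⊗ hyp 1 ⊗ hyp 3)
  3≤x⇒2√2≤x = prove 1 (λ t →
      # 3 :≤ t ⊃ ⊢ # 2 :* :√2 :≤ t
      by gap ⊕ gap ^ᶜ 2 ⊕ (2 ×ᶜ one ⊕ root) ⊗ ¬goal ⊕ (2 ×ᶜ one ⊕ root) ⊗ hyp 0)
  minimal-minus-u≥3-⊥ = prove 3 (λ y t u →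
      y :< :√2 :- :1 ⊃ :- t :≈ :√2 ⊃ u :+ t :* y :< :1 ⊃ # 3 :≤ u ⊃ ⊢ :⊥
      by 5 ×ᶜ gap ⊕ 3 ×ᶜ gap ^ᶜ 2 ⊕ (5 ×ᶜ gap ⊕ 3 ×ᶜ gap ^ᶜ 2) ⊗ hyp 0 ⊕ (one ⊕ 2 ×ᶜ gap) ⊗ hyp 2
         ⊕ (one ⊕ 2 ×ᶜ gap) ⊗ hyp 3 ⊕ (:0 :- y :+ # 2 :* :√2 :* y) ⊙ hyp 1)
  minimal-minus-X<1+√2 = prove 3 (λ X t u →
      :- t :≈ :√2 ⊃ u :≈ :1 ⊃ :- X :< u :- :- :1 :* t :* X ⊃ ⊢ X :< :1 :+ :√2
      by gap ⊗ ¬goal ⊕ hyp 2 ⊕ (:0 :- X) ⊙ hyp 0 ⊕ :1 ⊙ hyp 1)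
  -t≈√2⇒t≈-√2 = prove 1 (λ t →
      :- t :≈ :√2 ⊃ ⊢ t :≈ :- :√2
      by (:0 :- :1) ⊙ hyp 0)

  subst-e> = prove 6 (λ e f t X u m →
      e :≈ f ⊃ m :< u :- e :* t :* X ⊃ ⊢ m :< u :- f :* t :* X
      by ¬goal ⊕ hyp 1 ⊕ (:0 :- X :* t) ⊙ hyp 0)
  subst-e< = prove 6 (λ e f t X u m →
      e :≈ f ⊃ u :- e :* t :* X :< m ⊃ ⊢ u :- f :* t :* X :< m
      by ¬goal ⊕ hyp 1 ⊕ (X :* t) ⊙ hyp 0)

  -- The previous convergent has coordinates (1 , 0), denominator y and absolute error X. The
  -- hypotheses thus describe a vector with denominator between the previous convergent and the
  -- current one and with an error strictly below that of the previous one.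
  minimal-local : ∀ {e X y t u} → √2 < X → 0# < y → SignBound e y → Mixed t u →
                  y ≤ u + t * y → u + t * y < 1# → - X < u - e * t * X → u - e * t * X < X →
                  e ≈ - 1# × t ≈ - √2 × u ≈ 1# × X < 1# + √2
  minimal-local {t = t} √2<X 0<y ey tu y≤N N<1 -X<L L<X with compare t 0#
  ... | tri≈ _ t≈0 _ = ⊥-elim (lower (minimal-t≈0-⊥ _ _ _ t≈0 N<1 (mixed≥1 tu (minimal-t≈0-0<u _ _ _ 0<y t≈0 y≤N))))
  minimal-local √2<X 0<y (inj₁ e≈1) tu y≤N N<1 -X<L L<X | tri> _ _ 0<t =
    ⊥-elim (lower (minimal-plus-u≥1-⊥ _ _ _ 0<y 0<t N<1 (mixed≥1 tu (minimal-plus-0<u _ _ _ √2<X (mixed≥1ˡ tu 0<t)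
      (subst-e> _ _ _ _ _ _ e≈1 -X<L)))))
  minimal-local √2<X 0<y (inj₁ e≈1) tu y≤N N<1 -X<L L<X | tri< t<0 _ _ =
    ⊥-elim (lower (minimal-plus-t≤-1-⊥ _ _ _ _ √2<X 0<y (mixed≥1ˡ (mixed-neg tu) (x<0⇒0<-x t<0)) y≤N
      (subst-e< _ _ _ _ _ _ e≈1 L<X)))
  minimal-local √2<X 0<y (inj₂ (e≈-1 , y<)) tu y≤N N<1 -X<L L<X | tri> _ _ 0<t =
    ⊥-elim (lower (minimal-minus-t≥1-⊥ _ _ _ _ √2<X y< (mixed≥1ˡ tu 0<t) y≤N (subst-e< _ _ _ _ _ _ e≈-1 L<X)))
  minimal-local {X = X} {y} {t} {u} √2<X 0<y (inj₂ (e≈-1 , y<)) tu y≤N N<1 -X<L _ | tri< t<0 _ _ =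
    e≈-1 , conclude tu
    where
    0<-t = x<0⇒0<-x t<0
    0<u  = minimal-minus-0<u _ _ _ 0<y 0<-t y≤N
    -X<L′ = subst-e> _ _ _ _ _ _ e≈-1 -X<L
    conclude : Mixed t u → t ≈ - √2 × u ≈ 1# × X < 1# + √2
    -- The bounds imply -t (X - y) < 1 + X, which fails once -t ≥ 2√2. As 3 ≥ 2√2, only -t = 1 and
    -- -t = √2 survive.
    conclude (inj₁ (t∈ , u∈)) with odd≥1-pos (odd-neg t∈) 0<-t
    ... | inj₁ 1<-t = ⊥-elim (lower (minimal-minus-t≤-2√2-⊥ _ _ _ _ √2<X y< 0<y
                        (3≤x⇒2√2≤x _ (odd-gap (odd-neg t∈) 1<-t)) N<1 -X<L′))
    ... | inj₂ 1≈-t = ⊥-elim (lower (minimal-minus-t≈-1-⊥ _ _ _ y< (sym 1≈-t) N<1 (rad-gap u∈ 0<u)))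
    conclude (inj₂ (t∈ , u∈)) with rad-gap (rad-neg t∈) 0<-t | odd≥1-pos u∈ 0<u
    ... | inj₁ √2<-t | _ = ⊥-elim (lower (minimal-minus-t≤-2√2-⊥ _ _ _ _ √2<X y< 0<y
                             (rad-gap-√2 (rad-neg t∈) √2<-t) N<1 -X<L′))
    ... | inj₂ √2≈-t | inj₁ 1<u =
          ⊥-elim (lower (minimal-minus-u≥3-⊥ _ _ _ y< (sym √2≈-t) N<1 (odd-gap u∈ 1<u)))
    -- For (-√2 , 1) the error bound reads √2 X - 1 < X, which is X < 1 + √2.
    ... | inj₂ √2≈-t | inj₂ 1≈u =
          -t≈√2⇒t≈-√2 _ (sym √2≈-t) , sym 1≈u , minimal-minus-X<1+√2 _ _ _ (sym √2≈-t) (sym 1≈u) -X<L′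

-- Digits and growth of denominators for both expansions.

module Denominators {c ℓ} (ℝ : CompleteOrderedField c ℓ)
  (√2 : CompleteOrderedField.Carrier ℝ)
  (0<√2 : CompleteOrderedField._<_ ℝ (CompleteOrderedField.0# ℝ) √2)
  (√2*√2≈2 : CompleteOrderedField._≈_ ℝ (CompleteOrderedField._*_ ℝ √2 √2)
     (CompleteOrderedField._+_ ℝ (CompleteOrderedField.1# ℝ) (CompleteOrderedField.1# ℝ)))
  where
  open Expansions ℝ √2 0<√2 √2*√2≈2 public
  open Lattice ℝ √2 0<√2 √2*√2≈2 public

  pos-x≈0-⊥ = prove 1 (λ x →
      :0 :< x ⊃ x :≈ :0 ⊃ ⊢ :⊥
      by hyp 0 ⊕ :1 ⊙ hyp 1)
  pos-x≤-1-⊥ = prove 1 (λ x →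
      :0 :< x ⊃ x :≤ :- :1 ⊃ ⊢ :⊥
      by one ⊕ hyp 0 ⊕ hyp 1)

  int-pos⇒≥1 : ∀ {x} → IsInt x → 0# < x → 1# ≤ x
  int-pos⇒≥1 x∈ 0<x with int-trichotomy x∈
  ... | inj₁ 1≤x         = 1≤x
  ... | inj₂ (inj₁ x≈0)  = ⊥-elim (lower (pos-x≈0-⊥ _ 0<x x≈0))
  ... | inj₂ (inj₂ x≤-1) = ⊥-elim (lower (pos-x≤-1-⊥ _ 0<x x≤-1))

  1<⇒0<-1 = prove 1 (λ x →
      :1 :< x ⊃ ⊢ :0 :< x :- :1
      by ¬goal ⊕ hyp 0)
  1≤-1⇒2≤ = prove 1 (λ x →
      :1 :≤ x :- :1 ⊃ ⊢ # 2 :≤ x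
      by ¬goal ⊕ hyp 0)

  int>1⇒≥2 : ∀ {x} → IsInt x → 1# < x → 1# + 1# ≤ x
  int>1⇒≥2 x∈ 1<x = 1≤-1⇒2≤ _ (int-pos⇒≥1 (int-+ x∈ (int-neg int-1)) (1<⇒0<-1 _ 1<x))

  fromSign-cases : ∀ s → fromSign s ≈ 1# ⊎ fromSign s ≈ - 1#
  fromSign-cases Sign.+ = inj₁ refl
  fromSign-cases Sign.- = inj₂ refl

  rosen-lower = prove 3 (λ A x i →
      A :* :√2 :- :1 :* i :< x ⊃ :√2 :* i :≈ :1 ⊃ ⊢ :- :√2 :< # 2 :* (x :- A :* :√2)
      by ¬goal ⊕ 2 ×ᶜ hyp 0 ⊕ :√2 ⊙ hyp 1)
  rosen-upper = prove 3 (λ A x i →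
      x :< A :* :√2 :+ :1 :* i ⊃ :√2 :* i :≈ :1 ⊃ ⊢ # 2 :* (x :- A :* :√2) :< :√2
      by ¬goal ⊕ 2 ×ᶜ hyp 0 ⊕ :√2 ⊙ hyp 1)
  √2<tail₊ = prove 3 (λ e t x →
      e :≈ :1 ⊃ # 2 :* t :< :√2 ⊃ :0 :< e :* t ⊃ x :* (e :* t) :≈ :1 ⊃ ⊢ :√2 :< x
      by hyp 1 ⊕ root ⊗ ¬goal ⊗ hyp 2 ⊕ (# 2 :* t) ⊙ hyp 0 ⊕ (:0 :- :√2) ⊙ hyp 3)
  √2<tail₋ = prove 3 (λ e t x →
      e :≈ :- :1 ⊃ :- :√2 :< # 2 :* t ⊃ :0 :< e :* t ⊃ x :* (e :* t) :≈ :1 ⊃ ⊢ :√2 :< x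
      by hyp 1 ⊕ root ⊗ ¬goal ⊗ hyp 2 ⊕ (# 2 :* t) ⊙ hyp 0 ⊕ (:0 :- :√2) ⊙ hyp 3)
  rosen-0<A = prove 2 (λ A x →
      :√2 :< x ⊃ # 2 :* (x :- A :* :√2) :< :√2 ⊃ ⊢ :0 :< A
      by one ⊕ 3 ×ᶜ gap ⊕ (2 ×ᶜ one ⊕ 6 ×ᶜ gap) ⊗ ¬goal ⊕ (6 ×ᶜ gap ⊕ 4 ×ᶜ gap ^ᶜ 2) ⊗ hyp 0
         ⊕ (3 ×ᶜ gap ⊕ 2 ×ᶜ gap ^ᶜ 2) ⊗ hyp 1)
  rosen-1<A = prove 3 (λ e A x →
      :√2 :< x ⊃ e :≈ :- :1 ⊃ :0 :< e :* (x :- A :* :√2) ⊃ ⊢ :1 :< A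
      by root ⊗ ¬goal ⊕ hyp 0 ⊕ hyp 2 ⊕ (:0 :- :√2 :* A :+ x) ⊙ hyp 1)

  den₂≈1 = prove 1 (λ A →
      ⊢ :1 :≈ A :* :√2 :* :0 :+ :1 :* :1
      by no-hypothesis)
  den-base₁ = prove 1 (λ N →
      :1 :≈ N ⊃ ⊢ :0 :< N
      by one ⊕ ¬goal ⊕ :1 ⊙ hyp 0)
  den-base₂ = prove 1 (λ N →
      :1 :≈ N ⊃ ⊢ :0 :< (:√2 :- :1) :* N
      by one ⊕ (one ⊕ root) ⊗ ¬goal ⊕ :1 ⊙ hyp 0)
  den-step₊ = prove 5 (λ A e a b N →
      N :≈ A :* :√2 :* b :+ e :* a ⊃ e :≈ :1 ⊃ :1 :≤ A ⊃ :0 :≤ a ⊃ a :< b ⊃ ⊢ b :< N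
      by (one ⊕ root) ⊗ ¬goal ⊕ (2 ×ᶜ one ⊕ root) ⊗ hyp 3 ⊕ hyp 4
         ⊕ (2 ×ᶜ one ⊕ root) ⊗ hyp 2 ⊗ hyp 4 ⊕ (2 ×ᶜ one ⊕ root) ⊗ hyp 2 ⊗ hyp 3
         ⊕ (:0 :- :1 :- :√2) ⊙ hyp 0 ⊕ (:0 :- a :- :√2 :* a) ⊙ hyp 1)
  den-step₋ = prove 5 (λ A e a b N →
      N :≈ A :* :√2 :* b :+ e :* a ⊃ e :≈ :- :1 ⊃ :1 :≤ A ⊃ :0 :≤ a ⊃ a :< (:√2 :- :1) :* b ⊃
      ⊢ b :< N
      by ¬goal ⊕ hyp 4 ⊕ (2 ×ᶜ one ⊕ root) ⊗ hyp 2 ⊗ hyp 4 ⊕ (2 ×ᶜ one ⊕ root) ⊗ hyp 2 ⊗ hyp 3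
         ⊕ (:0 :- :1) ⊙ hyp 0 ⊕ (:0 :- a) ⊙ hyp 1)
  den-step₊² = prove 5 (λ A e a b N →
      N :≈ A :* :√2 :* b :+ e :* a ⊃ e :≈ :1 ⊃ # 2 :≤ A ⊃ :0 :≤ a ⊃ a :< b ⊃
      ⊢ b :< (:√2 :- :1) :* N
      by (3 ×ᶜ one ⊕ 2 ×ᶜ root) ⊗ ¬goal ⊕ (2 ×ᶜ one ⊕ root) ⊗ hyp 3 ⊕ hyp 4
         ⊕ (2 ×ᶜ one ⊕ root) ⊗ hyp 2 ⊗ hyp 4 ⊕ (2 ×ᶜ one ⊕ root) ⊗ hyp 2 ⊗ hyp 3
         ⊕ (:0 :- :1 :- :√2) ⊙ hyp 0 ⊕ (:0 :- a :- :√2 :* a) ⊙ hyp 1)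
  den-step₋² = prove 5 (λ A e a b N →
      N :≈ A :* :√2 :* b :+ e :* a ⊃ e :≈ :- :1 ⊃ # 2 :≤ A ⊃ :0 :≤ a ⊃ a :< (:√2 :- :1) :* b ⊃
      ⊢ b :< (:√2 :- :1) :* N
      by (one ⊕ root) ⊗ ¬goal ⊕ hyp 4 ⊕ (2 ×ᶜ one ⊕ root) ⊗ hyp 2 ⊗ hyp 4
         ⊕ (2 ×ᶜ one ⊕ root) ⊗ hyp 2 ⊗ hyp 3 ⊕ (:0 :- :1) ⊙ hyp 0 ⊕ (:0 :- a) ⊙ hyp 1)
  0≤a<b⇒0≤b = prove 2 (λ a b →
      :0 :≤ a ⊃ a :< b ⊃ ⊢ :0 :≤ b
      by ¬goal ⊕ hyp 0 ⊕ hyp 1)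
  0≤a<b⇒0<b = prove 2 (λ a b →
      :0 :≤ a ⊃ a :< b ⊃ ⊢ :0 :< b
      by ¬goal ⊕ hyp 0 ⊕ hyp 1)
  den-growth₊ = prove 5 (λ A e a b N →
      N :≈ A :* :√2 :* b :+ e :* a ⊃ e :≈ :1 ⊃ :1 :≤ A ⊃ :1 :≤ b ⊃ :0 :≤ a ⊃ ⊢ a :+ :1 :≤ N
      by gap ⊕ gap ^ᶜ 2 ⊕ root ⊗ ¬goal ⊕ 2 ×ᶜ hyp 2 ⊕ 2 ×ᶜ hyp 3 ⊕ 2 ×ᶜ (hyp 2 ⊗ hyp 3)
         ⊕ (:0 :- :√2) ⊙ hyp 0 ⊕ (:0 :- :√2 :* a) ⊙ hyp 1)
  den-growth₋ = prove 3 (λ a b N →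
      a :< (:√2 :- :1) :* b ⊃ b :< N ⊃ :1 :≤ a ⊃ ⊢ a :+ :1 :≤ N
      by gap ^ᶜ 2 ⊕ gap ⊗ ¬goal ⊕ hyp 0 ⊕ gap ⊗ hyp 1 ⊕ (gap ⊕ gap ^ᶜ 2) ⊗ hyp 2)
  1≤-trans = prove 2 (λ a b →
      :1 :≤ a ⊃ a :< b ⊃ ⊢ :1 :≤ b
      by ¬goal ⊕ hyp 0 ⊕ hyp 1)
  ≤-+1 = prove 3 (λ a b k →
      k :≤ a ⊃ a :+ :1 :≤ b ⊃ ⊢ :1 :+ k :≤ b
      by ¬goal ⊕ hyp 0 ⊕ hyp 1)
  1≈⇒1+0≤ = prove 1 (λ N →
      :1 :≈ N ⊃ ⊢ :1 :+ :0 :≤ N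
      by ¬goal ⊕ :1 ⊙ hyp 0)
  1≈⇒1≤ = prove 1 (λ N →
      :1 :≈ N ⊃ ⊢ :1 :≤ N
      by ¬goal ⊕ :1 ⊙ hyp 0)

  module Rosen {α} (R : RosenExpansion α) where
    open Expansion R

    s : ℕ → Carrier
    s = den R

    private
      A : ℕ → Carrier
      A n = fromℤ (a n)

      √2*√2⁻¹≈1 : √2 * √2 ⁻¹ ≈ 1#
      √2*√2⁻¹≈1 = ⁻¹-inverseʳ (0<x⇒x≉0 0<√2)

    -√2<2θ : ∀ n → - √2 < (1# + 1#) * θ R n
    -√2<2θ n = rosen-lower _ _ _ (proj₁ (digit n)) √2*√2⁻¹≈1

    2θ<√2 : ∀ n → (1# + 1#) * θ R n < √2
    2θ<√2 n = rosen-upper _ _ _ (proj₂ (digit n)) √2*√2⁻¹≈1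

    √2<x : ∀ n → √2 < x (suc n)
    √2<x n with fromSign-cases (ε (suc n))
    ... | inj₁ e≈1  = √2<tail₊ _ _ _ e≈1 (2θ<√2 n) (0<eθ R n) (tail-unit R n)
    ... | inj₂ e≈-1 = √2<tail₋ _ _ _ e≈-1 (-√2<2θ n) (0<eθ R n) (tail-unit R n)

    1≤A : ∀ n → 1# ≤ A (suc n)
    1≤A n = int-pos⇒≥1 (int-fromℤ (a (suc n))) (rosen-0<A _ _ (√2<x n) (2θ<√2 (suc n)))

    -- The Rosen rule that a digit 1 is followed by the sign +1, in contrapositive form: a negative
    -- remainder means that the multiple of √2 lies above a complete quotient greater than √2.
    2≤A : ∀ n → e R (2 ℕ.+ n) ≈ - 1# → 1# + 1# ≤ A (suc n)
    2≤A n e≈-1 = int>1⇒≥2 (int-fromℤ (a (suc n))) (rosen-1<A _ _ _ (√2<x n) e≈-1 (0<eθ R (suc n)))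

    Ratio : ℕ → Set ℓ
    Ratio n = e R n ≈ 1# ⊎ (e R n ≈ - 1# × s n < (√2 - 1#) * s (suc n))

    s₂≈1 : 1# ≈ s 2
    s₂≈1 = den₂≈1 _

    -- The claims need each other. After a sign -1 and a digit 1, strict growth means √2 b - a > b,
    -- which is the bound a < (√2 - 1) b; conversely a sign -1 comes after a digit at least 2, and 1
    -- / (2√2 - w) stays below √2 - 1 when w does.
    bounds : ∀ n → 0# ≤ s (suc n) × s (suc n) < s (2 ℕ.+ n) × Ratio (suc n)
    bounds zero = inj₂ refl , den-base₁ _ s₂≈1 , ratio (fromSign-cases (ε 1))
      where
      ratio : e R 1 ≈ 1# ⊎ e R 1 ≈ - 1# → Ratio 1
      ratio (inj₁ e≈1)  = inj₁ e≈1
      ratio (inj₂ e≈-1) = inj₂ (e≈-1 , den-base₂ _ s₂≈1)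
    bounds (suc n) = next (bounds n)
      where
      next : 0# ≤ s (suc n) × s (suc n) < s (2 ℕ.+ n) × Ratio (suc n) →
             0# ≤ s (2 ℕ.+ n) × s (2 ℕ.+ n) < s (3 ℕ.+ n) × Ratio (2 ℕ.+ n)
      next (0≤s , s<s′ , inj₁ e≈1) =
        0≤a<b⇒0≤b _ _ 0≤s s<s′ , den-step₊ _ _ _ _ _ refl e≈1 (1≤A n) 0≤s s<s′ ,
        ratio (fromSign-cases (ε (2 ℕ.+ n)))
        where
        ratio : e R (2 ℕ.+ n) ≈ 1# ⊎ e R (2 ℕ.+ n) ≈ - 1# → Ratio (2 ℕ.+ n)
        ratio (inj₁ e′≈1)  = inj₁ e′≈1
        ratio (inj₂ e′≈-1) = inj₂ (e′≈-1 , den-step₊² _ _ _ _ _ refl e≈1 (2≤A n e′≈-1) 0≤s s<s′)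
      next (0≤s , s<s′ , inj₂ (e≈-1 , s<)) =
        0≤a<b⇒0≤b _ _ 0≤s s<s′ , den-step₋ _ _ _ _ _ refl e≈-1 (1≤A n) 0≤s s< ,
        ratio (fromSign-cases (ε (2 ℕ.+ n)))
        where
        ratio : e R (2 ℕ.+ n) ≈ 1# ⊎ e R (2 ℕ.+ n) ≈ - 1# → Ratio (2 ℕ.+ n)
        ratio (inj₁ e′≈1)  = inj₁ e′≈1
        ratio (inj₂ e′≈-1) = inj₂ (e′≈-1 , den-step₋² _ _ _ _ _ refl e≈-1 (2≤A n e′≈-1) 0≤s s<)

    0≤s : ∀ n → 0# ≤ s (suc n)
    0≤s n = proj₁ (bounds n)

    s<s : ∀ n → s (suc n) < s (2 ℕ.+ n)
    s<s n = proj₁ (proj₂ (bounds n))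

    ratio : ∀ n → Ratio (suc n)
    ratio n = proj₂ (proj₂ (bounds n))

    1≤s : ∀ n → 1# ≤ s (2 ℕ.+ n)
    1≤s zero    = 1≈⇒1≤ _ s₂≈1
    1≤s (suc n) = 1≤-trans _ _ (1≤s n) (s<s (suc n))

    0<s : ∀ n → 0# < s (2 ℕ.+ n)
    0<s n = 0≤a<b⇒0<b _ _ (0≤s n) (s<s n)

    -- Two steps are taken because one may gain less than 1, as from 2√2 to √2 · 2√2 - 1 = 3.
    s+1≤s : ∀ n → s (2 ℕ.+ n) + 1# ≤ s (4 ℕ.+ n)
    s+1≤s n with ratio (suc n)
    ... | inj₁ e≈1      = den-growth₊ _ _ _ _ _ refl e≈1 (1≤A (suc n)) (1≤s (suc n)) (0≤s (suc n))
    ... | inj₂ (_ , s<) = den-growth₋ _ _ _ s< (s<s (2 ℕ.+ n)) (1≤s n)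

    s-unbounded : ∀ k → ∃ λ n → 1# + fromℤ (+ k) ≤ s (2 ℕ.+ n)
    s-unbounded zero    = 0 , 1≈⇒1+0≤ _ s₂≈1
    s-unbounded (suc k) with s-unbounded k
    ... | n , k≤s = 2 ℕ.+ n , ≤-+1 _ _ _ k≤s (s+1≤s n)

  dual-θ₊ = prove 5 (λ A z e t x →
      z :< A :* :√2 :+ :1 ⊃ t :≈ z :- A :* :√2 ⊃ e :≈ :1 ⊃ :0 :< e :* t ⊃ x :* (e :* t) :≈ :1 ⊃
      ⊢ :1 :< x
      by hyp 0 ⊕ ¬goal ⊗ hyp 3 ⊕ :1 ⊙ hyp 1 ⊕ t ⊙ hyp 2 ⊕ (:0 :- :1) ⊙ hyp 4)
  dual-θ₋ = prove 5 (λ A z e t x →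
      (A :- :1) :* :√2 :+ :1 :≤ z ⊃ t :≈ z :- A :* :√2 ⊃ e :≈ :- :1 ⊃ :0 :< e :* t ⊃
      x :* (e :* t) :≈ :1 ⊃ ⊢ :1 :+ :√2 :≤ x
      by (one ⊕ root) ⊗ hyp 0 ⊕ ¬goal ⊗ hyp 3 ⊕ (:0 :- :1 :- :√2) ⊙ hyp 1
         ⊕ (t :+ :√2 :* t) ⊙ hyp 2 ⊕ (:0 :- :1) ⊙ hyp 4)
  dual-0<A = prove 2 (λ A z →
      :1 :< z ⊃ z :< A :* :√2 :+ :1 ⊃ ⊢ :0 :< A
      by root ⊗ ¬goal ⊕ hyp 0 ⊕ hyp 1)
  dual-1<A = prove 2 (λ A z →
      :1 :+ :√2 :≤ z ⊃ z :< A :* :√2 :+ :1 ⊃ ⊢ :1 :< A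
      by root ⊗ ¬goal ⊕ hyp 0 ⊕ hyp 1)
  dual-step₊ = prove 5 (λ A e a b N →
      N :≈ A :* :√2 :* b :+ e :* a ⊃ e :≈ :1 ⊃ :1 :≤ A ⊃ :0 :≤ a ⊃ a :≤ b ⊃ :0 :< b ⊃ ⊢ b :≤ N
      by root ⊗ ¬goal ⊕ root ⊗ hyp 3 ⊕ (gap ⊕ gap ^ᶜ 2) ⊗ hyp 5 ⊕ 2 ×ᶜ (hyp 2 ⊗ hyp 5)
         ⊕ (:0 :- :√2) ⊙ hyp 0 ⊕ (:0 :- :√2 :* a) ⊙ hyp 1)
  dual-step₋ = prove 5 (λ A e a b N →
      N :≈ A :* :√2 :* b :+ e :* a ⊃ e :≈ :- :1 ⊃ # 2 :≤ A ⊃ :0 :≤ a ⊃ a :≤ b ⊃ :0 :< b ⊃ ⊢ b :≤ N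
      by (one ⊕ 2 ×ᶜ root) ⊗ ¬goal ⊕ (one ⊕ 2 ×ᶜ root) ⊗ hyp 4
         ⊕ (6 ×ᶜ gap ⊕ 4 ×ᶜ gap ^ᶜ 2) ⊗ hyp 5 ⊕ (4 ×ᶜ one ⊕ root) ⊗ hyp 2 ⊗ hyp 5
         ⊕ (:0 :- :1 :- # 2 :* :√2) ⊙ hyp 0 ⊕ (:0 :- a :- # 2 :* :√2 :* a) ⊙ hyp 1)
  dual-base = prove 1 (λ N →
      :1 :≈ N ⊃ ⊢ :0 :≤ N
      by one ⊕ ¬goal ⊕ :1 ⊙ hyp 0)
  0<b≤c = prove 2 (λ b c →
      :0 :< b ⊃ b :≤ c ⊃ ⊢ :0 :< c
      by ¬goal ⊕ hyp 0 ⊕ hyp 1)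
  0<⇒0≤ = prove 1 (λ b →
      :0 :< b ⊃ ⊢ :0 :≤ b
      by ¬goal ⊕ hyp 0)

  module Dual {α} (D : DualRosenExpansion α) where
    open Expansion D

    s : ℕ → Carrier
    s = den D

    private
      A : ℕ → Carrier
      A n = fromℤ (a n)

    -- The dual rule ties a digit to the sign before it, whereas the Rosen rule ties it to the sign
    -- after it: a dual remainder that is negative is at least 1 - √2, so the next complete quotient
    -- is at least 1 + √2.
    DigitBound : ℕ → Set ℓ
    DigitBound n = (e D n ≈ 1# × 1# ≤ A n) ⊎ (e D n ≈ - 1# × 1# + 1# ≤ A n)

    digit-bound : ∀ n → DigitBound (suc n)
    digit-bound n with fromSign-cases (ε (suc n))
    ... | inj₁ e≈1  = inj₁ (e≈1 , int-pos⇒≥1 (int-fromℤ (a (suc n))) (dual-0<A _ _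
            (dual-θ₊ _ _ _ _ _ (proj₂ (digit n)) refl e≈1 (0<eθ D n) (tail-unit D n))
            (proj₂ (digit (suc n)))))
    ... | inj₂ e≈-1 = inj₂ (e≈-1 , int>1⇒≥2 (int-fromℤ (a (suc n))) (dual-1<A _ _
            (dual-θ₋ _ _ _ _ _ (proj₁ (digit n)) refl e≈-1 (0<eθ D n) (tail-unit D n))
            (proj₂ (digit (suc n)))))

    -- The aim is positivity. Monotonicity is carried along to control the term subtracted when the
    -- sign is -1; with a digit at least 2 it leaves at least (2√2 - 1) b.
    bounds : ∀ n → 0# ≤ s (suc n) × s (suc n) ≤ s (2 ℕ.+ n) × 0# < s (2 ℕ.+ n)
    bounds zero = inj₂ refl , dual-base _ (den₂≈1 _) , den-base₁ _ (den₂≈1 _)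
    bounds (suc n) = next (bounds n) (digit-bound n)
      where
      next : 0# ≤ s (suc n) × s (suc n) ≤ s (2 ℕ.+ n) × 0# < s (2 ℕ.+ n) → DigitBound (suc n) →
             0# ≤ s (2 ℕ.+ n) × s (2 ℕ.+ n) ≤ s (3 ℕ.+ n) × 0# < s (3 ℕ.+ n)
      next (0≤s , s≤s′ , 0<s′) bound = 0<⇒0≤ _ 0<s′ , s′≤s″ bound , 0<b≤c _ _ 0<s′ (s′≤s″ bound)
        where
        s′≤s″ : DigitBound (suc n) → s (2 ℕ.+ n) ≤ s (3 ℕ.+ n)
        s′≤s″ (inj₁ (e≈1 , 1≤A))  = dual-step₊ _ _ _ _ _ refl e≈1 1≤A 0≤s s≤s′ 0<s′
        s′≤s″ (inj₂ (e≈-1 , 2≤A)) = dual-step₋ _ _ _ _ _ refl e≈-1 2≤A 0≤s s≤s′ 0<s′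

    0<s : ∀ n → 0# < s (2 ℕ.+ n)
    0<s n = proj₂ (proj₂ (bounds n))

-- Running the two algorithms in parallel.

module Synchronisation {c ℓ} (ℝ : CompleteOrderedField c ℓ)
  (√2 : CompleteOrderedField.Carrier ℝ)
  (0<√2 : CompleteOrderedField._<_ ℝ (CompleteOrderedField.0# ℝ) √2)
  (√2*√2≈2 : CompleteOrderedField._≈_ ℝ (CompleteOrderedField._*_ ℝ √2 √2)
     (CompleteOrderedField._+_ ℝ (CompleteOrderedField.1# ℝ) (CompleteOrderedField.1# ℝ)))
  where
  open Denominators ℝ √2 0<√2 √2*√2≈2 public

  sign-contra = prove 2 (λ e t →
      :0 :< e :* t ⊃ e :≈ :- :1 ⊃ :0 :< t ⊃ ⊢ :⊥
      by hyp 0 ⊕ hyp 2 ⊕ t ⊙ hyp 1)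
  sign-contra⁻ = prove 2 (λ e t →
      :0 :< e :* t ⊃ e :≈ :1 ⊃ t :< :0 ⊃ ⊢ :⊥
      by hyp 0 ⊕ hyp 2 ⊕ t ⊙ hyp 1)

  sign-pos : ∀ {e t} → e ≈ 1# ⊎ e ≈ - 1# → 0# < e * t → 0# < t → e ≈ 1#
  sign-pos (inj₁ e≈1)  _    _   = e≈1
  sign-pos (inj₂ e≈-1) 0<et 0<t = ⊥-elim (lower (sign-contra _ _ 0<et e≈-1 0<t))

  sign-neg : ∀ {e t} → e ≈ 1# ⊎ e ≈ - 1# → 0# < e * t → t < 0# → e ≈ - 1#
  sign-neg (inj₁ e≈1)  0<et t<0 = ⊥-elim (lower (sign-contra⁻ _ _ 0<et e≈1 t<0))
  sign-neg (inj₂ e≈-1) _    _   = e≈-1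

  pos-of = prove 2 (λ e t →
      e :≈ :1 ⊃ :0 :< e :* t ⊃ ⊢ :0 :< t
      by ¬goal ⊕ hyp 1 ⊕ t ⊙ hyp 0)
  neg-of = prove 2 (λ e t →
      e :≈ :- :1 ⊃ :0 :< e :* t ⊃ ⊢ t :< :0
      by ¬goal ⊕ hyp 1 ⊕ t ⊙ hyp 0)
  pos≈ = prove 2 (λ t u →
      t :≈ u ⊃ :0 :< t ⊃ ⊢ :0 :< u
      by ¬goal ⊕ hyp 1 ⊕ :1 ⊙ hyp 0)
  neg≈ = prove 2 (λ t u →
      t :≈ u ⊃ t :< :0 ⊃ ⊢ u :< :0
      by ¬goal ⊕ hyp 1 ⊕ (:0 :- :1) ⊙ hyp 0)

  sign-unique : ∀ {e f t u} → e ≈ 1# ⊎ e ≈ - 1# → f ≈ 1# ⊎ f ≈ - 1# →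
                0# < e * t → 0# < f * u → t ≈ u → f ≈ e
  sign-unique (inj₁ e≈1)  f 0<et 0<fu t≈u =
    trans (sign-pos f 0<fu (pos≈ _ _ t≈u (pos-of _ _ e≈1 0<et))) (sym e≈1)
  sign-unique (inj₂ e≈-1) f 0<et 0<fu t≈u =
    trans (sign-neg f 0<fu (neg≈ _ _ t≈u (neg-of _ _ e≈-1 0<et))) (sym e≈-1)

  start-tail = prove 3 (λ x y a →
      x :≈ a ⊃ y :≈ a ⊃ ⊢ y :≈ x :+ :0 :* :√2
      by (:0 :- :1) ⊙ hyp 0 ⊕ :1 ⊙ hyp 1)
  start-K = prove 2 (λ a b →
      ⊢ :1 :* a :≈ :1 :* a :- :0 :* :√2 :* b
      by no-hypothesis)
  same-δ≥1-⊥ = prove 5 (λ A B k x z →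
      z :≈ x :+ k :* :√2 ⊃ (B :- :1) :* :√2 :+ :1 :≤ z ⊃ # 2 :* (x :- A :* :√2) :< :√2 ⊃
      :1 :≤ B :- A :- k ⊃ ⊢ :⊥
      by 5 ×ᶜ gap ⊕ 3 ×ᶜ gap ^ᶜ 2 ⊕ (6 ×ᶜ one ⊕ 2 ×ᶜ root) ⊗ hyp 1 ⊕ (3 ×ᶜ one ⊕ root) ⊗ hyp 2
         ⊕ (4 ×ᶜ one ⊕ 6 ×ᶜ root) ⊗ hyp 3 ⊕ (# 6 :+ # 2 :* :√2) ⊙ hyp 0)
  same-δ≤-2-⊥ = prove 5 (λ A B k x z →
      z :≈ x :+ k :* :√2 ⊃ z :< B :* :√2 :+ :1 ⊃ :- :√2 :< # 2 :* (x :- A :* :√2) ⊃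
      B :- A :- k :+ :1 :≤ :- :1 ⊃ ⊢ :⊥
      by 13 ×ᶜ gap ⊕ 11 ×ᶜ gap ^ᶜ 2 ⊕ (4 ×ᶜ one ⊕ 6 ×ᶜ gap) ⊗ hyp 1
         ⊕ (2 ×ᶜ one ⊕ 3 ×ᶜ gap) ⊗ hyp 2 ⊕ (18 ×ᶜ gap ⊕ 10 ×ᶜ gap ^ᶜ 2) ⊗ hyp 3
         ⊕ (# 2 :- # 6 :* :√2) ⊙ hyp 0)
  δ+1≈0⇒δ≈-1 = prove 3 (λ A B k →
      B :- A :- k :+ :1 :≈ :0 ⊃ ⊢ B :- A :- k :≈ :- :1
      by :1 ⊙ hyp 0)
  δ≤-1-0<δ-⊥ = prove 3 (λ A B k →
      B :- A :- k :≤ :- :1 ⊃ :1 :≤ B :- A :- k :+ :1 ⊃ ⊢ :⊥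
      by one ⊕ hyp 0 ⊕ hyp 1)
  same-θ = prove 5 (λ A B k x z →
      z :≈ x :+ k :* :√2 ⊃ B :- A :- k :≈ :0 ⊃ ⊢ x :- A :* :√2 :≈ z :- B :* :√2
      by (:0 :- :1) ⊙ hyp 0 ⊕ :√2 ⊙ hyp 1)
  same-θ≥ = prove 5 (λ A B k x z →
      z :≈ x :+ k :* :√2 ⊃ B :- A :- k :≈ :0 ⊃ (B :- :1) :* :√2 :+ :1 :≤ z ⊃
      ⊢ :1 :- :√2 :≤ x :- A :* :√2
      by ¬goal ⊕ hyp 2 ⊕ :1 ⊙ hyp 0 ⊕ (:0 :- :√2) ⊙ hyp 1)
  same-tail = prove 6 (λ e f t u x z →
      f :≈ e ⊃ t :≈ u ⊃ x :* (e :* t) :≈ :1 ⊃ z :* (f :* u) :≈ :1 ⊃ ⊢ z :≈ x :+ :0 :* :√2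
      by (:0 :- u :* x :* z) ⊙ hyp 0 ⊕ (e :* x :* z) ⊙ hyp 1 ⊕ (:0 :- z) ⊙ hyp 2 ⊕ x ⊙ hyp 3)
  same-K = prove 9 (λ A B k e f a b c d →
      B :- A :- k :≈ :0 ⊃ d :≈ b ⊃ f :* c :≈ e :* a :- k :* :√2 :* b ⊃
      ⊢ B :* :√2 :* d :+ f :* c :≈ A :* :√2 :* b :+ e :* a
      by (:√2 :* b) ⊙ hyp 0 ⊕ (:√2 :* B) ⊙ hyp 1 ⊕ :1 ⊙ hyp 2)
  same-K′ = prove 5 (λ e f d b N →
      f :≈ e ⊃ d :≈ b ⊃ ⊢ f :* d :≈ e :* b :- :0 :* :√2 :* N
      by d ⊙ hyp 0 ⊕ e ⊙ hyp 1)
  same-x≥ = prove 3 (λ e t x →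
      e :≈ :- :1 ⊃ :1 :- :√2 :≤ t ⊃ :0 :< e :* t ⊃ x :* (e :* t) :≈ :1 ⊃ ⊢ :1 :+ :√2 :≤ x
      by (one ⊕ root) ⊗ hyp 1 ⊕ ¬goal ⊗ hyp 2 ⊕ (t :+ :√2 :* t) ⊙ hyp 0 ⊕ (:0 :- :1) ⊙ hyp 3)
  split-θ<1-√2 = prove 5 (λ A B k x z →
      z :≈ x :+ k :* :√2 ⊃ B :- A :- k :≈ :- :1 ⊃ z :< B :* :√2 :+ :1 ⊃
      ⊢ x :- A :* :√2 :< :1 :- :√2
      by ¬goal ⊕ hyp 2 ⊕ (:0 :- :1) ⊙ hyp 0 ⊕ :√2 ⊙ hyp 1)
  θ<0 = prove 1 (λ t →
      t :< :1 :- :√2 ⊃ ⊢ t :< :0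
      by gap ⊕ gap ^ᶜ 2 ⊕ root ⊗ ¬goal ⊕ root ⊗ hyp 0)
  split-dual-θ = prove 5 (λ A B k x z →
      z :≈ x :+ k :* :√2 ⊃ B :- A :- k :≈ :- :1 ⊃ ⊢ x :- A :* :√2 :+ :√2 :≈ z :- B :* :√2
      by (:0 :- :1) ⊙ hyp 0 ⊕ :√2 ⊙ hyp 1)
  split-0<dual-θ = prove 2 (λ t u →
      t :+ :√2 :≈ u ⊃ :- :√2 :< # 2 :* t ⊃ ⊢ :0 :< u
      by gap ⊕ gap ^ᶜ 2 ⊕ 2 ×ᶜ gap ⊗ ¬goal ⊕ gap ⊗ hyp 1 ⊕ (:0 :- # 2 :+ # 2 :* :√2) ⊙ hyp 0)
  split-x<1+√2 = prove 3 (λ e t x →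
      e :≈ :- :1 ⊃ t :< :1 :- :√2 ⊃ :0 :< e :* t ⊃ x :* (e :* t) :≈ :1 ⊃ ⊢ x :< :1 :+ :√2
      by hyp 1 ⊕ gap ⊗ ¬goal ⊗ hyp 2 ⊕ (:0 :- t) ⊙ hyp 0 ⊕ (:0 :- :1 :+ :√2) ⊙ hyp 3)
  split-z = prove 6 (λ e f t u x z →
      e :≈ :- :1 ⊃ f :≈ :1 ⊃ t :+ :√2 :≈ u ⊃ x :* (e :* t) :≈ :1 ⊃ z :* (f :* u) :≈ :1 ⊃
      ⊢ (z :- :0 :* :√2) :* (:√2 :* x :- :1) :≈ x
      by (:0 :- t :* x :* z) ⊙ hyp 0 ⊕ (:0 :- u :* x :* z) ⊙ hyp 1 ⊕ (x :* z) ⊙ hyp 2 ⊕ z ⊙ hyp 3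
         ⊕ x ⊙ hyp 4)
  split-K = prove 9 (λ A B k e f a b c d →
      B :- A :- k :≈ :- :1 ⊃ d :≈ b ⊃ f :* c :≈ e :* a :- k :* :√2 :* b ⊃
      ⊢ B :* :√2 :* d :+ f :* c :≈ A :* :√2 :* b :+ e :* a :- :√2 :* b
      by (:√2 :* b) ⊙ hyp 0 ⊕ (:√2 :* B) ⊙ hyp 1 ⊕ :1 ⊙ hyp 2)
  split-K′ = prove 4 (λ f d b N →
      f :≈ :1 ⊃ d :≈ b ⊃ ⊢ f :* d :≈ b :- :0 :* :√2 :* N
      by d ⊙ hyp 0 ⊕ :1 ⊙ hyp 1)

  split-δ≥1-⊥ = prove 4 (λ B k x z →
      (z :- k :* :√2) :* (:√2 :* x :- :1) :≈ x ⊃ :√2 :< x ⊃ (B :- :1) :* :√2 :+ :1 :≤ z ⊃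
      :1 :≤ B :- :1 :- k ⊃ ⊢ :⊥
      by gap ⊕ gap ^ᶜ 2 ⊕ root ⊗ hyp 1 ⊕ (gap ⊕ gap ^ᶜ 2) ⊗ hyp 2 ⊕ 2 ×ᶜ gap ⊗ hyp 3
         ⊕ 2 ×ᶜ gap ⊗ hyp 1 ⊗ hyp 2 ⊕ (2 ×ᶜ gap ⊕ 2 ×ᶜ gap ^ᶜ 2) ⊗ hyp 1 ⊗ hyp 3
         ⊕ (# 2 :- :√2) ⊙ hyp 0)
  split-δ≤-1-⊥ = prove 4 (λ B k x z →
      (z :- k :* :√2) :* (:√2 :* x :- :1) :≈ x ⊃ :√2 :< x ⊃ x :< :1 :+ :√2 ⊃ z :< B :* :√2 :+ :1 ⊃
      B :- :1 :- k :≤ :- :1 ⊃ ⊢ :⊥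
      by (gap ⊕ gap ^ᶜ 2) ⊗ hyp 2 ⊕ root ⊗ hyp 3 ⊕ 2 ×ᶜ hyp 4 ⊕ 2 ×ᶜ (hyp 1 ⊗ hyp 3)
         ⊕ 2 ×ᶜ root ⊗ hyp 1 ⊗ hyp 4 ⊕ (:0 :- :√2) ⊙ hyp 0)
  split-A≤0-⊥ = prove 2 (λ A x →
      :√2 :< x ⊃ # 2 :* (x :- A :* :√2) :< :√2 ⊃ A :- :1 :≤ :- :1 ⊃ ⊢ :⊥
      by one ⊕ 3 ×ᶜ gap ⊕ (6 ×ᶜ gap ⊕ 4 ×ᶜ gap ^ᶜ 2) ⊗ hyp 0 ⊕ (3 ×ᶜ gap ⊕ 2 ×ᶜ gap ^ᶜ 2) ⊗ hyp 1
         ⊕ (2 ×ᶜ one ⊕ 6 ×ᶜ gap) ⊗ hyp 2)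
  split-A≥3-⊥ = prove 2 (λ A x →
      x :< :1 :+ :√2 ⊃ :- :√2 :< # 2 :* (x :- A :* :√2) ⊃ :1 :≤ A :- :1 :- :1 ⊃ ⊢ :⊥
      by 13 ×ᶜ gap ⊕ 11 ×ᶜ gap ^ᶜ 2 ⊕ (4 ×ᶜ one ⊕ 6 ×ᶜ gap) ⊗ hyp 0
         ⊕ (2 ×ᶜ one ⊕ 3 ×ᶜ gap) ⊗ hyp 1 ⊕ (18 ×ᶜ gap ⊕ 10 ×ᶜ gap ^ᶜ 2) ⊗ hyp 2)
  2≤A-A≤1-⊥ = prove 1 (λ A →
      :1 :≤ A :- :1 ⊃ A :- :1 :- :1 :≤ :- :1 ⊃ ⊢ :⊥
      by one ⊕ hyp 0 ⊕ hyp 1)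
  split-dual-θ<0 = prove 4 (λ B k x z →
      (z :- k :* :√2) :* (:√2 :* x :- :1) :≈ x ⊃ :√2 :< x ⊃ B :- :1 :- k :≈ :0 ⊃
      ⊢ z :- B :* :√2 :< :0
      by ¬goal ⊕ hyp 1 ⊕ root ⊗ ¬goal ⊗ hyp 1 ⊕ :1 ⊙ hyp 0 ⊕ (:√2 :- # 2 :* x) ⊙ hyp 2)
  split-dual-tail = prove 6 (λ B k x z f y →
      (z :- k :* :√2) :* (:√2 :* x :- :1) :≈ x ⊃ B :- :1 :- k :≈ :0 ⊃ f :≈ :- :1 ⊃
      y :* (f :* (z :- B :* :√2)) :≈ :1 ⊃ ⊢ y :* (x :- :√2) :≈ :√2 :* x :- :1
      by y ⊙ hyp 0 ⊕ (:√2 :* y :- # 2 :* x :* y) ⊙ hyp 1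
         ⊕ (:0 :- :√2 :* B :* y :+ y :* z :+ # 2 :* B :* x :* y :- :√2 :* x :* y :* z) ⊙ hyp 2
         ⊕ (:0 :- :1 :+ :√2 :* x) ⊙ hyp 3)
  merge-0<θ = prove 2 (λ A x →
      :√2 :< x ⊃ A :- :1 :≈ :0 ⊃ ⊢ :0 :< x :- A :* :√2
      by ¬goal ⊕ hyp 0 ⊕ :√2 ⊙ hyp 1)
  stay-θ<0 = prove 2 (λ A x →
      x :< :1 :+ :√2 ⊃ A :- :1 :- :1 :≈ :0 ⊃ ⊢ x :- A :* :√2 :< :0
      by gap ⊕ gap ^ᶜ 2 ⊕ root ⊗ ¬goal ⊕ root ⊗ hyp 0 ⊕ (:0 :- # 2) ⊙ hyp 1)
  merge-tail = prove 5 (λ A e x y w →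
      A :- :1 :≈ :0 ⊃ e :≈ :1 ⊃ w :* (e :* (x :- A :* :√2)) :≈ :1 ⊃
      y :* (x :- :√2) :≈ :√2 :* x :- :1 ⊃ ⊢ y :≈ w :+ :1 :* :√2
      by (# 2 :* w :- :√2 :* w :* y) ⊙ hyp 0
         ⊕ (# 2 :* A :* w :- :√2 :* w :* x :- :√2 :* A :* w :* y :+ w :* x :* y) ⊙ hyp 1
         ⊕ (:√2 :- y) ⊙ hyp 2 ⊕ w ⊙ hyp 3)
  merge-K = prove 9 (λ A B k e f a b c d →
      A :- :1 :≈ :0 ⊃ B :- :1 :- k :≈ :0 ⊃ e :≈ :- :1 ⊃ d :≈ b :- :√2 :* a ⊃
      f :* c :≈ a :- k :* :√2 :* d ⊃ ⊢ B :* :√2 :* d :+ f :* c :≈ A :* :√2 :* b :+ e :* a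
      by (:0 :- :√2 :* b) ⊙ hyp 0 ⊕ (:√2 :* d) ⊙ hyp 1 ⊕ (:0 :- a) ⊙ hyp 2 ⊕ :√2 ⊙ hyp 3
         ⊕ :1 ⊙ hyp 4)
  merge-K′ = prove 7 (λ A g e f a b d →
      f :≈ :- :1 ⊃ e :≈ :1 ⊃ d :≈ b :- :√2 :* a ⊃ A :- :1 :≈ :0 ⊃ g :≈ :- :1 ⊃
      ⊢ f :* d :≈ e :* b :- :1 :* :√2 :* (A :* :√2 :* b :+ g :* a)
      by d ⊙ hyp 0 ⊕ (:0 :- b) ⊙ hyp 1 ⊕ (:0 :- :1) ⊙ hyp 2 ⊕ (# 2 :* b) ⊙ hyp 3
         ⊕ (:√2 :* a) ⊙ hyp 4)
  stay-θ<1-√2 = prove 2 (λ A x →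
      x :< :1 :+ :√2 ⊃ A :- :1 :- :1 :≈ :0 ⊃ ⊢ x :- A :* :√2 :< :1 :- :√2
      by ¬goal ⊕ hyp 0 ⊕ (:0 :- :√2) ⊙ hyp 1)
  stay-tail = prove 5 (λ A e x y w →
      A :- :1 :- :1 :≈ :0 ⊃ e :≈ :- :1 ⊃ w :* (e :* (x :- A :* :√2)) :≈ :1 ⊃
      y :* (x :- :√2) :≈ :√2 :* x :- :1 ⊃ ⊢ (y :- :1 :* :√2) :* (:√2 :* w :- :1) :≈ w
      by (# 2 :* w :- :√2 :* w :* y) ⊙ hyp 0
         ⊕ (:0 :- # 2 :* A :* w :+ :√2 :* w :* x :+ :√2 :* A :* w :* y :- w :* x :* y) ⊙ hyp 1
         ⊕ (:0 :- :√2 :+ y) ⊙ hyp 2 ⊕ w ⊙ hyp 3)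
  stay-K = prove 9 (λ A B k e f a b c d →
      A :- :1 :- :1 :≈ :0 ⊃ B :- :1 :- k :≈ :0 ⊃ e :≈ :- :1 ⊃ d :≈ b :- :√2 :* a ⊃
      f :* c :≈ a :- k :* :√2 :* d ⊃
      ⊢ B :* :√2 :* d :+ f :* c :≈ A :* :√2 :* b :+ e :* a :- :√2 :* b
      by (:0 :- :√2 :* b) ⊙ hyp 0 ⊕ (:√2 :* d) ⊙ hyp 1 ⊕ (:0 :- a) ⊙ hyp 2 ⊕ :√2 ⊙ hyp 3
         ⊕ :1 ⊙ hyp 4)
  stay-K′ = prove 7 (λ A g f a b d N →
      f :≈ :- :1 ⊃ d :≈ b :- :√2 :* a ⊃ A :- :1 :- :1 :≈ :0 ⊃ g :≈ :- :1 ⊃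
      N :≈ A :* :√2 :* b :+ g :* a :- :√2 :* b ⊃ ⊢ f :* d :≈ b :- :1 :* :√2 :* N
      by d ⊙ hyp 0 ⊕ (:0 :- :1) ⊙ hyp 1 ⊕ (# 2 :* b) ⊙ hyp 2 ⊕ (:√2 :* a) ⊙ hyp 3 ⊕ :√2 ⊙ hyp 4)

  module _ {α} (R : RosenExpansion α) (D : DualRosenExpansion α) where
    private
      module R = Expansion R
      module D = Expansion D
      module ℛ = Rosen R
      module 𝒟 = Dual D
      x z A B : ℕ → Carrier
      x = R.x
      z = D.x
      A n = fromℤ (R.a n)
      B n = fromℤ (D.a n)
      f : ℕ → Carrier
      f = e D
      V W : Carrier → Carrier → ℕ → Carrier
      V = K R.a R.ε
      W = K D.a D.ε

    -- After n steps either both algorithms have reached the same convergent Vₙ₊₁ = Wₙ₊₁, or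
    -- the dual one has reached Vₙ₊₁ - √2 Vₙ, which the Rosen algorithm jumps over.
    data State (n : ℕ) : Set (c Level.⊔ ℓ) where
      -- The equations express that zₙ Wₙ₊₁ + fₙ Wₙ and xₙ Vₙ₊₁ + eₙ Vₙ are the same vector; the
      -- offset κ, which is only ever 0 or 1, moves between the complete quotient and the earlier
      -- vector. The last component excludes the condition under which a vector is skipped.
      same  : ∀ κ → IsInt κ → z n ≈ x n + κ * √2 →
              (∀ v₀ v₁ → W v₀ v₁ (suc n) ≈ V v₀ v₁ (suc n)) →
              (∀ v₀ v₁ → f n * W v₀ v₁ n ≈ e R n * V v₀ v₁ n - κ * √2 * V v₀ v₁ (suc n)) →
              e R n ≈ 1# ⊎ 1# + √2 ≤ x n → State n
      -- Put w = zₙ - κ√2. The dual combination is now w (Vₙ₊₁ - √2 Vₙ) + Vₙ, and it is proportional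
      -- to xₙ Vₙ₊₁ - Vₙ exactly when w (√2 xₙ - 1) = xₙ.
      split : ∀ κ → IsInt κ → e R n ≈ - 1# → √2 < x n → x n < 1# + √2 →
              (z n - κ * √2) * (√2 * x n - 1#) ≈ x n →
              (∀ v₀ v₁ → W v₀ v₁ (suc n) ≈ V v₀ v₁ (suc n) - √2 * V v₀ v₁ n) →
              (∀ v₀ v₁ → f n * W v₀ v₁ n ≈ V v₀ v₁ n - κ * √2 * W v₀ v₁ (suc n)) → State n

    initial : State 0
    initial = same 0# int-0 (start-tail _ _ _ R.start D.start) (λ _ _ → refl)
                (λ v₀ v₁ → start-K v₀ v₁) (inj₁ refl)

    private
      module _ (n : ℕ) where
        e± = fromSign-cases (R.ε (suc n))
        f± = fromSign-cases (D.ε (suc n))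

        same-next : ∀ κ → z n ≈ x n + κ * √2 →
                    (∀ v₀ v₁ → W v₀ v₁ (suc n) ≈ V v₀ v₁ (suc n)) →
                    (∀ v₀ v₁ → f n * W v₀ v₁ n ≈ e R n * V v₀ v₁ n - κ * √2 * V v₀ v₁ (suc n)) →
                    B n - A n - κ ≈ 0# → State (suc n)
        same-next κ z≈ W≈ fW≈ δ≈0 =
          same 0# int-0 (same-tail _ _ _ _ _ _ f≈e θ≈ (tail-unit R n) (tail-unit D n))
            (λ v₀ v₁ → same-K _ _ _ _ _ _ _ _ _ δ≈0 (W≈ v₀ v₁) (fW≈ v₀ v₁))
            (λ v₀ v₁ → same-K′ _ _ _ _ _ f≈e (W≈ v₀ v₁)) (far e±)
          where
          θ≈ = same-θ _ _ _ _ _ z≈ δ≈0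
          f≈e = sign-unique e± f± (0<eθ R n) (0<eθ D n) θ≈
          far : e R (suc n) ≈ 1# ⊎ e R (suc n) ≈ - 1# → e R (suc n) ≈ 1# ⊎ 1# + √2 ≤ x (suc n)
          far (inj₁ e≈1)  = inj₁ e≈1
          far (inj₂ e≈-1) = inj₂ (same-x≥ _ _ _ e≈-1
            (same-θ≥ _ _ _ _ _ z≈ δ≈0 (proj₁ (D.digit n))) (0<eθ R n) (tail-unit R n))

        -- The Rosen remainder is below 1 - √2 and the dual one is larger by √2, so the first is
        -- negative and the second positive. The bound on the next complete quotient is 1 / (√2 - 1)
        -- = 1 + √2.
        split-next : ∀ κ → z n ≈ x n + κ * √2 →
                     (∀ v₀ v₁ → W v₀ v₁ (suc n) ≈ V v₀ v₁ (suc n)) →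
                     (∀ v₀ v₁ → f n * W v₀ v₁ n ≈ e R n * V v₀ v₁ n - κ * √2 * V v₀ v₁ (suc n)) →
                     B n - A n - κ ≈ - 1# → State (suc n)
        split-next κ z≈ W≈ fW≈ δ≈-1 =
          split 0# int-0 e≈-1 (ℛ.√2<x n) (split-x<1+√2 _ _ _ e≈-1 θ<1-√2 (0<eθ R n) (tail-unit R n))
            (split-z _ _ _ _ _ _ e≈-1 f≈1 θ̃≈ (tail-unit R n) (tail-unit D n))
            (λ v₀ v₁ → split-K _ _ _ _ _ _ _ _ _ δ≈-1 (W≈ v₀ v₁) (fW≈ v₀ v₁))
            (λ v₀ v₁ → split-K′ _ _ _ _ f≈1 (W≈ v₀ v₁))
          where
          θ<1-√2 = split-θ<1-√2 _ _ _ _ _ z≈ δ≈-1 (proj₂ (D.digit n))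
          θ̃≈ = split-dual-θ _ _ _ _ _ z≈ δ≈-1
          e≈-1 = sign-neg e± (0<eθ R n) (θ<0 _ θ<1-√2)
          f≈1 = sign-pos f± (0<eθ D n) (split-0<dual-θ _ _ θ̃≈ (ℛ.-√2<2θ n))

        module _ κ (e≈-1 : e R n ≈ - 1#) (√2<x : √2 < x n) (x<1+√2 : x n < 1# + √2)
                 (z≈ : (z n - κ * √2) * (√2 * x n - 1#) ≈ x n)
                 (W≈ : ∀ v₀ v₁ → W v₀ v₁ (suc n) ≈ V v₀ v₁ (suc n) - √2 * V v₀ v₁ n)
                 (fW≈ : ∀ v₀ v₁ → f n * W v₀ v₁ n ≈ V v₀ v₁ n - κ * √2 * W v₀ v₁ (suc n))
                 (δ≈0 : B n - 1# - κ ≈ 0#) where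

          -- The dual remainder is x / (√2 x - 1) - √2 with x = xₙ, negative because x > √2.
          f≈-1 : f (suc n) ≈ - 1#
          f≈-1 = sign-neg f± (0<eθ D n) (split-dual-θ<0 _ _ _ _ z≈ √2<x δ≈0)

          -- The dual remainder simplifies to -(x - √2) / (√2 x - 1), and the next dual quotient is
          -- the reciprocal of its absolute value.
          z′≈ : z (suc n) * (x n - √2) ≈ √2 * x n - 1#
          z′≈ = split-dual-tail _ _ _ _ _ _ z≈ δ≈0 f≈-1 (tail-unit D n)

          -- With Rosen digit 1 the next Rosen quotient is 1 / (x - √2), and (√2 x - 1) / (x - √2)
          -- exceeds it by exactly √2. This is the origin of κ = 1.
          merge : A n - 1# ≈ 0# → State (suc n)
          merge A≈1 =
            same 1# int-1 (merge-tail _ _ _ _ _ A≈1 e′≈1 (tail-unit R n) z′≈)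
              (λ v₀ v₁ → merge-K _ _ _ _ _ _ _ _ _ A≈1 δ≈0 e≈-1 (W≈ v₀ v₁) (fW≈ v₀ v₁))
              (λ v₀ v₁ → merge-K′ _ _ _ _ _ _ _ f≈-1 e′≈1 (W≈ v₀ v₁) A≈1 e≈-1) (inj₁ e′≈1)
            where
            e′≈1 = sign-pos e± (0<eθ R n) (merge-0<θ _ _ √2<x A≈1)

          -- With Rosen digit 2 the next quotient is 1 / (2√2 - x), again below the fixed point 1 +
          -- √2, so the dual algorithm remains on a skipped vector.
          stay : A n - 1# - 1# ≈ 0# → State (suc n)
          stay A≈2 =
            split 1# int-1 e′≈-1 (ℛ.√2<x n)
              (split-x<1+√2 _ _ _ e′≈-1 (stay-θ<1-√2 _ _ x<1+√2 A≈2) (0<eθ R n) (tail-unit R n))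
              (stay-tail _ _ _ _ _ A≈2 e′≈-1 (tail-unit R n) z′≈)
              W′≈
              (λ v₀ v₁ → stay-K′ _ _ _ _ _ _ _ f≈-1 (W≈ v₀ v₁) A≈2 e≈-1 (W′≈ v₀ v₁))
            where
            e′≈-1 = sign-neg e± (0<eθ R n) (stay-θ<0 _ _ x<1+√2 A≈2)
            W′≈ = λ v₀ v₁ → stay-K _ _ _ _ _ _ _ _ _ A≈2 δ≈0 e≈-1 (W≈ v₀ v₁) (fW≈ v₀ v₁)

    -- In state `same` the two remainder intervals allow the digits, corrected by κ, to differ only
    -- by 0 or 1. In state `split`, w = zₙ - κ√2 lies strictly between 1 and √2, which fixes the
    -- dual digit as 1 + κ, while √2 < xₙ < 1 + √2 leaves the Rosen digits 1 and 2.
    next : ∀ n → State n → State (suc n)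
    next n (same κ κ∈ z≈ W≈ fW≈ _) with int-trichotomy δ∈
      where δ∈ : IsInt (B n - A n - κ)
            δ∈ = int-+ (int-+ (int-fromℤ (D.a n)) (int-neg (int-fromℤ (R.a n)))) (int-neg κ∈)
    ... | inj₁ 1≤δ        = ⊥-elim (lower (same-δ≥1-⊥ _ _ _ _ _ z≈ (proj₁ (D.digit n)) (ℛ.2θ<√2 n) 1≤δ))
    ... | inj₂ (inj₁ δ≈0) = same-next n κ z≈ W≈ fW≈ δ≈0
    ... | inj₂ (inj₂ δ≤-1) with int-trichotomy δ+1∈
      where δ+1∈ : IsInt (B n - A n - κ + 1#)
            δ+1∈ = int-+ (int-+ (int-+ (int-fromℤ (D.a n)) (int-neg (int-fromℤ (R.a n)))) (int-neg κ∈)) int-1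
    ...   | inj₁ 1≤δ+1         = ⊥-elim (lower (δ≤-1-0<δ-⊥ _ _ _ δ≤-1 1≤δ+1))
    ...   | inj₂ (inj₁ δ+1≈0)  = split-next n κ z≈ W≈ fW≈ (δ+1≈0⇒δ≈-1 _ _ _ δ+1≈0)
    ...   | inj₂ (inj₂ δ+1≤-1) =
      ⊥-elim (lower (same-δ≤-2-⊥ _ _ _ _ _ z≈ (proj₂ (D.digit n)) (ℛ.-√2<2θ n) δ+1≤-1))
    next n (split κ κ∈ e≈-1 √2<x x<1+√2 z≈ W≈ fW≈) with int-trichotomy δ∈
      where δ∈ : IsInt (B n - 1# - κ)
            δ∈ = int-+ (int-+ (int-fromℤ (D.a n)) (int-neg int-1)) (int-neg κ∈)
    ... | inj₁ 1≤δ =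
      ⊥-elim (lower (split-δ≥1-⊥ _ _ _ _ z≈ √2<x (proj₁ (D.digit n)) 1≤δ))
    ... | inj₂ (inj₂ δ≤-1) =
      ⊥-elim (lower (split-δ≤-1-⊥ _ _ _ _ z≈ √2<x x<1+√2 (proj₂ (D.digit n)) δ≤-1))
    ... | inj₂ (inj₁ δ≈0) with int-trichotomy A-1∈
      where A-1∈ : IsInt (A n - 1#)
            A-1∈ = int-+ (int-fromℤ (R.a n)) (int-neg int-1)
    ...   | inj₂ (inj₁ A≈1)  = merge n κ e≈-1 √2<x x<1+√2 z≈ W≈ fW≈ δ≈0 A≈1
    ...   | inj₂ (inj₂ A≤0)  = ⊥-elim (lower (split-A≤0-⊥ _ _ √2<x (ℛ.2θ<√2 n) A≤0))
    ...   | inj₁ 2≤A with int-trichotomy A-2∈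
      where A-2∈ : IsInt (A n - 1# - 1#)
            A-2∈ = int-+ (int-+ (int-fromℤ (R.a n)) (int-neg int-1)) (int-neg int-1)
    ...     | inj₂ (inj₁ A≈2) = stay n κ e≈-1 √2<x x<1+√2 z≈ W≈ fW≈ δ≈0 A≈2
    ...     | inj₁ 3≤A        = ⊥-elim (lower (split-A≥3-⊥ _ _ x<1+√2 (ℛ.-√2<2θ n) 3≤A))
    ...     | inj₂ (inj₂ A≤1) = ⊥-elim (lower (2≤A-A≤1-⊥ _ 2≤A A≤1))

    state : ∀ n → State n
    state zero    = initial
    state (suc n) = next n (state n)

-- Best approximations and convergents.

module BestApproximation {c ℓ} (ℝ : CompleteOrderedField c ℓ)
  (√2 : CompleteOrderedField.Carrier ℝ)
  (0<√2 : CompleteOrderedField._<_ ℝ (CompleteOrderedField.0# ℝ) √2)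
  (√2*√2≈2 : CompleteOrderedField._≈_ ℝ (CompleteOrderedField._*_ ℝ √2 √2)
     (CompleteOrderedField._+_ ℝ (CompleteOrderedField.1# ℝ) (CompleteOrderedField.1# ℝ)))
  where
  open Synchronisation ℝ √2 0<√2 √2*√2≈2 public

  same-ratio = prove 6 (λ p q a b i j →
      q :* i :≈ :1 ⊃ b :* j :≈ :1 ⊃ a :* q :≈ p :* b ⊃ ⊢ a :* j :≈ p :* i
      by (:0 :- a :* j) ⊙ hyp 0 ⊕ (i :* p) ⊙ hyp 1 ⊕ (i :* j) ⊙ hyp 2)
  cross-multiply = prove 6 (λ p q i v s w →
      p :* i :≈ v ⊃ q :* i :≈ :1 ⊃ v :* s :≈ w ⊃ ⊢ p :* s :≈ w :* q
      by (q :* s) ⊙ hyp 0 ⊕ (:0 :- p :* s) ⊙ hyp 1 ⊕ q ⊙ hyp 2)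
  cross⇒≤ = prove 6 (λ p q i v s w →
      q :* i :≈ :1 ⊃ v :* s :≈ w ⊃ p :* s :≈ w :* q ⊃ :0 :< s ⊃ ⊢ p :* i :≤ v
      by ¬goal ⊗ hyp 3 ⊕ w ⊙ hyp 0 ⊕ (:0 :- :1) ⊙ hyp 1 ⊕ i ⊙ hyp 2)
  cross⇒≥ = prove 6 (λ p q i v s w →
      q :* i :≈ :1 ⊃ v :* s :≈ w ⊃ p :* s :≈ w :* q ⊃ :0 :< s ⊃ ⊢ v :≤ p :* i
      by ¬goal ⊗ hyp 3 ⊕ (:0 :- w) ⊙ hyp 0 ⊕ :1 ⊙ hyp 1 ⊕ (:0 :- i) ⊙ hyp 2)

  q*q⁻¹≈1 : ∀ {q} → 0# < q → q * q ⁻¹ ≈ 1#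
  q*q⁻¹≈1 0<q = ⁻¹-inverseʳ (0<x⇒x≉0 0<q)

  cross⇒≈ : ∀ {p q p′ q′} → 0# < q → 0# < q′ → p′ * q ≈ p * q′ → p′ / q′ ≈ p / q
  cross⇒≈ 0<q 0<q′ = same-ratio _ _ _ _ _ _ (q*q⁻¹≈1 0<q) (q*q⁻¹≈1 0<q′)

  ≈⇒cross : ∀ {p q v r s} → 0# < q → v * s ≈ r → p / q ≈ v → p * s ≈ r * q
  ≈⇒cross 0<q v*s≈r p/q≈v = cross-multiply _ _ _ _ _ _ p/q≈v (q*q⁻¹≈1 0<q) v*s≈r

  cross⇒value : ∀ {p q v r s} → 0# < q → 0# < s → v * s ≈ r → p * s ≈ r * q → p / q ≈ v
  cross⇒value 0<q 0<s v*s≈r ps≈rq =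
    ≤-antisym (cross⇒≤ _ _ _ _ _ _ (q*q⁻¹≈1 0<q) v*s≈r ps≈rq 0<s)
              (cross⇒≥ _ _ _ _ _ _ (q*q⁻¹≈1 0<q) v*s≈r ps≈rq 0<s)

  odd-nonneg-bounded = prove 3 (λ q y n →
      q :≈ :1 :+ # 2 :* y ⊃ y :≈ n ⊃ ⊢ q :< :1 :+ (:1 :+ (n :+ n))
      by one ⊕ ¬goal ⊕ :1 ⊙ hyp 0 ⊕ (# 2) ⊙ hyp 1)
  rad-nonneg-bounded = prove 3 (λ q y n →
      q :≈ :√2 :* y ⊃ y :≈ n ⊃ :0 :≤ n ⊃ ⊢ q :< :1 :+ (:1 :+ (n :+ n))
      by 2 ×ᶜ one ⊕ ¬goal ⊕ (gap ⊕ gap ^ᶜ 2) ⊗ hyp 2 ⊕ :1 ⊙ hyp 0 ⊕ :√2 ⊙ hyp 1)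
  odd-neg-bounded = prove 3 (λ q y n →
      q :≈ :1 :+ # 2 :* y ⊃ y :≈ :- (:1 :+ n) ⊃ :0 :≤ n ⊃ ⊢ q :< :1 :+ :0
      by 2 ×ᶜ one ⊕ ¬goal ⊕ 2 ×ᶜ hyp 2 ⊕ :1 ⊙ hyp 0 ⊕ (# 2) ⊙ hyp 1)
  rad-neg-bounded = prove 3 (λ q y n →
      q :≈ :√2 :* y ⊃ y :≈ :- (:1 :+ n) ⊃ :0 :≤ n ⊃ ⊢ q :< :1 :+ :0
      by one ⊕ gap ⊗ ¬goal ⊕ (gap ⊕ gap ^ᶜ 2) ⊗ hyp 2 ⊕ (:0 :- :1 :+ :√2) ⊙ hyp 0
         ⊕ (# 2 :- :√2) ⊙ hyp 1)
  <-double = prove 3 (λ q n m →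
      m :≈ n :+ n ⊃ q :< :1 :+ (:1 :+ (n :+ n)) ⊃ ⊢ q :< :1 :+ (:1 :+ m)
      by ¬goal ⊕ hyp 1 ⊕ (:0 :- :1) ⊙ hyp 0)

  -- Needed to place a given denominator among the Rosen denominators. It is 1 + 2n or √2 n for an
  -- explicit integer n; both are below 2 + 2n when n ≥ 0 and below 1 when n < 0.
  mixed-bounded : ∀ {x y} → Mixed x y → ∃ λ k → y < 1# + fromℤ (+ k)
  mixed-bounded (inj₂ (_ , y , (+ n , y≈n) , q≈)) =
    suc (n ℕ.+ n) , <-double _ _ _ (×-homo-+ 1# n n) (odd-nonneg-bounded _ _ _ q≈ y≈n)
  mixed-bounded (inj₂ (_ , y , (-[1+ n ] , y≈n) , q≈)) = 0 , odd-neg-bounded _ _ _ q≈ y≈n (0≤fromℕ n)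
  mixed-bounded (inj₁ (_ , y , (+ n , y≈n) , q≈)) =
    suc (n ℕ.+ n) , <-double _ _ _ (×-homo-+ 1# n n) (rad-nonneg-bounded _ _ _ q≈ y≈n (0≤fromℕ n))
  mixed-bounded (inj₁ (_ , y , (-[1+ n ] , y≈n) , q≈)) = 0 , rad-neg-bounded _ _ _ q≈ y≈n (0≤fromℕ n)

  crossing : ∀ (f : ℕ → Carrier) q m → f 0 ≤ q → q < f m → ∃ λ n → f n ≤ q × q < f (suc n)
  crossing f q zero    f0≤q q<f0 = ⊥-elim (lower (prove 2 (λ a b → a :≤ b ⊃ b :< a ⊃ ⊢ :⊥
                                     by hyp 0 ⊕ hyp 1) _ _ f0≤q q<f0))
  crossing f q (suc m) f0≤q q<f with compare q (f m)
  ... | tri< q<fm _ _ = crossing f q m f0≤q q<fm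
  ... | tri≈ _ q≈fm _ = m , inj₂ (sym q≈fm) , q<f
  ... | tri> _ _ fm<q = m , inj₁ fm<q , q<f

  quotient*S≈P = prove 3 (λ P S i →
      S :* i :≈ :1 ⊃ ⊢ P :* i :* S :≈ P
      by P ⊙ hyp 0)
  0≤quotient = prove 2 (λ P i →
      :0 :≤ P ⊃ :0 :< i ⊃ ⊢ :0 :≤ P :* i
      by ¬goal ⊕ hyp 0 ⊗ hyp 1)
  0<quotient = prove 2 (λ P i →
      :0 :< P ⊃ :0 :< i ⊃ ⊢ :0 :< P :* i
      by ¬goal ⊕ hyp 0 ⊗ hyp 1)
  y<√2-1 = prove 3 (λ P S y →
      y :* S :≈ P ⊃ :0 :< S ⊃ P :< (:√2 :- :1) :* S ⊃ ⊢ y :< :√2 :- :1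
      by hyp 2 ⊕ ¬goal ⊗ hyp 1 ⊕ :1 ⊙ hyp 0)
  N≤1 = prove 7 (λ P S y t u b q →
      b :≈ t :* P :+ u :* S ⊃ y :* S :≈ P ⊃ b :≤ q ⊃ q :≈ S ⊃ :0 :< S ⊃ ⊢ u :+ t :* y :≤ :1
      by hyp 2 ⊕ ¬goal ⊗ hyp 4 ⊕ (:0 :- :1) ⊙ hyp 0 ⊕ t ⊙ hyp 1 ⊕ :1 ⊙ hyp 3)
  0<N = prove 6 (λ P S y t u b →
      b :≈ t :* P :+ u :* S ⊃ y :* S :≈ P ⊃ :0 :< b ⊃ :0 :< S ⊃ ⊢ :0 :< u :+ t :* y
      by hyp 2 ⊕ ¬goal ⊗ hyp 3 ⊕ :1 ⊙ hyp 0 ⊕ (:0 :- t) ⊙ hyp 1)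
  -1≤N = prove 1 (λ n →
      :0 :< n ⊃ ⊢ :- :1 :≤ n
      by one ⊕ ¬goal ⊕ hyp 0)
  N≤1-√2y = prove 7 (λ P S y t u b q →
      b :≈ t :* P :+ u :* S ⊃ y :* S :≈ P ⊃ b :≤ q ⊃ q :≈ S :- :√2 :* P ⊃ :0 :< S ⊃
      ⊢ u :+ t :* y :≤ :1 :- :√2 :* y
      by hyp 2 ⊕ ¬goal ⊗ hyp 4 ⊕ (:0 :- :1) ⊙ hyp 0 ⊕ (:√2 :+ t) ⊙ hyp 1 ⊕ :1 ⊙ hyp 3)
  y≤N = prove 6 (λ P S y t u b →
      b :≈ t :* P :+ u :* S ⊃ y :* S :≈ P ⊃ P :≤ b ⊃ :0 :< S ⊃ ⊢ y :≤ u :+ t :* y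
      by hyp 2 ⊕ ¬goal ⊗ hyp 3 ⊕ :1 ⊙ hyp 0 ⊕ (:1 :- t) ⊙ hyp 1)
  N<1 = prove 6 (λ P S y t u b →
      b :≈ t :* P :+ u :* S ⊃ y :* S :≈ P ⊃ b :< S ⊃ :0 :< S ⊃ ⊢ u :+ t :* y :< :1
      by hyp 2 ⊕ ¬goal ⊗ hyp 3 ⊕ (:0 :- :1) ⊙ hyp 0 ⊕ t ⊙ hyp 1)
  error-coordinates = prove 11 (λ a b t u P S E H α e x →
      a :≈ t :* E :+ u :* H ⊃ b :≈ t :* P :+ u :* S ⊃
      P :* α :- E :≈ :- (e :* x :* (S :* α :- H)) ⊃
      ⊢ b :* α :- a :≈ (u :- e :* t :* x) :* (S :* α :- H)
      by (:0 :- :1) ⊙ hyp 0 ⊕ α ⊙ hyp 1 ⊕ t ⊙ hyp 2)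
  error-same = prove 5 (λ a b S H α →
      a :≈ H ⊃ b :≈ S ⊃
      ⊢ (b :* α :- a) :* (b :* α :- a) :≈ :1 :* (S :* α :- H) :* (:1 :* (S :* α :- H))
      by (H :+ a :- # 2 :* S :* α) ⊙ hyp 0
         ⊕ (:0 :- # 2 :* a :* α :+ S :* α :* α :+ b :* α :* α) ⊙ hyp 1)
  error-skipped = prove 9 (λ a b P S E H α e x →
      a :≈ H :- :√2 :* E ⊃ b :≈ S :- :√2 :* P ⊃ e :≈ :- :1 ⊃
      P :* α :- E :≈ :- (e :* x :* (S :* α :- H)) ⊃
      ⊢ b :* α :- a :≈ (:1 :- :√2 :* x) :* (S :* α :- H)
      by (:0 :- :1) ⊙ hyp 0 ⊕ α ⊙ hyp 1 ⊕ (:0 :- :√2 :* H :* x :+ :√2 :* S :* x :* α) ⊙ hyp 2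
         ⊕ (:0 :- :√2) ⊙ hyp 3)
  square-skipped = prove 3 (λ a D x →
      a :≈ (:1 :- :√2 :* x) :* D ⊃ ⊢ a :* a :≈ (:√2 :* x :- :1) :* D :* ((:√2 :* x :- :1) :* D)
      by (D :+ a :- :√2 :* D :* x) ⊙ hyp 0)
  square-previous = prove 4 (λ a D e x →
      a :≈ :- (e :* x :* D) ⊃ e :* e :≈ :1 ⊃ ⊢ a :* a :≈ x :* D :* (x :* D)
      by (a :- D :* e :* x) ⊙ hyp 0 ⊕ (D :* D :* x :* x) ⊙ hyp 1)
  0≤√2x-1 = prove 1 (λ x →
      :√2 :< x ⊃ ⊢ :0 :≤ :√2 :* x :- :1
      by gap ⊕ gap ^ᶜ 2 ⊕ (gap ⊕ gap ^ᶜ 2) ⊗ ¬goal ⊕ 2 ×ᶜ gap ⊗ hyp 0)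
  L-subst≥ = prove 5 (λ e t u x m →
      e :≈ :- :1 ⊃ :- m :≤ u :- e :* t :* x ⊃ ⊢ :- m :≤ u :+ t :* x
      by ¬goal ⊕ hyp 1 ⊕ (:0 :- t :* x) ⊙ hyp 0)
  L-subst≤ = prove 5 (λ e t u x m →
      e :≈ :- :1 ⊃ u :- e :* t :* x :≤ m ⊃ ⊢ u :+ t :* x :≤ m
      by ¬goal ⊕ hyp 1 ⊕ (t :* x) ⊙ hyp 0)
  t≈0-cross = prove 10 (λ a b t u P S E H p q →
      a :≈ t :* E :+ u :* H ⊃ b :≈ t :* P :+ u :* S ⊃ t :≈ :0 ⊃ p :≈ H ⊃ q :≈ S ⊃
      ⊢ a :* q :≈ p :* b
      by S ⊙ hyp 0 ⊕ (:0 :- H) ⊙ hyp 1 ⊕ (E :* S :- H :* P) ⊙ hyp 2 ⊕ (:0 :- b) ⊙ hyp 3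
         ⊕ a ⊙ hyp 4)
  skipped-cross = prove 10 (λ a b t u P S E H p q →
      a :≈ t :* E :+ u :* H ⊃ b :≈ t :* P :+ u :* S ⊃ t :≈ :- :√2 ⊃ u :≈ :1 ⊃ p :≈ H :- :√2 :* E ⊃
      q :≈ S :- :√2 :* P ⊃ ⊢ a :* q :≈ p :* b
      by q ⊙ hyp 0 ⊕ (:0 :- p) ⊙ hyp 1 ⊕ (E :* q :- P :* p) ⊙ hyp 2 ⊕ (H :* q :- S :* p) ⊙ hyp 3
         ⊕ (:0 :- q) ⊙ hyp 4 ⊕ p ⊙ hyp 5)
  e≈1-e≈-1-⊥ = prove 1 (λ e →
      e :≈ :1 ⊃ e :≈ :- :1 ⊃ ⊢ :⊥
      by 2 ×ᶜ one ⊕ (:0 :- :1) ⊙ hyp 0 ⊕ :1 ⊙ hyp 1)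
  1+√2≤x-x<1+√2-⊥ = prove 1 (λ x →
      :1 :+ :√2 :≤ x ⊃ x :< :1 :+ :√2 ⊃ ⊢ :⊥
      by hyp 0 ⊕ hyp 1)
  coordinates-dual = prove 6 (λ a t u E H W →
      a :≈ t :* E :+ u :* H ⊃ t :≈ :- :√2 ⊃ u :≈ :1 ⊃ W :≈ H :- :√2 :* E ⊃ ⊢ a :≈ W
      by :1 ⊙ hyp 0 ⊕ E ⊙ hyp 1 ⊕ H ⊙ hyp 2 ⊕ (:0 :- :1) ⊙ hyp 3)
  cross-≈ = prove 4 (λ p q H S →
      p :≈ H ⊃ q :≈ S ⊃ ⊢ p :* S :≈ H :* q
      by S ⊙ hyp 0 ⊕ (:0 :- H) ⊙ hyp 1)
  ≈-≤ = prove 3 (λ a b c →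
      a :≈ c ⊃ a :≤ b ⊃ ⊢ c :≤ b
      by ¬goal ⊕ hyp 1 ⊕ (:0 :- :1) ⊙ hyp 0)
  <-≤-trans = prove 3 (λ a b c →
      a :< b ⊃ b :≤ c ⊃ ⊢ a :< c
      by ¬goal ⊕ hyp 0 ⊕ hyp 1)
  p*i*q≈p = prove 3 (λ p q i →
      q :* i :≈ :1 ⊃ ⊢ p :* i :* q :≈ p
      by p ⊙ hyp 0)

  module _ {α} (R : RosenExpansion α) (D : DualRosenExpansion α) where
    private
      module R = Expansion R
      module D = Expansion D
      module ℛ = Rosen R
      module 𝒟 = Dual D
      r s : ℕ → Carrier
      r = num R
      s = den R
      x : ℕ → Carrier
      x = R.x
      y : ℕ → Carrier
      y n = s n * s (suc n) ⁻¹
      L : ℕ → Carrier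
      L = error R

      y*s≈s : ∀ n → y (suc n) * s (2 ℕ.+ n) ≈ s (suc n)
      y*s≈s n = quotient*S≈P _ _ _ (q*q⁻¹≈1 (ℛ.0<s n))

      sign-bound : ∀ n → SignBound (e R (suc n)) (y (suc n))
      sign-bound n with ℛ.ratio n
      ... | inj₁ e≈1         = inj₁ e≈1
      ... | inj₂ (e≈-1 , s<) = inj₂ (e≈-1 , y<√2-1 _ _ _ (y*s≈s n) (ℛ.0<s n) s<)

      R-normalised : ∀ n → IsNormalised (r (2 ℕ.+ n)) (s (2 ℕ.+ n))
      R-normalised n = ℛ.0<s n , _ , _ , proj₂ (H₄-continuants R.a R.ε (suc n))

      R-value : ∀ i → R.convergents i * s (2 ℕ.+ i) ≈ r (2 ℕ.+ i)
      R-value = convergent-value Rosen.0<s R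

      D-value : ∀ i → D.convergents i * den D (2 ℕ.+ i) ≈ num D (2 ℕ.+ i)
      D-value = convergent-value Dual.0<s D

    private
      -- Reduces a strict comparison of errors to the claim that a competitor at least as near must
      -- be the same fraction, a claim about lattice points.
      beats : ∀ {p q p′ q′} → 0# < q → 0# < q′ → ¬ (p′ / q′ ≈ p / q) →
              (∣ q′ * α - p′ ∣ ≤ ∣ q * α - p ∣ → p′ * q ≈ p * q′) →
              ∣ q * α - p ∣ < ∣ q′ * α - p′ ∣
      beats {p} {q} {p′} {q′} 0<q 0<q′ p′/q′≉p/q tie with compare ∣ q * α - p ∣ ∣ q′ * α - p′ ∣
      ... | tri< nearer _ _ = nearer
      ... | tri≈ _ b≈a _    = ⊥-elim (p′/q′≉p/q (cross⇒≈ 0<q 0<q′ (tie (inj₂ (sym b≈a)))))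
      ... | tri> _ _ a<b    = ⊥-elim (p′/q′≉p/q (cross⇒≈ 0<q 0<q′ (tie (inj₁ a<b))))

    -- Stated for any pair equal to the convergent, so that it also covers a dual convergent in
    -- state `same`.
    rosen-best : ∀ n {p q} → 0# < q → p ≈ r (2 ℕ.+ n) → q ≈ s (2 ℕ.+ n) →
                 IsBestApproximation α p q
    rosen-best n {p} {q} 0<q p≈ q≈ p′ q′ (0<q′ , _ , _ , H) p′/q′≉p/q q′≤q =
      beats 0<q 0<q′ p′/q′≉p/q tie
      where
      tie : ∣ q′ * α - p′ ∣ ≤ ∣ q * α - p ∣ → p′ * q ≈ p * q′
      tie a≤b with continuant-coordinates R.a R.ε (suc n) H
      ... | t , u , tu , p′≈ , q′≈ = t≈0-cross _ _ _ _ _ _ _ _ _ _ p′≈ q′≈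
        (rosen-local (ℛ.√2<x n) (0≤quotient _ _ (ℛ.0≤s n) (0<x⇒0<x⁻¹ (ℛ.0<s n))) (sign-bound n) tu
          (-1≤N _ (0<N _ _ _ _ _ _ q′≈ (y*s≈s n) 0<q′ (ℛ.0<s n)))
          (N≤1 _ _ _ _ _ _ _ q′≈ (y*s≈s n) q′≤q q≈ (ℛ.0<s n)) (proj₁ bounds) (proj₂ bounds))
        p≈ q≈
        where
        bounds = ∣ℓD∣≤∣mD∣⇒ (error≉0 R (suc n))
          (error-coordinates _ _ _ _ _ _ _ _ _ _ _ p′≈ q′≈ (error-recursion R (suc n)))
          (error-same _ _ _ _ _ p≈ q≈) (inj₁ 0<1) a≤b

    skipped-best : ∀ n {p q} → 0# < q → e R (2 ℕ.+ n) ≈ - 1# →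
                   √2 < x (2 ℕ.+ n) → x (2 ℕ.+ n) < 1# + √2 →
                   p ≈ r (3 ℕ.+ n) - √2 * r (2 ℕ.+ n) → q ≈ s (3 ℕ.+ n) - √2 * s (2 ℕ.+ n) →
                   IsBestApproximation α p q
    skipped-best n {p} {q} 0<q e≈-1 √2<x x<1+√2 p≈ q≈ p′ q′ (0<q′ , _ , _ , H) p′/q′≉p/q q′≤q =
      beats 0<q 0<q′ p′/q′≉p/q tie
      where
      y<√2-1′ : SignBound (e R (2 ℕ.+ n)) (y (2 ℕ.+ n)) → y (2 ℕ.+ n) < √2 - 1#
      y<√2-1′ (inj₁ e≈1)      = ⊥-elim (lower (e≈1-e≈-1-⊥ _ e≈1 e≈-1))
      y<√2-1′ (inj₂ (_ , y<)) = y<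
      tie : ∣ q′ * α - p′ ∣ ≤ ∣ q * α - p ∣ → p′ * q ≈ p * q′
      tie a≤b with continuant-coordinates R.a R.ε (2 ℕ.+ n) H
      ... | t , u , tu , p′≈ , q′≈ =
        skipped-cross _ _ _ _ _ _ _ _ _ _ p′≈ q′≈ (proj₁ tu≈) (proj₂ tu≈) p≈ q≈
        where
        bounds = ∣ℓD∣≤∣mD∣⇒ (error≉0 R (2 ℕ.+ n))
          (error-coordinates _ _ _ _ _ _ _ _ _ _ _ p′≈ q′≈ (error-recursion R (2 ℕ.+ n)))
          (square-skipped _ _ _ (error-skipped _ _ _ _ _ _ _ _ _ p≈ q≈ e≈-1 (error-recursion R (2 ℕ.+ n))))
          (0≤√2x-1 _ √2<x) a≤b
        tu≈ = skipped-local √2<x x<1+√2 (0<quotient _ _ (ℛ.0<s n) (0<x⇒0<x⁻¹ (ℛ.0<s (suc n))))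
          (y<√2-1′ (sign-bound (suc n))) tu
          (0<N _ _ _ _ _ _ q′≈ (y*s≈s (suc n)) 0<q′ (ℛ.0<s (suc n)))
          (N≤1-√2y _ _ _ _ _ _ _ q′≈ (y*s≈s (suc n)) q′≤q q≈ (ℛ.0<s (suc n)))
          (L-subst≥ _ _ _ _ _ e≈-1 (proj₁ bounds)) (L-subst≤ _ _ _ _ _ e≈-1 (proj₂ bounds))

    convergent⇒best : ∀ {p q} → IsNormalised p q →
                      (∃ λ i → p / q ≈ R.convergents i) ⊎
                      (∃ λ i → 1 ℕ.≤ i × p / q ≈ D.convergents i) →
                      IsBestApproximation α p q
    convergent⇒best (0<q , _ , _ , H) (inj₁ (i , p/q≈))
      with normalised-unique H (proj₂ (H₄-continuants R.a R.ε (suc i))) 0<q (ℛ.0<s i)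
             (≈⇒cross 0<q (R-value i) p/q≈)
    ... | r≈p , s≈q = rosen-best i 0<q (sym r≈p) (sym s≈q)
    -- The index being at least 1 makes y positive. At index 0 the skipped vector v₀ - √2 v₋₁ has
    -- the same denominator 1 as v₀ and a larger error.
    convergent⇒best (0<q , _ , _ , H) (inj₂ (suc i , ℕ.s≤s _ , p/q≈))
      with normalised-unique H (proj₂ (H₄-continuants D.a D.ε (2 ℕ.+ i))) 0<q (𝒟.0<s (suc i))
             (≈⇒cross 0<q (D-value (suc i)) p/q≈) | state R D (2 ℕ.+ i)
    ... | r≈p , s≈q | same _ _ _ W≈ _ _ =
      rosen-best (suc i) 0<q (trans (sym r≈p) (W≈ 0# 1#)) (trans (sym s≈q) (W≈ 1# 0#))
    ... | r≈p , s≈q | split _ _ e≈-1 √2<x x<1+√2 _ W≈ _ =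
      skipped-best i 0<q e≈-1 √2<x x<1+√2
        (trans (sym r≈p) (W≈ 0# 1#)) (trans (sym s≈q) (W≈ 1# 0#))

    private
      between : ∀ {p q} → IsNormalised p q → ∃ λ n → s (2 ℕ.+ n) ≤ q × q < s (3 ℕ.+ n)
      between {p} {q} (0<q , _ , _ , H) with mixed-bounded (H₄-column H)
      ... | k , q<1+k with ℛ.s-unbounded k
      -- The search starts at the Rosen denominator 1, which no normalised denominator falls below.
      ... | m , 1+k≤s = crossing (λ n → s (2 ℕ.+ n)) q m
              (≈-≤ _ _ _ ℛ.s₂≈1 (mixed≥1 (H₄-column H) 0<q)) (<-≤-trans _ _ _ q<1+k 1+k≤s)

      -- The conclusion of `minimal-local` contradicts the last component of `same`, so the state is
      -- `split`, and its dual vector has precisely the coordinates (-√2 , 1).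
      dual-at : ∀ n {p q t u} → 0# < q → State R D (2 ℕ.+ n) →
                p ≈ t * r (2 ℕ.+ n) + u * r (3 ℕ.+ n) →
                q ≈ t * s (2 ℕ.+ n) + u * s (3 ℕ.+ n) →
                e R (2 ℕ.+ n) ≈ - 1# × t ≈ - √2 × u ≈ 1# × x (2 ℕ.+ n) < 1# + √2 →
                p / q ≈ D.convergents (suc n)
      dual-at n 0<q (same _ _ _ _ _ (inj₁ e≈1)) _ _ (e≈-1 , _) =
        ⊥-elim (lower (e≈1-e≈-1-⊥ _ e≈1 e≈-1))
      dual-at n 0<q (same _ _ _ _ _ (inj₂ 1+√2≤x)) _ _ (_ , _ , _ , x<1+√2) =
        ⊥-elim (lower (1+√2≤x-x<1+√2-⊥ _ 1+√2≤x x<1+√2))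
      dual-at n 0<q (split _ _ _ _ _ _ W≈ _) p≈ q≈ (_ , t≈ , u≈ , _) =
        cross⇒value 0<q (𝒟.0<s (suc n)) (D-value (suc n)) (cross-≈ _ _ _ _
          (coordinates-dual _ _ _ _ _ _ p≈ t≈ u≈ (W≈ 0# 1#))
          (coordinates-dual _ _ _ _ _ _ q≈ t≈ u≈ (W≈ 1# 0#)))

      p/q*q≈p : ∀ {p q} → 0# < q → p / q * q ≈ p
      p/q*q≈p 0<q = p*i*q≈p _ _ _ (q*q⁻¹≈1 0<q)

      -- The competitor is the Rosen convergent of index n, whose denominator does not exceed q. A
      -- best approximation different from it is strictly nearer, which is the error bound of
      -- `minimal-local`.
      skipped : ∀ {p q} → IsNormalised p q → IsBestApproximation α p q →
                ∀ n → s (2 ℕ.+ n) ≤ q → q < s (3 ℕ.+ n) →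
                ¬ (p * s (2 ℕ.+ n) ≈ r (2 ℕ.+ n) * q) → p / q ≈ D.convergents (suc n)
      skipped {p} {q} (0<q , _ , _ , H) best n s≤q q<s ps≉rq
        with continuant-coordinates R.a R.ε (2 ℕ.+ n) H
      ... | t , u , tu , p≈ , q≈ = dual-at n 0<q (state R D (2 ℕ.+ n)) p≈ q≈
        (minimal-local √2<x (0<quotient _ _ (ℛ.0<s n) (0<x⇒0<x⁻¹ (ℛ.0<s (suc n))))
          (sign-bound (suc n)) tu
          (y≤N _ _ _ _ _ _ q≈ (y*s≈s (suc n)) s≤q (ℛ.0<s (suc n)))
          (N<1 _ _ _ _ _ _ q≈ (y*s≈s (suc n)) q<s (ℛ.0<s (suc n)))
          (proj₁ bounds) (proj₂ bounds))
        where
        √2<x = ℛ.√2<x (suc n)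
        bounds = ∣ℓD∣<∣mD∣⇒ (error≉0 R (2 ℕ.+ n))
          (error-coordinates _ _ _ _ _ _ _ _ _ _ _ p≈ q≈ (error-recursion R (2 ℕ.+ n)))
          (square-previous _ _ _ _ (error-recursion R (2 ℕ.+ n)) (signs-square R.ε (2 ℕ.+ n)))
          (inj₁ (0<tail R (suc n)))
          (best _ _ (R-normalised n)
            (λ r/s≈p/q → ps≉rq (sym (≈⇒cross (ℛ.0<s n) (p/q*q≈p 0<q) r/s≈p/q))) s≤q)

    best⇒convergent : ∀ {p q} → IsNormalised p q → IsBestApproximation α p q →
                      (∃ λ i → p / q ≈ R.convergents i) ⊎
                      (∃ λ i → 1 ℕ.≤ i × p / q ≈ D.convergents i)
    best⇒convergent {p} {q} pq@(0<q , _ , _ , H) best with between pq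
    ... | n , s≤q , q<s with compare (p * s (2 ℕ.+ n)) (r (2 ℕ.+ n) * q)
    ... | tri≈ _ ps≈rq _ = inj₁ (n , cross⇒value 0<q (ℛ.0<s n) (R-value n) ps≈rq)
    ... | tri< _ ps≉rq _ =
      inj₂ (suc n , ℕ.s≤s ℕ.z≤n , skipped pq best n s≤q q<s ps≉rq)
    ... | tri> _ ps≉rq _ =
      inj₂ (suc n , ℕ.s≤s ℕ.z≤n , skipped pq best n s≤q q<s ps≉rq)

theorem1p4 : ∀ {c ℓ} (ℝ : CompleteOrderedField c ℓ) →
    let open CompleteOrderedField ℝ in
    (√2 : Carrier) → 0# < √2 → √2 * √2 ≈ 1# + 1# →
    let open Hecke ℝ √2 in
    (α : Carrier) → ¬ (α ∈ℚH₄) →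
    (R : RosenExpansion α) (D : DualRosenExpansion α) →
    let open Expansion in
    (p q : Carrier) → IsNormalised p q →
    IsBestApproximation α p q ⇔
    ((∃ λ i → p / q ≈ convergents R i) ⊎
    (∃ λ i → 1 ℕ.≤ i × p / q ≈ convergents D i))
theorem1p4 ℝ √2 0<√2 √2*√2≈2 α _ R D p q pq =
  mk⇔ (best⇒convergent R D pq) (convergent⇒best R D pq)
  where open BestApproximation ℝ √2 0<√2 √2*√2≈2
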